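{- Let $s,t\geq 1$ be integers and let $p,q,l$ be three distinct primes with $p,q$ odd, $p\equiv 3 \pmod 4$, $\mathrm{ord}_{p^s}(l)=\phi(p^s)/2$, $\mathrm{ord}_{q^t}(l)=\phi(q^t)$ and $\gcd(\phi(p^s),\phi(q^t))=2$. Let $0\leq i<i'\leq s-1$ and $0\leq j\leq t-1$. Then in the ring $\mathbb{F}_l[x]/\langle x^{p^sq^t}-1\rangle$: (i) If $q$ is a quadratic residue modulo $p$, then \[\chi_{ij}\chi_{i'j}=\frac{\phi(p^{s-i'})}{2}(q-2)q^{t-j-1}\chi_{ij}+\frac{\phi(p^{s-i'})}{2}\phi(q^{t-j})\sum_{j<m\leq t}\chi_{im}.\] (ii) If $q$ is a quadratic nonresidue modulo $p$, then \[ \chi_{ij}\chi_{i'j}=\frac{\phi(p^{s-i'})}{2}(q-2)q^{t-j-1}\chi_{ij}+\frac{\phi(p^{s-i'})}{2}\phi(q^{t-j})\Big(\sum_{\substack{j<m\leq t\\2\nmid m-j}}\chi_{im}^*+\sum_{\substack{j<m\leq t\\2\mid m-j}}\chi_{im}\Big). \]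
   Context: Here $\phi$ is Euler's phi function (with $\phi(1)=1$) and $\mathrm{ord}_m(k)$ is the multiplicative order of $k$ modulo $m$. Put $n=p^sq^t$. Fix an integer $g$ that is a primitive root both modulo $p^s$ and modulo $q^t$. For an integer $\gamma$, $C_\gamma=\{\gamma l^r \bmod n: r\geq 0\}\subseteq \mathbb{Z}_n$ is the $l$-cyclotomic coset modulo $n$ containing $\gamma$. For $0\leq i\leq s$, $0\leq j\leq t$ set $C_{ij}=C_{p^iq^j}$ and $C_{ij}^*=C_{p^iq^jg}$. Define elements of $\mathbb{F}_l[x]/\langle x^{n}-1\rangle$ by $\chi_{ij}=\sum_{\alpha\in C_{ij}}x^\alpha$ and $\chi_{ij}^*=\sum_{\alpha\in C_{ij}^*}x^\alpha$. Integer coefficients are read in $\mathbb{F}_l$, and empty sums are $0$. -}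

module Defs where

open import Algebra.Bundles using (CommutativeRing)
open import Data.Fin.Base as Fin using (Fin; toℕ; fromℕ<)
open import Data.Fin.Properties using (any?; toℕ<n; toℕ-fromℕ<; pigeonhole)
open import Data.Integer.Base as ℤ using (ℤ; +_; -_; 0ℤ; 1ℤ)
import Data.Integer.Properties as ℤₚ
open import Data.Integer.DivMod using (_%ℕ_; _/ℕ_; n%ℕd<d; a≡a%ℕn+[a/ℕn]*n)
open import Data.Integer.Divisibility.Signed
  using (_∣_; divides; _∣?_; ∣m⇒∣-m; ∣m∣n⇒∣m+n; ∣n⇒∣m*n; ∣m⇒∣m*n)
open import Data.Integer.Tactic.RingSolver using (solve-∀)
open import Data.List.Base
  using (List; []; _∷_; _++_; map; foldr; filter; length; replicate; upTo; allFin)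
open import Data.Nat.Base as ℕ using (ℕ; zero; suc; _<_; _≤_)
import Data.Nat.Divisibility as ℕ∣
import Data.Nat.Properties as ℕₚ
open import Data.Nat.Coprimality using (coprime?)
open import Data.Nat.Induction using (<-rec)
open import Data.Integer.Coprimality using (Coprime)
open import Data.Product using (∃; _×_; _,_)
open import Level using (0ℓ; _⊔_)
open import Relation.Binary.PropositionalEquality
  using (_≡_; refl; sym; trans; cong; cong₂; subst)
open import Relation.Nullary using (¬_; yes; no)
open import Relation.Nullary.Decidable using (map′; ¬?)
open import Relation.Unary using (Pred; Decidable)

infix 4 _≡_[mod_]

_≡_[mod_] : ℤ → ℤ → ℕ → Set
a ≡ b [mod m ] = + m ∣ a ℤ.- b

mod-reflexive : ∀ {m a b} → a ≡ b → a ≡ b [mod m ]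
mod-reflexive {a = a} refl = divides 0ℤ (ℤₚ.+-inverseʳ a)

mod-sym : ∀ {m a b} → a ≡ b [mod m ] → b ≡ a [mod m ]
mod-sym {a = a} {b} p = subst (_ ∣_) (lemma a b) (∣m⇒∣-m p)
  where
  lemma : ∀ a b → - (a ℤ.- b) ≡ b ℤ.- a
  lemma = solve-∀

mod-trans : ∀ {m a b c} → a ≡ b [mod m ] → b ≡ c [mod m ] → a ≡ c [mod m ]
mod-trans {a = a} {b} {c} p q = subst (_ ∣_) (lemma a b c) (∣m∣n⇒∣m+n p q)
  where
  lemma : ∀ a b c → (a ℤ.- b) ℤ.+ (b ℤ.- c) ≡ a ℤ.- c
  lemma = solve-∀

mod-+-cong : ∀ {m a b c d} → a ≡ b [mod m ] → c ≡ d [mod m ] →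
             a ℤ.+ c ≡ b ℤ.+ d [mod m ]
mod-+-cong {a = a} {b} {c} {d} p q = subst (_ ∣_) (lemma a b c d) (∣m∣n⇒∣m+n p q)
  where
  lemma : ∀ a b c d → (a ℤ.- b) ℤ.+ (c ℤ.- d) ≡ (a ℤ.+ c) ℤ.- (b ℤ.+ d)
  lemma = solve-∀

mod-neg-cong : ∀ {m a b} → a ≡ b [mod m ] → - a ≡ - b [mod m ]
mod-neg-cong {a = a} {b} p = subst (_ ∣_) (lemma a b) (∣m⇒∣-m p)
  where
  lemma : ∀ a b → - (a ℤ.- b) ≡ - a ℤ.- - b
  lemma = solve-∀

mod-*-cong : ∀ {m a b c d} → a ≡ b [mod m ] → c ≡ d [mod m ] →
             a ℤ.* c ≡ b ℤ.* d [mod m ]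
mod-*-cong {a = a} {b} {c} {d} p q =
  subst (_ ∣_) (lemma a b c d) (∣m∣n⇒∣m+n (∣m⇒∣m*n c p) (∣n⇒∣m*n b q))
  where
  lemma : ∀ a b c d → (a ℤ.- b) ℤ.* c ℤ.+ b ℤ.* (c ℤ.- d) ≡ a ℤ.* c ℤ.- b ℤ.* d
  lemma = solve-∀

φ : ℕ → ℕ
φ n = length (filter (λ k → coprime? k n) (map suc (upTo n)))

-- ord_m(k) = d.  As k ^ d ≡ 1 with d positive, this entails that k is a unit
-- modulo m.
HasOrder : (m : ℕ) (k : ℤ) (d : ℕ) → Set
HasOrder m k d =
  0 < d × k ℤ.^ d ≡ 1ℤ [mod m ] ×
  (∀ e → 0 < e → k ℤ.^ e ≡ 1ℤ [mod m ] → d ≤ e)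

PrimitiveRoot : (g : ℤ) (m : ℕ) → Set
PrimitiveRoot g m = HasOrder m g (φ m)

QuadraticResidue : (a : ℤ) (m : ℕ) → Set
QuadraticResidue a m = Coprime a (+ m) × ∃ λ x → x ℤ.* x ≡ a [mod m ]

QuadraticNonresidue : (a : ℤ) (m : ℕ) → Set
QuadraticNonresidue a m = Coprime a (+ m) × ¬ ∃ λ x → x ℤ.* x ≡ a [mod m ]

-- ℤ/lℤ: integers, with congruence modulo l as the setoid equality.
-- An integer is thus its own image in ℤ/lℤ.  For l prime this is 𝔽_l.
𝔽 : ℕ → CommutativeRing 0ℓ 0ℓ
𝔽 l = record
  { Carrier = ℤ
  ; _≈_     = λ a b → a ≡ b [mod l ]
  ; _+_     = ℤ._+_
  ; _*_     = ℤ._*_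
  ; -_      = -_
  ; 0#      = 0ℤ
  ; 1#      = 1ℤ
  ; isCommutativeRing = record
    { isRing = record
      { +-isAbelianGroup = record
        { isGroup = record
          { isMonoid = record
            { isSemigroup = record
              { isMagma = record
                { isEquivalence = record
                  { refl  = λ {a} → mod-reflexive {l} {a} refl
                  ; sym   = λ {a} {b} → mod-sym {l} {a} {b}
                  ; trans = λ {a} {b} {c} → mod-trans {l} {a} {b} {c}
                  }
                ; ∙-cong = λ {a} {b} {c} {d} → mod-+-cong {l} {a} {b} {c} {d}
                }
              ; assoc = λ a b c → mod-reflexive (ℤₚ.+-assoc a b c)
              }
            ; identity = (λ a → mod-reflexive (ℤₚ.+-identityˡ a))
                       , (λ a → mod-reflexive (ℤₚ.+-identityʳ a))
            }
          ; inverse = (λ a → mod-reflexive (ℤₚ.+-inverseˡ a))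
                    , (λ a → mod-reflexive (ℤₚ.+-inverseʳ a))
          ; ⁻¹-cong = λ {a} {b} → mod-neg-cong {l} {a} {b}
          }
        ; comm = λ a b → mod-reflexive (ℤₚ.+-comm a b)
        }
      ; *-cong     = λ {a} {b} {c} {d} → mod-*-cong {l} {a} {b} {c} {d}
      ; *-assoc    = λ a b c → mod-reflexive (ℤₚ.*-assoc a b c)
      ; *-identity = (λ a → mod-reflexive (ℤₚ.*-identityˡ a))
                   , (λ a → mod-reflexive (ℤₚ.*-identityʳ a))
      ; distrib    = (λ a b c → mod-reflexive (ℤₚ.*-distribˡ-+ a b c))
                   , (λ a b c → mod-reflexive (ℤₚ.*-distribʳ-+ a b c))
      }
    ; *-comm = λ a b → mod-reflexive (ℤₚ.*-comm a b)
    }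
  }

module Polynomial {c ℓ} (R : CommutativeRing c ℓ) where
  private module R = CommutativeRing R

  -- Coefficients in order of increasing degree; trailing zeros are permitted,
  -- so polynomials are compared by _≈_, not by _≡_.
  Poly : Set c
  Poly = List R.Carrier

  coeff : Poly → ℕ → R.Carrier
  coeff []      k       = R.0#
  coeff (a ∷ f) zero    = a
  coeff (a ∷ f) (suc k) = coeff f k

  infix  4 _≈_
  infixl 6 _+_ _-_
  infixl 7 _*_
  infixr 8 _•_
  infix  9 X^_

  _≈_ : Poly → Poly → Set ℓ
  f ≈ g = ∀ k → coeff f k R.≈ coeff g k

  _+_ : Poly → Poly → Poly
  []      + g       = g
  (a ∷ f) + []      = a ∷ f
  (a ∷ f) + (b ∷ g) = (a R.+ b) ∷ (f + g)

  _•_ : R.Carrier → Poly → Poly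
  r • f = map (r R.*_) f

  _-_ : Poly → Poly → Poly
  f - g = f + map (R.-_) g

  _*_ : Poly → Poly → Poly
  []      * g = []
  (a ∷ f) * g = a • g + (R.0# ∷ f * g)

  X^_ : ℕ → Poly
  X^ n = replicate n R.0# ++ R.1# ∷ []

  1ₚ : Poly
  1ₚ = X^ 0

  ∑ : {I : Set} → List I → (I → Poly) → Poly
  ∑ is f = foldr _+_ [] (map f is)

  infix 4 _≈_⟨mod_⟩

  -- Equality of residue classes in the quotient by the ideal generated by h.
  _≈_⟨mod_⟩ : Poly → Poly → Poly → Set (c ⊔ ℓ)
  f ≈ g ⟨mod h ⟩ = ∃ λ k → f - g ≈ k * h

-- The l-cyclotomic coset of γ modulo n.  Fin n plays the role of ℤ_n, each
-- residue class being given by its least nonnegative representative.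
C : (n l : ℕ) → ℤ → Pred (Fin n) 0ℓ
C n l γ α = ∃ λ r → + toℕ α ≡ γ ℤ.* (+ l) ℤ.^ r [mod n ]

-- Membership is decidable because the powers γ l ^ r with r < n already
-- represent every element of the coset.
module _ (n l : ℕ) .{{_ : ℕ.NonZero n}} (γ : ℤ) where
  private
    u : ℕ → ℤ
    u r = γ ℤ.* (+ l) ℤ.^ r

    u-+ : ∀ a k → u (a ℕ.+ k) ≡ u a ℤ.* (+ l) ℤ.^ k
    u-+ a k = trans (cong (γ ℤ.*_) (ℤₚ.^-distribˡ-+-* (+ l) a k))
                    (sym (ℤₚ.*-assoc γ ((+ l) ℤ.^ a) ((+ l) ℤ.^ k)))

    u%n : Fin (suc n) → Fin n
    u%n r = fromℕ< (n%ℕd<d (u (toℕ r)) n)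

    %-≡⇒mod : ∀ a b → a %ℕ n ≡ b %ℕ n → a ≡ b [mod n ]
    %-≡⇒mod a b eq = divides (a /ℕ n ℤ.- b /ℕ n)
      (trans (cong₂ ℤ._-_ (trans (a≡a%ℕn+[a/ℕn]*n a n)
                                 (cong (λ z → + z ℤ.+ (a /ℕ n) ℤ.* + n) eq))
                          (a≡a%ℕn+[a/ℕn]*n b n))
             (lemma (+ (b %ℕ n)) (a /ℕ n) (b /ℕ n) (+ n)))
      where
      lemma : ∀ z x y m → (z ℤ.+ x ℤ.* m) ℤ.- (z ℤ.+ y ℤ.* m) ≡ (x ℤ.- y) ℤ.* m
      lemma = solve-∀

    earlier : ∀ r → n ≤ r → ∃ λ r′ → r′ < r × u r ≡ u r′ [mod n ]
    earlier r n≤r with pigeonhole (ℕₚ.n<1+n n) u%n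
    ... | i , j , i<j , eq = a ℕ.+ k , a+k<r , step
      where
      a = toℕ i
      b = toℕ j
      k = r ℕ.∸ b
      b≤r : b ≤ r
      b≤r = ℕₚ.≤-trans (ℕₚ.≤-pred (toℕ<n j)) n≤r
      a+k<r : a ℕ.+ k < r
      a+k<r = subst (a ℕ.+ k <_) (ℕₚ.m+[n∸m]≡n b≤r) (ℕₚ.+-monoˡ-< k i<j)
      ua%≡ub% : u a %ℕ n ≡ u b %ℕ n
      ua%≡ub% = trans (sym (toℕ-fromℕ< (n%ℕd<d (u a) n)))
                      (trans (cong toℕ eq) (toℕ-fromℕ< (n%ℕd<d (u b) n)))
      step : u r ≡ u (a ℕ.+ k) [mod n ]
      step = subst (λ z → z ≡ u (a ℕ.+ k) [mod n ])
        (trans (sym (u-+ b k)) (cong u (ℕₚ.m+[n∸m]≡n b≤r)))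
        (subst (λ z → u b ℤ.* (+ l) ℤ.^ k ≡ z [mod n ]) (sym (u-+ a k))
          (mod-*-cong {n} {u b} {u a} (%-≡⇒mod (u b) (u a) (sym ua%≡ub%))
                      (mod-reflexive {a = (+ l) ℤ.^ k} refl)))

  bounded-exponent : ∀ r → ∃ λ (r′ : Fin n) →
                     γ ℤ.* (+ l) ℤ.^ r ≡ γ ℤ.* (+ l) ℤ.^ toℕ r′ [mod n ]
  bounded-exponent = <-rec _ go
    where
    go : ∀ r → (∀ {r₁} → r₁ < r → ∃ λ (r′ : Fin n) → u r₁ ≡ u (toℕ r′) [mod n ]) →
         ∃ λ (r′ : Fin n) → u r ≡ u (toℕ r′) [mod n ]
    go r rec with r ℕₚ.<? n
    ... | yes r<n = fromℕ< r<n , mod-reflexive (cong u (sym (toℕ-fromℕ< r<n)))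
    ... | no  r≮n with earlier r (ℕₚ.≮⇒≥ r≮n)
    ...   | r₁ , r₁<r , e with rec r₁<r
    ...     | r′ , e′ = r′ , mod-trans {n} {u r} {u r₁} e e′

C? : ∀ n l γ → Decidable (C n l γ)
C? (suc n) l γ α = map′
  (λ (r , e) → toℕ r , e)
  (λ (r , e) → let (r′ , e′) = bounded-exponent (suc n) l γ r in
    r′ , mod-trans {suc n} {+ toℕ α} {γ ℤ.* (+ l) ℤ.^ r} e e′)
  (any? λ r → + suc n ∣? + toℕ α ℤ.- γ ℤ.* (+ l) ℤ.^ toℕ r)

module Cosets (p q s t l : ℕ) (g : ℤ) where
  open Polynomial (𝔽 l) public

  n : ℕ
  n = p ℕ.^ s ℕ.* q ℕ.^ t

  X^n-1 : Poly
  X^n-1 = X^ n - 1ₚ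

  χ[_] : ℤ → Poly
  χ[ γ ] = ∑ (filter (C? n l γ) (allFin n)) (λ α → X^ toℕ α)

  χ : ℕ → ℕ → Poly
  χ i j = χ[ + (p ℕ.^ i ℕ.* q ℕ.^ j) ]

  χ* : ℕ → ℕ → Poly
  χ* i j = χ[ + (p ℕ.^ i ℕ.* q ℕ.^ j) ℤ.* g ]

⦅_,_⟧ : ℕ → ℕ → List ℕ
⦅ j , t ⟧ = filter (j ℕₚ.<?_) (upTo (suc t))

⦅_,_⟧-even : ℕ → ℕ → List ℕ
⦅ j , t ⟧-even = filter (λ m → 2 ℕ∣.∣? (m ℕ.∸ j)) ⦅ j , t ⟧

⦅_,_⟧-odd : ℕ → ℕ → List ℕ
⦅ j , t ⟧-odd = filter (λ m → ¬? (2 ℕ∣.∣? (m ℕ.∸ j))) ⦅ j , t ⟧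

{-# OPTIONS --safe #-}
-- The order φ(p^s)/2 of l modulo p^s is odd because p ≡ 3 mod 4.  Hence −1 is not a power of l, every
-- unit modulo p^s is ± a power of l, and the signs of q and g are read off their residuacity.  The
-- orders of l modulo p^s and q^t are coprime and l generates the units modulo q^t, so the coset of
-- γ = p^i q^m u consists of the z with q-adic valuation m (capped at t) whose residue modulo p^s lies in
-- γ⟨l⟩.  Adding an element of p^i′ q^j⟨l⟩, where i′ > i, maps p^i q^j⟨l⟩ to itself modulo p^s.  The
-- coefficient of the product at x^w therefore vanishes unless w lies in p^i q^j⟨l⟩ modulo p^s, and
-- otherwise it counts the y in p^i′ q^j⟨l⟩ such that y and w − y both have valuation j; this is an
-- inclusion–exclusion over divisibility by q^j and q^(j+1).  The answer depends only on whether w has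
-- valuation j or more, and the w of valuation m > j form the coset of p^i q^m or of p^i q^m g, whichever
-- agrees with p^i q^j modulo p^s up to powers of l.

module Submission where

open import Defs
open import Algebra.Bundles using (CommutativeMonoid)
open import Data.Bool.Base using (true; false; if_then_else_)
import Data.Fin.Base as Fin
import Data.Fin.Properties as Finₚ
import Data.Integer.Coprimality as ℤᶜ
import Data.Integer.DivMod as ℤᵈ
open import Data.Integer.Divisibility.Signed as ℤ∣ using (divides)
import Data.Integer.Properties as ℤₚ
open import Data.Integer as ℤ using (ℤ; +_; -[1+_]; 0ℤ; 1ℤ; ∣_∣)
open import Data.Integer.Tactic.RingSolver using (solve-∀)
open import Data.List.Base
  using (List; []; _∷_; map; upTo; filter; lookup; length; foldr; allFin; tabulate; applyUpTo)
open import Data.List.Membership.Propositional using (_∈_)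
import Data.List.Membership.Propositional.Properties as ∈ₚ
open import Data.List.Relation.Unary.All as All using (All; []; _∷_)
import Data.List.Relation.Unary.All.Properties as Allₚ
open import Data.List.Relation.Unary.Any using (index)
import Data.List.Relation.Unary.Any.Properties as Anyₚ
import Data.Nat.Coprimality as ℕᶜ
import Data.Nat.Divisibility as ℕ∣
import Data.Nat.DivMod as ℕᵈ
open import Data.Nat.GCD using (gcd; gcd-greatest; module Bézout)
open import Data.Nat as ℕ using (ℕ; zero; suc)
open import Data.Nat.Primality as Prime using (Prime)
import Data.Nat.Properties as ℕₚ
open import Data.Product using (∃; _×_; _,_; proj₁; proj₂)
open import Data.Sum as Sum using (_⊎_; inj₁; inj₂; [_,_]′)
open import Function using (_∘_; id)
open import Level using (0ℓ)
open import Relation.Binary.Bundles using (Setoid)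
open import Relation.Binary.PropositionalEquality
  using (_≡_; _≢_; refl; sym; trans; cong; cong₂; subst; subst₂; module ≡-Reasoning)
import Relation.Binary.Reasoning.Setoid as SetoidReasoning
open import Relation.Nullary using (¬_; Dec; does; yes; no; contradiction)
open import Relation.Nullary.Decidable using (map′; dec-true; dec-false; ¬?)
open import Relation.Unary using (Pred; Decidable)

-- The powers of l have index 2 among the units modulo p^s, and lying among them depends only on the
-- residue modulo p: every unit is plus or minus a power of l, and the two signs stay apart modulo
-- p. A summand with one more factor p therefore leaves the unit part of p^i q^j l^a a power of l;
-- this is where i < i′ enters. The constants come from counting classes. Multiples of q^j fall into
-- q classes modulo q^(j+1). For y and w - y both to have valuation exactly j, the classes of 0 and
-- of w are forbidden. These are two classes if w has valuation j, leaving q - 2, and a single class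
-- if w has larger valuation, leaving q - 1; each class holds q^(t-j-1) residues modulo q^t. The
-- factor φ(p^(s-i′))/2 is the number of residues modulo p^s in p^i′ q^j⟨l⟩, and the coprimality of
-- p^s and q^t makes the two counts multiply. The coefficients are thus computed once for both
-- cases; the residuacity of q decides only which coset carries the w of a given valuation m > j.

-- Congruences of integers.

module Congruence where
  open import Data.Integer.Base using (_+_; _*_; _-_; -_; _^_)

  infix 4 _≅_[_]

  -- A record, so that a, b and m can be inferred.
  record _≅_[_] (a b : ℤ) (m : ℕ) : Set where
    constructor congruent
    field difference : a ≡ b [mod m ]

  open _≅_[_] public

  private variable
    a b c d : ℤ
    m k : ℕ

  ≡⇒≅ : a ≡ b → a ≅ b [ m ]
  ≡⇒≅ {m = m} a≡b = congruent (mod-reflexive {m} a≡b)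

  ≅-refl : a ≅ a [ m ]
  ≅-refl = ≡⇒≅ refl

  ≅-sym : a ≅ b [ m ] → b ≅ a [ m ]
  ≅-sym {a} {b} {m} (congruent e) = congruent (mod-sym {m} {a} {b} e)

  ≅-trans : a ≅ b [ m ] → b ≅ c [ m ] → a ≅ c [ m ]
  ≅-trans {a} {b} {m} {c} (congruent e) (congruent f) =
    congruent (mod-trans {m} {a} {b} {c} e f)

  ≅-setoid : ℕ → Setoid 0ℓ 0ℓ
  ≅-setoid m = record
    { Carrier = ℤ
    ; _≈_ = _≅_[ m ]
    ; isEquivalence = record { refl = ≅-refl ; sym = ≅-sym ; trans = ≅-trans }
    }

  module ≅-Reasoning (m : ℕ) = SetoidReasoning (≅-setoid m)

  +-cong : a ≅ b [ m ] → c ≅ d [ m ] → a + c ≅ b + d [ m ]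
  +-cong {a} {b} {m} {c} {d} (congruent e) (congruent f) =
    congruent (mod-+-cong {m} {a} {b} {c} {d} e f)

  neg-cong : a ≅ b [ m ] → - a ≅ - b [ m ]
  neg-cong {a} {b} {m} (congruent e) = congruent (mod-neg-cong {m} {a} {b} e)

  -‿cong : a ≅ b [ m ] → c ≅ d [ m ] → a - c ≅ b - d [ m ]
  -‿cong e f = +-cong e (neg-cong f)

  *-cong : a ≅ b [ m ] → c ≅ d [ m ] → a * c ≅ b * d [ m ]
  *-cong {a} {b} {m} {c} {d} (congruent e) (congruent f) =
    congruent (mod-*-cong {m} {a} {b} {c} {d} e f)

  *-congˡ : ∀ c → a ≅ b [ m ] → c * a ≅ c * b [ m ]
  *-congˡ c = *-cong (≅-refl {c})

  ^-cong : ∀ n → a ≅ b [ m ] → a ^ n ≅ b ^ n [ m ]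
  ^-cong zero    e = ≅-refl
  ^-cong (suc n) e = *-cong e (^-cong n e)

  ≅-weaken : k ℕ∣.∣ m → a ≅ b [ m ] → a ≅ b [ k ]
  ≅-weaken {k} {m} k∣m (congruent e) = congruent (ℤ∣.∣-trans (ℤ∣.∣ᵤ⇒∣ k∣m) e)

  ∣⇒≅0 : + m ℤ∣.∣ a → a ≅ 0ℤ [ m ]
  ∣⇒≅0 {m} {a} m∣a = congruent (subst (+ m ℤ∣.∣_) (sym (ℤₚ.+-identityʳ a)) m∣a)

  ≅0⇒∣ : a ≅ 0ℤ [ m ] → + m ℤ∣.∣ a
  ≅0⇒∣ {a} {m} (congruent e) = subst (+ m ℤ∣.∣_) (ℤₚ.+-identityʳ a) e

  ∣-resp-≅ : a ≅ b [ m ] → + m ℤ∣.∣ a → + m ℤ∣.∣ b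
  ∣-resp-≅ a≅b = ≅0⇒∣ ∘ ≅-trans (≅-sym a≅b) ∘ ∣⇒≅0

  modulus≅0 : + m ≅ 0ℤ [ m ]
  modulus≅0 = ∣⇒≅0 ℤ∣.∣-refl

  *-cancelˡ-coprime : ∀ c {a b} → ℤᶜ.Coprime c (+ m) → c * a ≅ c * b [ m ] → a ≅ b [ m ]
  *-cancelˡ-coprime {m} c {a} {b} c⊥m (congruent e) = congruent
    (ℤ∣.∣ᵤ⇒∣ (ℤᶜ.coprime-divisor (+ m) c (a - b) (ℤᶜ.sym {c} {+ m} c⊥m)
      (ℤ∣.∣⇒∣ᵤ (subst (+ m ℤ∣.∣_) (lemma c a b) e))))
    where
    lemma : ∀ c a b → c * a - c * b ≡ c * (a - b)
    lemma = solve-∀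

  *-cancelˡ-modulus : ∀ k .{{_ : ℕ.NonZero k}} → + k * a ≅ + k * b [ k ℕ.* m ] → a ≅ b [ m ]
  *-cancelˡ-modulus {a} {b} {m} k@(suc _) (congruent e) = congruent
    (ℤ∣.*-cancelˡ-∣ (+ k) (subst₂ ℤ∣._∣_ (ℤₚ.pos-* k m) (lemma (+ k) a b) e))
    where
    lemma : ∀ c a b → c * a - c * b ≡ c * (a - b)
    lemma = solve-∀

  -- The uniqueness half of the Chinese remainder theorem. Existence never arises, since a suitable
  -- exponent of l is exhibited directly in `combine`.
  chinese-remainder : ∀ m n → ℕᶜ.Coprime m n →
                      a ≅ b [ m ] → a ≅ b [ n ] → a ≅ b [ m ℕ.* n ]
  chinese-remainder {a} {b} m n m⊥n (congruent (divides x e)) (congruent f) = congruent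
    (subst₂ ℤ∣._∣_ (trans (ℤₚ.*-comm (+ n) (+ m)) (sym (ℤₚ.pos-* m n)))
                   (sym e) (ℤ∣.*-monoˡ-∣ (+ m) n∣x))
    where
    n∣x : + n ℤ∣.∣ x
    n∣x = ℤ∣.∣ᵤ⇒∣ (ℤᶜ.coprime-divisor (+ n) (+ m) x (ℕᶜ.sym m⊥n)
            (ℤ∣.∣⇒∣ᵤ (subst (+ n ℤ∣.∣_) (trans e (ℤₚ.*-comm x (+ m))) f)))

  -- Bézout's identity over ℕ comes in two forms according to which side carries the 1, so the
  -- inverse is `+ x` in one and `- + x` in the other.
  inverse-∣∣ : ∀ a → ℤᶜ.Coprime a (+ m) → ∃ λ b → + ∣ a ∣ * b ≅ 1ℤ [ m ]
  inverse-∣∣ {m} a a⊥m with ℕᶜ.coprime-Bézout a⊥m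
  ... | Bézout.+- x y e = + x , congruent (divides (+ y) (begin
    + ∣ a ∣ * + x - 1ℤ      ≡⟨ cong (_- 1ℤ) (ℤₚ.*-comm (+ ∣ a ∣) (+ x)) ⟩
    + x * + ∣ a ∣ - 1ℤ      ≡⟨ cong (_- 1ℤ) (ℤₚ.pos-* x ∣ a ∣) ⟨
    + (x ℕ.* ∣ a ∣) - 1ℤ    ≡⟨ cong (λ z → + z - 1ℤ) e ⟨
    + (1 ℕ.+ y ℕ.* m) - 1ℤ  ≡⟨ cong (λ z → 1ℤ + z - 1ℤ) (ℤₚ.pos-* y m) ⟩
    1ℤ + + y * + m - 1ℤ     ≡⟨ lemma (+ y * + m) ⟩
    + y * + m               ∎))
    where
    open ≡-Reasoning
    lemma : ∀ z → 1ℤ + z - 1ℤ ≡ z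
    lemma = solve-∀
  ... | Bézout.-+ x y e = - + x , congruent (divides (- + y) (begin
    + ∣ a ∣ * - + x - 1ℤ      ≡⟨ lemma (+ ∣ a ∣) (+ x) ⟩
    - (1ℤ + + x * + ∣ a ∣)    ≡⟨ cong (λ z → - (1ℤ + z)) (ℤₚ.pos-* x ∣ a ∣) ⟨
    - + (1 ℕ.+ x ℕ.* ∣ a ∣)   ≡⟨ cong (λ z → - + z) e ⟩
    - + (y ℕ.* m)             ≡⟨ cong -_ (ℤₚ.pos-* y m) ⟩
    - (+ y * + m)             ≡⟨ ℤₚ.neg-distribˡ-* (+ y) (+ m) ⟩
    - + y * + m               ∎))
    where
    open ≡-Reasoning
    lemma : ∀ a x → a * - x - 1ℤ ≡ - (1ℤ + x * a)
    lemma = solve-∀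

  inverse : ∀ a → ℤᶜ.Coprime a (+ m) → ∃ λ b → a * b ≅ 1ℤ [ m ]
  inverse {m} a a⊥m with inverse-∣∣ a a⊥m | ℤₚ.+∣i∣≡i⊎+∣i∣≡-i a
  ... | b , e | inj₁ p = b , subst (λ z → z * b ≅ 1ℤ [ m ]) p e
  ... | b , e | inj₂ p = - b , ≅-trans (≡⇒≅ (trans (lemma a b) (cong (_* b) (sym p)))) e
    where
    lemma : ∀ a b → a * - b ≡ - a * b
    lemma = solve-∀

  unit⇒coprime : ∀ a b → a * b ≅ 1ℤ [ m ] → ℤᶜ.Coprime a (+ m)
  unit⇒coprime {m} a b (congruent e) {d} (d∣a , d∣m) =
    ℕ∣.∣1⇒≡1 (ℤ∣.∣⇒∣ᵤ {+ d} {1ℤ} (subst (+ d ℤ∣.∣_) (lemma (a * b))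
      (ℤ∣.∣m∣n⇒∣m-n (ℤ∣.∣m⇒∣m*n b (ℤ∣.∣ᵤ⇒∣ {+ d} {a} d∣a))
                    (ℤ∣.∣-trans (ℤ∣.∣ᵤ⇒∣ {+ d} {+ m} d∣m) e))))
    where
    lemma : ∀ z → z - (z - 1ℤ) ≡ 1ℤ
    lemma = solve-∀

  ≅-remainder : ∀ a m .{{_ : ℕ.NonZero m}} → a ≅ + (a ℤᵈ.%ℕ m) [ m ]
  ≅-remainder a m = congruent (divides (a ℤᵈ./ℕ m)
    (trans (cong (_- r) (ℤᵈ.a≡a%ℕn+[a/ℕn]*n a m)) (lemma r (a ℤᵈ./ℕ m * + m))))
    where
    r = + (a ℤᵈ.%ℕ m)
    lemma : ∀ r z → r + z - r ≡ z
    lemma = solve-∀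

  ≅⇒≡-below : ∀ {x y} → x ℕ.< m → y ℕ.< m → + x ≅ + y [ m ] → x ≡ y
  ≅⇒≡-below {m} {x} {y} x<m y<m (congruent e) = ℤₚ.+-injective
    (ℤₚ.i-j≡0⇒i≡j (+ x) (+ y) (ℤₚ.∣i∣≡0⇒i≡0 (small ∣ + x - + y ∣ (ℤ∣.∣⇒∣ᵤ e)
      (subst (ℕ._< m) (cong ∣_∣ (sym (ℤₚ.m-n≡m⊖n x y)))
        (ℕₚ.≤-<-trans (ℤₚ.∣m⊝n∣≤m⊔n x y) (ℕₚ.⊔-lub x<m y<m))))))
    where
    small : ∀ z → m ℕ∣.∣ z → z ℕ.< m → z ≡ 0
    small zero    _   _   = refl
    small (suc z) m∣z z<m = contradiction m∣z (ℕ∣.>⇒∤ z<m)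

-- Multiplicative order and primitive roots.

module Order where
  open Congruence
  open import Data.Integer.Base using (_*_; _-_; _^_)

  ^-1 : ∀ {k m} v → k ≅ 1ℤ [ m ] → k ^ v ≅ 1ℤ [ m ]
  ^-1 v e = ≅-trans (^-cong v e) (≡⇒≅ (ℤₚ.^-zeroˡ v))

  module _ m k d (ord : HasOrder m k d) where
    order>0 : 0 ℕ.< d
    order>0 = proj₁ ord

    ^order≅1 : k ^ d ≅ 1ℤ [ m ]
    ^order≅1 = congruent (proj₁ (proj₂ ord))

    order-minimal : ∀ e → 0 ℕ.< e → k ^ e ≅ 1ℤ [ m ] → d ℕ.≤ e
    order-minimal e e>0 (congruent c) = proj₂ (proj₂ ord) e e>0 c

    ^[order*]≅1 : ∀ v → k ^ (d ℕ.* v) ≅ 1ℤ [ m ]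
    ^[order*]≅1 v = ≅-trans (≡⇒≅ (sym (ℤₚ.^-*-assoc k d v))) (^-1 v ^order≅1)

    ^-period : ∀ r v → k ^ (r ℕ.+ d ℕ.* v) ≅ k ^ r [ m ]
    ^-period r v = begin
      k ^ (r ℕ.+ d ℕ.* v)  ≡⟨ ℤₚ.^-distribˡ-+-* k r (d ℕ.* v) ⟩
      k ^ r * k ^ (d ℕ.* v)  ≈⟨ *-congˡ (k ^ r) (^[order*]≅1 v) ⟩
      k ^ r * 1ℤ            ≡⟨ ℤₚ.*-identityʳ (k ^ r) ⟩
      k ^ r                 ∎
      where open ≅-Reasoning m

    -- r + r (d − 1) = d r, so k ^ (r (d − 1)) is an inverse of k ^ r.
    ^-inverse : ∀ r → k ^ r * k ^ (r ℕ.* ℕ.pred d) ≅ 1ℤ [ m ]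
    ^-inverse r = ≅-trans (≡⇒≅ (begin
      k ^ r * k ^ (r ℕ.* ℕ.pred d)  ≡⟨ ℤₚ.^-distribˡ-+-* k r (r ℕ.* ℕ.pred d) ⟨
      k ^ (r ℕ.+ r ℕ.* ℕ.pred d)    ≡⟨ cong (k ^_) (ℕₚ.*-suc r (ℕ.pred d)) ⟨
      k ^ (r ℕ.* suc (ℕ.pred d))    ≡⟨ cong (λ z → k ^ (r ℕ.* z)) (ℕₚ.suc-pred d {{ℕ.>-nonZero order>0}}) ⟩
      k ^ (r ℕ.* d)                 ≡⟨ cong (k ^_) (ℕₚ.*-comm r d) ⟩
      k ^ (d ℕ.* r)                 ∎)) (^[order*]≅1 r)
      where open ≡-Reasoning

    ^-coprime : ∀ r → ℤᶜ.Coprime (k ^ r) (+ m)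
    ^-coprime r = unit⇒coprime (k ^ r) (k ^ (r ℕ.* ℕ.pred d)) (^-inverse r)

    order∣ : ∀ e → k ^ e ≅ 1ℤ [ m ] → d ℕ∣.∣ e
    order∣ e k^e≅1 with e ℕᵈ.% d in eq
      where instance _ = ℕ.>-nonZero order>0
    ... | zero  = ℕ∣.m%n≡0⇒n∣m e d {{ℕ.>-nonZero order>0}} eq
    ... | suc r = contradiction (order-minimal (suc r) ℕ.z<s k^r≅1)
                    (ℕₚ.<⇒≱ (subst (ℕ._< d) eq (ℕᵈ.m%n<n e d)))
      where
      instance _ = ℕ.>-nonZero order>0
      k^r≅1 : k ^ suc r ≅ 1ℤ [ m ]
      k^r≅1 = begin
        k ^ suc r                       ≈⟨ ^-period (suc r) (e ℕᵈ./ d) ⟨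
        k ^ (suc r ℕ.+ d ℕ.* (e ℕᵈ./ d))  ≡⟨ cong (k ^_) (trans (cong₂ ℕ._+_ (sym eq) (ℕₚ.*-comm d (e ℕᵈ./ d))) (sym (ℕᵈ.m≡m%n+[m/n]*n e d))) ⟩
        k ^ e                           ≈⟨ k^e≅1 ⟩
        1ℤ                              ∎
        where open ≅-Reasoning m

    ^-injective-below : ∀ {a b} → a ℕ.< b → b ℕ.< d → ¬ (k ^ a ≅ k ^ b [ m ])
    ^-injective-below {a} {b} a<b b<d e = ℕₚ.<⇒≱ (ℕₚ.≤-<-trans (ℕₚ.m∸n≤m b a) b<d)
      (order-minimal (b ℕ.∸ a) (ℕₚ.m<n⇒0<n∸m a<b)
        (≅-sym (*-cancelˡ-coprime (k ^ a) (^-coprime a) (begin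
          k ^ a * 1ℤ               ≡⟨ ℤₚ.*-identityʳ (k ^ a) ⟩
          k ^ a                    ≈⟨ e ⟩
          k ^ b                    ≡⟨ cong (k ^_) (ℕₚ.m+[n∸m]≡n (ℕₚ.<⇒≤ a<b)) ⟨
          k ^ (a ℕ.+ (b ℕ.∸ a))      ≡⟨ ℤₚ.^-distribˡ-+-* k a (b ℕ.∸ a) ⟩
          k ^ a * k ^ (b ℕ.∸ a)     ∎))))
      where open ≅-Reasoning m

  coprime-resp-≅ : ∀ {a b m} → a ≅ b [ m ] → ℤᶜ.Coprime a (+ m) → ℤᶜ.Coprime b (+ m)
  coprime-resp-≅ {a} {b} {m} a≅b a⊥m with inverse a a⊥m
  ... | c , e = unit⇒coprime b c (≅-trans (*-cong (≅-sym a≅b) ≅-refl) e)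

  pigeonhole-∈ : {A : Set} (xs : List A) (f : Fin.Fin (suc (length xs)) → A) → (∀ i → f i ∈ xs) →
                 ∃ λ i → ∃ λ j → i Fin.< j × f i ≡ f j
  pigeonhole-∈ xs f f∈xs with Finₚ.pigeonhole (ℕₚ.n<1+n (length xs)) (index ∘ f∈xs)
  ... | i , j , i<j , eq = i , j , i<j ,
    trans (Anyₚ.lookup-index (f∈xs i)) (trans (cong (lookup xs) eq) (sym (Anyₚ.lookup-index (f∈xs j))))

  -- This is literally the list whose length defines `φ m`, so the pigeonhole principle applies to
  -- `suc (φ m)` elements without any conversion.
  units : ℕ → List ℕ
  units m = filter (λ k → ℕᶜ.coprime? k m) (map suc (upTo m))

  representative : ∀ {m} .{{_ : ℕ.NonZero m}} v → ℤᶜ.Coprime v (+ m) →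
                   ∃ λ k → k ∈ units m × v ≅ + k [ m ]
  representative {m} v v⊥m = suc r , ∈ₚ.∈-filter⁺ (λ k → ℕᶜ.coprime? k m)
      (∈ₚ.∈-map⁺ suc (∈ₚ.∈-upTo⁺ (ℤᵈ.n%ℕd<d (v - 1ℤ) m)))
      (coprime-resp-≅ v≅ v⊥m) , v≅
    where
    -- The list `units m` is drawn from 1, ..., m rather than 0, ..., m - 1, hence the reduction of
    -- v - 1 followed by `suc`.
    r = (v - 1ℤ) ℤᵈ.%ℕ m
    lemma : ∀ v → v ≡ 1ℤ ℤ.+ (v - 1ℤ)
    lemma = solve-∀
    v≅ : v ≅ + suc r [ m ]
    v≅ = ≅-trans (≡⇒≅ (lemma v)) (+-cong (≅-refl {1ℤ}) (≅-remainder (v - 1ℤ) m))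

  -- The φ(m) powers of a primitive root are distinct units, so by the
  -- pigeonhole principle no unit is missed.
  primitive-root-generates : ∀ m g .{{_ : ℕ.NonZero m}} → PrimitiveRoot g m →
    ∀ u → ℤᶜ.Coprime u (+ m) → ∃ λ r → u ≅ g ^ r [ m ]
  primitive-root-generates m g prim u u⊥m =
    conclude (pigeonhole-∈ (units m) (proj₁ ∘ rep) (proj₁ ∘ proj₂ ∘ rep))
    where
    element : Fin.Fin (suc (φ m)) → ℤ
    element Fin.zero    = u
    element (Fin.suc i) = g ^ Fin.toℕ i

    element-coprime : ∀ i → ℤᶜ.Coprime (element i) (+ m)
    element-coprime Fin.zero    = u⊥m
    element-coprime (Fin.suc i) = ^-coprime m g (φ m) prim (Fin.toℕ i)

    rep : ∀ i → ∃ λ k → k ∈ units m × element i ≅ + k [ m ]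
    rep i = representative (element i) (element-coprime i)

    rep-injective : ∀ i j → proj₁ (rep i) ≡ proj₁ (rep j) → element i ≅ element j [ m ]
    rep-injective i j eq = ≅-trans (proj₂ (proj₂ (rep i)))
      (≅-trans (≡⇒≅ (cong +_ eq)) (≅-sym (proj₂ (proj₂ (rep j)))))

    conclude : (∃ λ i → ∃ λ j → i Fin.< j × proj₁ (rep i) ≡ proj₁ (rep j)) → ∃ λ r → u ≅ g ^ r [ m ]
    conclude (Fin.zero , Fin.suc j , _ , eq) = Fin.toℕ j , rep-injective Fin.zero (Fin.suc j) eq
    conclude (Fin.suc i , Fin.suc j , ℕ.s<s i<j , eq) = contradiction
      (rep-injective (Fin.suc i) (Fin.suc j) eq)
      (^-injective-below m g (φ m) prim i<j (Finₚ.toℕ<n j))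

-- Finite sums over initial segments and lists in a commutative monoid.

module RangeSum {c ℓ} (M : CommutativeMonoid c ℓ) where
  open CommutativeMonoid M renaming (refl to ≈-refl; sym to ≈-sym; trans to ≈-trans)
  open import Algebra.Properties.CommutativeMonoid.Sum M
  open SetoidReasoning setoid

  ∑< : ℕ → (ℕ → Carrier) → Carrier
  ∑< n F = sum {n} (F ∘ Fin.toℕ)

  listSum : {I : Set} → List I → (I → Carrier) → Carrier
  listSum is F = foldr _∙_ ε (map F is)

  ∑<-cong : ∀ n {F G} → (∀ k → k ℕ.< n → F k ≈ G k) → ∑< n F ≈ ∑< n G
  ∑<-cong n e = sum-cong-≋ (λ i → e (Fin.toℕ i) (Finₚ.toℕ<n i))

  ∑<-comm : ∀ m n (F : ℕ → ℕ → Carrier) →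
            ∑< m (λ i → ∑< n (λ j → F i j)) ≈ ∑< n (λ j → ∑< m (λ i → F i j))
  ∑<-comm m n F = ∑-comm {m} {n} (λ i j → F (Fin.toℕ i) (Fin.toℕ j))

  ∑<-∙ : ∀ n F G → ∑< n (λ k → F k ∙ G k) ≈ ∑< n F ∙ ∑< n G
  ∑<-∙ n F G = ∑-distrib-+ {n} (F ∘ Fin.toℕ) (G ∘ Fin.toℕ)

  ∑<-last : ∀ n F → ∑< (suc n) F ≈ ∑< n F ∙ F n
  ∑<-last zero    F = comm (F 0) ε
  ∑<-last (suc n) F = begin
    F 0 ∙ ∑< (suc n) (F ∘ suc)      ≈⟨ ∙-congˡ (∑<-last n (F ∘ suc)) ⟩
    F 0 ∙ (∑< n (F ∘ suc) ∙ F (suc n))  ≈⟨ assoc _ _ _ ⟨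
    ∑< (suc n) F ∙ F (suc n)        ∎

  ∑<-+ : ∀ m n F → ∑< (m ℕ.+ n) F ≈ ∑< m F ∙ ∑< n (F ∘ (m ℕ.+_))
  ∑<-+ zero    n F = ≈-sym (identityˡ _)
  ∑<-+ (suc m) n F = ≈-trans (∙-congˡ (∑<-+ m n (F ∘ suc))) (≈-sym (assoc _ _ _))

  ∑<-* : ∀ m n F → ∑< (m ℕ.* n) F ≈ ∑< m (λ i → ∑< n (λ j → F (i ℕ.* n ℕ.+ j)))
  ∑<-* zero    n F = ≈-refl
  ∑<-* (suc m) n F = begin
    ∑< (n ℕ.+ m ℕ.* n) F
      ≈⟨ ∑<-+ n (m ℕ.* n) F ⟩
    ∑< n F ∙ ∑< (m ℕ.* n) (F ∘ (n ℕ.+_))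
      ≈⟨ ∙-congˡ (∑<-* m n (F ∘ (n ℕ.+_))) ⟩
    ∑< n F ∙ ∑< m (λ i → ∑< n (λ j → F (n ℕ.+ (i ℕ.* n ℕ.+ j))))
      ≈⟨ ∙-congˡ (∑<-cong m (λ i _ → ∑<-cong n (λ j _ →
           reflexive (cong F (sym (ℕₚ.+-assoc n (i ℕ.* n) j)))))) ⟩
    ∑< (suc m) (λ i → ∑< n (λ j → F (i ℕ.* n ℕ.+ j)))  ∎

  -- Moving the window by one step drops `F 0` and gains `F n`, which agree by periodicity.
  ∑<-shift : ∀ n F → (∀ k → F (n ℕ.+ k) ≈ F k) → ∀ b → ∑< n (λ k → F (b ℕ.+ k)) ≈ ∑< n F
  ∑<-shift n F periodic zero    = ≈-refl
  ∑<-shift n F periodic (suc b) = begin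
    ∑< n (λ k → F (suc b ℕ.+ k))  ≈⟨ ∑<-shift n (F ∘ suc) periodic′ b ⟩
    ∑< n (F ∘ suc)                ≈⟨ step n periodic ⟩
    ∑< n F                        ∎
    where
    periodic′ : ∀ k → F (suc (n ℕ.+ k)) ≈ F (suc k)
    periodic′ k = ≈-trans (reflexive (cong F (sym (ℕₚ.+-suc n k)))) (periodic (suc k))
    step : ∀ n → (∀ k → F (n ℕ.+ k) ≈ F k) → ∑< n (F ∘ suc) ≈ ∑< n F
    step zero    _        = ≈-refl
    step (suc n) periodic = begin
      ∑< (suc n) (F ∘ suc)         ≈⟨ ∑<-last n (F ∘ suc) ⟩
      ∑< n (F ∘ suc) ∙ F (suc n)   ≈⟨ ∙-congˡ (reflexive (cong F (sym (ℕₚ.+-identityʳ (suc n))))) ⟩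
      ∑< n (F ∘ suc) ∙ F (suc n ℕ.+ 0)  ≈⟨ ∙-congˡ (periodic 0) ⟩
      ∑< n (F ∘ suc) ∙ F 0         ≈⟨ comm _ _ ⟩
      ∑< (suc n) F                 ∎

  ∑<-reverse : ∀ n F → ∑< n (λ k → F (n ℕ.∸ suc k)) ≈ ∑< n F
  ∑<-reverse zero    F = ≈-refl
  ∑<-reverse (suc n) F = begin
    F n ∙ ∑< n (λ k → F (n ℕ.∸ suc k))  ≈⟨ ∙-congˡ (∑<-reverse n F) ⟩
    F n ∙ ∑< n F                        ≈⟨ comm _ _ ⟩
    ∑< n F ∙ F n                        ≈⟨ ∑<-last n F ⟨
    ∑< (suc n) F                        ∎

  ∑<-ε : ∀ n F → (∀ k → k ℕ.< n → F k ≈ ε) → ∑< n F ≈ ε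
  ∑<-ε n F e = ≈-trans (∑<-cong n e) (sum-replicate-zero n)

  ∑<-single : ∀ n F b → b ℕ.< n → (∀ k → k ℕ.< n → k ≢ b → F k ≈ ε) → ∑< n F ≈ F b
  ∑<-single (suc n) F zero    _           e =
    ≈-trans (∙-congˡ (∑<-ε n (F ∘ suc) (λ k k<n → e (suc k) (ℕ.s<s k<n) (λ ())))) (identityʳ (F 0))
  ∑<-single (suc n) F (suc b) (ℕ.s<s b<n) e = ≈-trans
    (∙-cong (e 0 ℕ.z<s (λ ()))
            (∑<-single n (F ∘ suc) b b<n (λ k k<n k≢b → e (suc k) (ℕ.s<s k<n) (k≢b ∘ ℕₚ.suc-injective))))
    (identityˡ (F (suc b)))

  listSum-cong : {I : Set} (is : List I) {F G : I → Carrier} → All (λ i → F i ≈ G i) is →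
                 listSum is F ≈ listSum is G
  listSum-cong []       []       = ≈-refl
  listSum-cong (i ∷ is) (e ∷ es) = ∙-cong e (listSum-cong is es)

  -- Stated for `tabulate f` so that the induction can replace f by `f ∘ Fin.suc`; `allFin n` is the
  -- case f = `id`. The variant for `applyUpTo` covers `upTo` in the same way.
  listSum-filter : ∀ {I : Set} {P : Pred I 0ℓ} (P? : Decidable P) n (f : Fin.Fin n → I) F →
    listSum (filter P? (tabulate f)) F ≈ sum {n} (λ i → if does (P? (f i)) then F (f i) else ε)
  listSum-filter P? zero    f F = ≈-refl
  listSum-filter P? (suc n) f F with does (P? (f Fin.zero))
  ... | true  = ∙-congˡ (listSum-filter P? n (f ∘ Fin.suc) F)
  ... | false = ≈-trans (listSum-filter P? n (f ∘ Fin.suc) F) (≈-sym (identityˡ _))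

  listSum-filter-applyUpTo : ∀ {I : Set} {P : Pred I 0ℓ} (P? : Decidable P) n (f : ℕ → I) F →
    listSum (filter P? (applyUpTo f n)) F ≈ ∑< n (λ k → if does (P? (f k)) then F (f k) else ε)
  listSum-filter-applyUpTo P? zero    f F = ≈-refl
  listSum-filter-applyUpTo P? (suc n) f F with does (P? (f 0))
  ... | true  = ∙-congˡ (listSum-filter-applyUpTo P? n (f ∘ suc) F)
  ... | false = ≈-trans (listSum-filter-applyUpTo P? n (f ∘ suc) F) (≈-sym (identityˡ _))

  listSum-partition : ∀ {I : Set} {P : Pred I 0ℓ} (P? : Decidable P) is F →
    listSum (filter (¬? ∘ P?) is) F ∙ listSum (filter P? is) F ≈ listSum is F
  listSum-partition P? []       F = identityˡ ε
  listSum-partition P? (i ∷ is) F with does (P? i)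
  ... | false = ≈-trans (assoc _ _ _) (∙-congˡ (listSum-partition P? is F))
  ... | true  = begin
    A ∙ (F i ∙ B)  ≈⟨ assoc _ _ _ ⟨
    (A ∙ F i) ∙ B  ≈⟨ ∙-congʳ (comm A (F i)) ⟩
    (F i ∙ A) ∙ B  ≈⟨ assoc _ _ _ ⟩
    F i ∙ (A ∙ B)  ≈⟨ ∙-congˡ (listSum-partition P? is F) ⟩
    F i ∙ listSum is F  ∎
    where
    A = listSum (filter (¬? ∘ P?) is) F
    B = listSum (filter P? is) F

-- Polynomials modulo h: coefficients, congruence and the additive monoid.

module PolynomialQuotient (l : ℕ) (h : Polynomial.Poly (𝔽 l)) where
  open import Data.Integer.Base using () renaming (_+_ to _+ᶻ_; _*_ to _*ᶻ_; -_ to -ᶻ_; _-_ to _-ᶻ_)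
  open Polynomial (𝔽 l)

  coeff-+ : ∀ f g k → coeff (f + g) k ≡ coeff f k +ᶻ coeff g k
  coeff-+ []      g       k       = sym (ℤₚ.+-identityˡ _)
  coeff-+ (a ∷ f) []      k       = sym (ℤₚ.+-identityʳ _)
  coeff-+ (a ∷ f) (b ∷ g) zero    = refl
  coeff-+ (a ∷ f) (b ∷ g) (suc k) = coeff-+ f g k

  coeff-• : ∀ r f k → coeff (r • f) k ≡ r *ᶻ coeff f k
  coeff-• r []      k       = sym (ℤₚ.*-zeroʳ r)
  coeff-• r (a ∷ f) zero    = refl
  coeff-• r (a ∷ f) (suc k) = coeff-• r f k

  coeff-neg : ∀ f k → coeff (map -ᶻ_ f) k ≡ -ᶻ coeff f k
  coeff-neg []      k       = refl
  coeff-neg (a ∷ f) zero    = refl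
  coeff-neg (a ∷ f) (suc k) = coeff-neg f k

  -- The last summand stays unevaluated because `coeff (0ℤ ∷ f * g) k` reduces only once k is split;
  -- the distributive laws make that split afterwards in a local `go`.
  coeff-∷* : ∀ a f g k → coeff ((a ∷ f) * g) k ≡ a *ᶻ coeff g k +ᶻ coeff (0ℤ ∷ f * g) k
  coeff-∷* a f g k = trans (coeff-+ (a • g) (0ℤ ∷ f * g) k)
                             (cong (_+ᶻ coeff (0ℤ ∷ f * g) k) (coeff-• a g k))

  *-distribʳ-+ : ∀ e f g k → coeff ((f + g) * e) k ≡ coeff (f * e) k +ᶻ coeff (g * e) k
  *-distribʳ-+ e []      g       k = sym (ℤₚ.+-identityˡ _)
  *-distribʳ-+ e (a ∷ f) []      k = sym (ℤₚ.+-identityʳ _)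
  *-distribʳ-+ e (a ∷ f) (b ∷ g) k
    rewrite coeff-∷* (a +ᶻ b) (f + g) e k | coeff-∷* a f e k | coeff-∷* b g e k = go k
    where
    lemma : ∀ a b x y z → (a +ᶻ b) *ᶻ x +ᶻ (y +ᶻ z) ≡ (a *ᶻ x +ᶻ y) +ᶻ (b *ᶻ x +ᶻ z)
    lemma = solve-∀
    go : ∀ k → (a +ᶻ b) *ᶻ coeff e k +ᶻ coeff (0ℤ ∷ (f + g) * e) k ≡
               (a *ᶻ coeff e k +ᶻ coeff (0ℤ ∷ f * e) k) +ᶻ (b *ᶻ coeff e k +ᶻ coeff (0ℤ ∷ g * e) k)
    go zero    = lemma a b (coeff e 0) 0ℤ 0ℤ
    go (suc k) = trans (cong ((a +ᶻ b) *ᶻ coeff e (suc k) +ᶻ_) (*-distribʳ-+ e f g k))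
                       (lemma a b (coeff e (suc k)) (coeff (f * e) k) (coeff (g * e) k))

  *-distribˡ-+ : ∀ e f g k → coeff (e * (f + g)) k ≡ coeff (e * f) k +ᶻ coeff (e * g) k
  *-distribˡ-+ []      f g k = refl
  *-distribˡ-+ (a ∷ e) f g k
    rewrite coeff-∷* a e (f + g) k | coeff-∷* a e f k | coeff-∷* a e g k | coeff-+ f g k = go k
    where
    lemma : ∀ a x x′ y z → a *ᶻ (x +ᶻ x′) +ᶻ (y +ᶻ z) ≡ (a *ᶻ x +ᶻ y) +ᶻ (a *ᶻ x′ +ᶻ z)
    lemma = solve-∀
    go : ∀ k → a *ᶻ (coeff f k +ᶻ coeff g k) +ᶻ coeff (0ℤ ∷ e * (f + g)) k ≡
               (a *ᶻ coeff f k +ᶻ coeff (0ℤ ∷ e * f) k) +ᶻ (a *ᶻ coeff g k +ᶻ coeff (0ℤ ∷ e * g) k)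
    go zero    = lemma a (coeff f 0) (coeff g 0) 0ℤ 0ℤ
    go (suc k) = trans (cong (a *ᶻ (coeff f (suc k) +ᶻ coeff g (suc k)) +ᶻ_) (*-distribˡ-+ e f g k))
                       (lemma a (coeff f (suc k)) (coeff g (suc k)) (coeff (e * f) k) (coeff (e * g) k))

  •-*-assoc : ∀ r f e k → coeff ((r • f) * e) k ≡ r *ᶻ coeff (f * e) k
  •-*-assoc r []      e k = sym (ℤₚ.*-zeroʳ r)
  •-*-assoc r (a ∷ f) e k
    rewrite coeff-∷* (r *ᶻ a) (r • f) e k | coeff-∷* a f e k = go k
    where
    lemma : ∀ r a x y → r *ᶻ a *ᶻ x +ᶻ r *ᶻ y ≡ r *ᶻ (a *ᶻ x +ᶻ y)
    lemma = solve-∀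
    go : ∀ k → r *ᶻ a *ᶻ coeff e k +ᶻ coeff (0ℤ ∷ (r • f) * e) k ≡
               r *ᶻ (a *ᶻ coeff e k +ᶻ coeff (0ℤ ∷ f * e) k)
    go zero    = trans (cong (r *ᶻ a *ᶻ coeff e 0 +ᶻ_) (sym (ℤₚ.*-zeroʳ r))) (lemma r a (coeff e 0) 0ℤ)
    go (suc k) = trans (cong (r *ᶻ a *ᶻ coeff e (suc k) +ᶻ_) (•-*-assoc r f e k))
                       (lemma r a (coeff e (suc k)) (coeff (f * e) k))

  X^0* : ∀ f k → coeff (X^ 0 * f) k ≡ coeff f k
  X^0* f k = trans (coeff-∷* 1ℤ [] f k) (trans (cong₂ _+ᶻ_ (ℤₚ.*-identityˡ (coeff f k)) (zeros k)) (ℤₚ.+-identityʳ _))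
    where
    zeros : ∀ k → coeff (0ℤ ∷ []) k ≡ 0ℤ
    zeros zero    = refl
    zeros (suc k) = refl

  X^suc* : ∀ a f k → coeff (X^ (suc a) * f) k ≡ coeff (0ℤ ∷ X^ a * f) k
  X^suc* a f k = trans (coeff-∷* 0ℤ (X^ a) f k) (ℤₚ.+-identityˡ _)

  X^-*-X^ : ∀ a b k → coeff (X^ a * X^ b) k ≡ coeff (X^ (a ℕ.+ b)) k
  X^-*-X^ zero    b k       = X^0* (X^ b) k
  X^-*-X^ (suc a) b zero    = X^suc* a (X^ b) 0
  X^-*-X^ (suc a) b (suc k) = trans (X^suc* a (X^ b) (suc k)) (X^-*-X^ a b k)

  X^-*-[X^n-1] : ∀ a n k → coeff (X^ a * (X^ n - 1ₚ)) k ≡ coeff (X^ (a ℕ.+ n) - X^ a) k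
  X^-*-[X^n-1] zero    n k       = X^0* (X^ n - 1ₚ) k
  X^-*-[X^n-1] (suc a) n zero    = X^suc* a (X^ n - 1ₚ) 0
  X^-*-[X^n-1] (suc a) n (suc k) = trans (X^suc* a (X^ n - 1ₚ) (suc k)) (X^-*-[X^n-1] a n k)

  infix 4 _~_

  -- Congruence modulo h over ℤ, although the ambient ring is 𝔽 l: integers carry both structures,
  -- and all identities needed here hold before reduction modulo l.
  record _~_ (f g : Poly) : Set where
    constructor congruent
    field
      quotient : Poly
      agree    : ∀ k → coeff f k ≡ coeff g k +ᶻ coeff (quotient * h) k

  ~⇒≈⟨mod⟩ : ∀ {f g} → f ~ g → f ≈ g ⟨mod h ⟩
  ~⇒≈⟨mod⟩ {f} {g} (congruent q e) = q , λ k → mod-reflexive {l} (begin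
    coeff (f - g) k                              ≡⟨ coeff-+ f (map -ᶻ_ g) k ⟩
    coeff f k +ᶻ coeff (map -ᶻ_ g) k             ≡⟨ cong₂ _+ᶻ_ (e k) (coeff-neg g k) ⟩
    coeff g k +ᶻ coeff (q * h) k -ᶻ coeff g k    ≡⟨ lemma (coeff g k) (coeff (q * h) k) ⟩
    coeff (q * h) k                              ∎)
    where
    open ≡-Reasoning
    lemma : ∀ x y → x +ᶻ y -ᶻ x ≡ y
    lemma = solve-∀

  coeff≡⇒~ : ∀ {f g} → (∀ k → coeff f k ≡ coeff g k) → f ~ g
  coeff≡⇒~ e = congruent [] (λ k → trans (e k) (sym (ℤₚ.+-identityʳ _)))

  ~-refl : ∀ {f} → f ~ f
  ~-refl = coeff≡⇒~ (λ _ → refl)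

  ~-reflexive : ∀ {f g} → f ≡ g → f ~ g
  ~-reflexive refl = ~-refl

  ~-sym : ∀ {f g} → f ~ g → g ~ f
  ~-sym {f} {g} (congruent q e) = congruent (ℤ.-1ℤ • q) (λ k → begin
    coeff g k                                                        ≡⟨ lemma (coeff g k) (coeff (q * h) k) ⟩
    coeff g k +ᶻ coeff (q * h) k +ᶻ ℤ.-1ℤ *ᶻ coeff (q * h) k         ≡⟨ cong₂ _+ᶻ_ (e k) (•-*-assoc ℤ.-1ℤ q h k) ⟨
    coeff f k +ᶻ coeff ((ℤ.-1ℤ • q) * h) k                           ∎)
    where
    open ≡-Reasoning
    lemma : ∀ x y → x ≡ x +ᶻ y +ᶻ ℤ.-1ℤ *ᶻ y
    lemma = solve-∀

  ~-trans : ∀ {e f g} → e ~ f → f ~ g → e ~ g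
  ~-trans {e} {f} {g} (congruent q a) (congruent r b) = congruent (r + q) (λ k → begin
    coeff e k                                              ≡⟨ a k ⟩
    coeff f k +ᶻ coeff (q * h) k                           ≡⟨ cong (_+ᶻ coeff (q * h) k) (b k) ⟩
    coeff g k +ᶻ coeff (r * h) k +ᶻ coeff (q * h) k        ≡⟨ ℤₚ.+-assoc (coeff g k) _ _ ⟩
    coeff g k +ᶻ (coeff (r * h) k +ᶻ coeff (q * h) k)      ≡⟨ cong (coeff g k +ᶻ_) (*-distribʳ-+ h r q k) ⟨
    coeff g k +ᶻ coeff ((r + q) * h) k                     ∎)
    where open ≡-Reasoning

  +-cong-~ : ∀ {e f e′ f′} → e ~ f → e′ ~ f′ → e + e′ ~ f + f′
  +-cong-~ {e} {f} {e′} {f′} (congruent q a) (congruent q′ a′) = congruent (q + q′) (λ k → begin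
    coeff (e + e′) k                                                  ≡⟨ coeff-+ e e′ k ⟩
    coeff e k +ᶻ coeff e′ k                                           ≡⟨ cong₂ _+ᶻ_ (a k) (a′ k) ⟩
    coeff f k +ᶻ coeff (q * h) k +ᶻ (coeff f′ k +ᶻ coeff (q′ * h) k)  ≡⟨ lemma (coeff f k) _ _ _ ⟩
    coeff f k +ᶻ coeff f′ k +ᶻ (coeff (q * h) k +ᶻ coeff (q′ * h) k)  ≡⟨ cong₂ _+ᶻ_ (coeff-+ f f′ k) (*-distribʳ-+ h q q′ k) ⟨
    coeff (f + f′) k +ᶻ coeff ((q + q′) * h) k                        ∎)
    where
    open ≡-Reasoning
    lemma : ∀ x y z w → x +ᶻ y +ᶻ (z +ᶻ w) ≡ x +ᶻ z +ᶻ (y +ᶻ w)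
    lemma = solve-∀

  •-cong : ∀ r {f g} → f ~ g → r • f ~ r • g
  •-cong r {f} {g} (congruent q e) = congruent (r • q) (λ k → begin
    coeff (r • f) k                                ≡⟨ coeff-• r f k ⟩
    r *ᶻ coeff f k                                 ≡⟨ cong (r *ᶻ_) (e k) ⟩
    r *ᶻ (coeff g k +ᶻ coeff (q * h) k)            ≡⟨ ℤₚ.*-distribˡ-+ r _ _ ⟩
    r *ᶻ coeff g k +ᶻ r *ᶻ coeff (q * h) k         ≡⟨ cong₂ _+ᶻ_ (coeff-• r g k) (•-*-assoc r q h k) ⟨
    coeff (r • g) k +ᶻ coeff ((r • q) * h) k       ∎)
    where open ≡-Reasoning

  -- Packaged so that the sum lemmas of `RangeSum` apply to polynomials up to congruence just as
  -- they do to integers.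
  quotient-+-commutativeMonoid : CommutativeMonoid 0ℓ 0ℓ
  quotient-+-commutativeMonoid = record
    { Carrier = Poly
    ; _≈_ = _~_
    ; _∙_ = _+_
    ; ε   = []
    ; isCommutativeMonoid = record
      { isMonoid = record
        { isSemigroup = record
          { isMagma = record
            { isEquivalence = record { refl = ~-refl ; sym = ~-sym ; trans = ~-trans }
            ; ∙-cong = +-cong-~
            }
          ; assoc = λ e f g → coeff≡⇒~ (λ k → +-assoc e f g k)
          }
        ; identity = (λ f → ~-refl) , λ f → coeff≡⇒~ (λ k → trans (coeff-+ f [] k) (ℤₚ.+-identityʳ _))
        }
      ; comm = λ f g → coeff≡⇒~ (λ k → trans (coeff-+ f g k)
                         (trans (ℤₚ.+-comm (coeff f k) (coeff g k)) (sym (coeff-+ g f k))))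
      }
    }
    where
    +-assoc : ∀ e f g k → coeff ((e + f) + g) k ≡ coeff (e + (f + g)) k
    +-assoc e f g k rewrite coeff-+ (e + f) g k | coeff-+ e f k | coeff-+ e (f + g) k | coeff-+ f g k =
      ℤₚ.+-assoc (coeff e k) (coeff f k) (coeff g k)

  open CommutativeMonoid quotient-+-commutativeMonoid public using () renaming (setoid to ~-setoid)
  module Σₚ = RangeSum quotient-+-commutativeMonoid
  module Σᶻ = RangeSum ℤₚ.+-0-commutativeMonoid

  •-∑< : ∀ r n F → r • Σₚ.∑< n F ~ Σₚ.∑< n (λ k → r • F k)
  •-∑< r zero    F = ~-refl
  •-∑< r (suc n) F = ~-trans (coeff≡⇒~ •-+) (+-cong-~ ~-refl (•-∑< r n (F ∘ suc)))
    where
    •-+ : ∀ k → coeff (r • (F 0 + Σₚ.∑< n (F ∘ suc))) k ≡ coeff (r • F 0 + r • Σₚ.∑< n (F ∘ suc)) k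
    •-+ k rewrite coeff-• r (F 0 + Σₚ.∑< n (F ∘ suc)) k
                | coeff-+ (F 0) (Σₚ.∑< n (F ∘ suc)) k
                | coeff-+ (r • F 0) (r • Σₚ.∑< n (F ∘ suc)) k
                | coeff-• r (F 0) k | coeff-• r (Σₚ.∑< n (F ∘ suc)) k
      = ℤₚ.*-distribˡ-+ r (coeff (F 0) k) _

  +-• : ∀ u v f → u • f + v • f ~ (u +ᶻ v) • f
  +-• u v f = coeff≡⇒~ go
    where
    go : ∀ k → coeff (u • f + v • f) k ≡ coeff ((u +ᶻ v) • f) k
    go k rewrite coeff-+ (u • f) (v • f) k | coeff-• u f k | coeff-• v f k | coeff-• (u +ᶻ v) f k =
      sym (ℤₚ.*-distribʳ-+ (coeff f k) u v)

  0• : ∀ f → 0ℤ • f ~ []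
  0• f = coeff≡⇒~ (λ k → coeff-• 0ℤ f k)

  1• : ∀ f → 1ℤ • f ~ f
  1• f = coeff≡⇒~ (λ k → trans (coeff-• 1ℤ f k) (ℤₚ.*-identityˡ _))

  •-• : ∀ u v f → u • v • f ~ (u *ᶻ v) • f
  •-• u v f = coeff≡⇒~ go
    where
    go : ∀ k → coeff (u • v • f) k ≡ coeff ((u *ᶻ v) • f) k
    go k rewrite coeff-• u (v • f) k | coeff-• v f k | coeff-• (u *ᶻ v) f k =
      sym (ℤₚ.*-assoc u v (coeff f k))

  ∑<-• : ∀ n (u : ℕ → ℤ) f → Σₚ.∑< n (λ k → u k • f) ~ Σᶻ.∑< n u • f
  ∑<-• zero    u f = ~-sym (0• f)
  ∑<-• (suc n) u f = ~-trans (+-cong-~ ~-refl (∑<-• n (u ∘ suc) f)) (+-• (u 0) (Σᶻ.∑< n (u ∘ suc)) f)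

  listSum-* : ∀ {I : Set} (is : List I) F g → ∑ is F * g ~ Σₚ.listSum is (λ i → F i * g)
  listSum-* []       F g = ~-refl
  listSum-* (i ∷ is) F g = ~-trans
    (coeff≡⇒~ (λ k → trans (*-distribʳ-+ g (F i) (∑ is F) k) (sym (coeff-+ (F i * g) (∑ is F * g) k))))
    (+-cong-~ ~-refl (listSum-* is F g))

  *-zeroʳ : ∀ f k → coeff (f * []) k ≡ 0ℤ
  *-zeroʳ []      k       = refl
  *-zeroʳ (a ∷ f) zero    = refl
  *-zeroʳ (a ∷ f) (suc k) = *-zeroʳ f k

  *-listSum : ∀ {I : Set} g (is : List I) F → g * ∑ is F ~ Σₚ.listSum is (λ i → g * F i)
  *-listSum g []       F = coeff≡⇒~ (*-zeroʳ g)
  *-listSum g (i ∷ is) F = ~-trans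
    (coeff≡⇒~ (λ k → trans (*-distribˡ-+ g (F i) (∑ is F) k) (sym (coeff-+ (g * F i) (g * ∑ is F) k))))
    (+-cong-~ ~-refl (*-listSum g is F))

-- The Iverson bracket. With integer values, products express intersections, differences express
-- relative complements, and counting becomes summation.
[_]₁ : {A : Set} → Dec A → ℤ
[ d ]₁ = if does d then 1ℤ else 0ℤ

-- Polynomials modulo X^n - 1 and cyclic convolution.

module CyclicPolynomial (l n : ℕ) where
  open import Data.Integer.Base using () renaming (_+_ to _+ᶻ_; _*_ to _*ᶻ_; -_ to -ᶻ_; _-_ to _-ᶻ_)
  open Polynomial (𝔽 l)
  open Congruence using (_≅_[_]; ≡⇒≅; +-cong; -‿cong; ≅-refl; modulus≅0)
  open PolynomialQuotient l (X^ n - 1ₚ) public hiding (congruent)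
  open PolynomialQuotient l (X^ n - 1ₚ) using (congruent)
  open SetoidReasoning ~-setoid

  -- The coefficient function lives on ℤ rather than on residues, so that w - b can be its argument
  -- without being reduced; periodicity modulo n is assumed where it matters.
  P : (ℤ → ℤ) → Poly
  P f = Σₚ.∑< n (λ w → f (+ w) • X^ w)

  P-cong : ∀ {f g} → (∀ z → f z ≡ g z) → P f ~ P g
  P-cong e = Σₚ.∑<-cong n (λ w _ → ~-reflexive (cong (_• X^ w) (e (+ w))))

  P-+ : ∀ f g → P f + P g ~ P (λ z → f z +ᶻ g z)
  P-+ f g = ~-trans (~-sym (Σₚ.∑<-∙ n (λ w → f (+ w) • X^ w) (λ w → g (+ w) • X^ w)))
    (Σₚ.∑<-cong n (λ w _ → +-• (f (+ w)) (g (+ w)) (X^ w)))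

  P-• : ∀ r f → r • P f ~ P (λ z → r *ᶻ f z)
  P-• r f = ~-trans (•-∑< r n (λ w → f (+ w) • X^ w))
    (Σₚ.∑<-cong n (λ w _ → •-• r (f (+ w)) (X^ w)))

  X^-periodic : ∀ k → X^ (n ℕ.+ k) ~ X^ k
  X^-periodic k = congruent (X^ k) agree
    where
    lemma : ∀ x y → x ≡ y +ᶻ (x +ᶻ -ᶻ y)
    lemma = solve-∀
    agree : ∀ i → coeff (X^ (n ℕ.+ k)) i ≡ coeff (X^ k) i +ᶻ coeff (X^ k * (X^ n - 1ₚ)) i
    agree i rewrite ℕₚ.+-comm n k | X^-*-[X^n-1] k n i
      | coeff-+ (X^ (k ℕ.+ n)) (map -ᶻ_ (X^ k)) i | coeff-neg (X^ k) i = lemma (coeff (X^ (k ℕ.+ n)) i) (coeff (X^ k) i)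

  module _ {Q : Pred (Fin.Fin n) 0ℓ} (Q? : Decidable Q) (f : ℤ → ℤ)
           (f-indicates : ∀ i → f (+ Fin.toℕ i) ≡ [ Q? i ]₁) where

    filtered-sum : ∀ F → Σₚ.listSum (filter Q? (allFin n)) (F ∘ Fin.toℕ) ~ Σₚ.∑< n (λ w → f (+ w) • F w)
    filtered-sum F = ~-trans (Σₚ.listSum-filter Q? n id (F ∘ Fin.toℕ)) (sum-cong-≋ term)
      where
      open import Algebra.Properties.CommutativeMonoid.Sum quotient-+-commutativeMonoid using (sum-cong-≋)
      term : ∀ i → (if does (Q? i) then F (Fin.toℕ i) else []) ~ f (+ Fin.toℕ i) • F (Fin.toℕ i)
      term i rewrite f-indicates i with does (Q? i)
      ... | true  = ~-sym (1• _)
      ... | false = ~-sym (0• _)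

  module _ {Q R : Pred (Fin.Fin n) 0ℓ} (Q? : Decidable Q) (R? : Decidable R) (f g : ℤ → ℤ)
           (f-indicates : ∀ i → f (+ Fin.toℕ i) ≡ [ Q? i ]₁)
           (g-indicates : ∀ i → g (+ Fin.toℕ i) ≡ [ R? i ]₁)
           (f-periodic : ∀ {a b} → a ≅ b [ n ] → f a ≡ f b) where

    private
      Qs = filter Q? (allFin n)
      Rs = filter R? (allFin n)
      X : Fin.Fin n → Poly
      X i = X^ Fin.toℕ i

    -- After both sums are expanded and exchanged, w = a + b is substituted for each fixed b. The
    -- terms have period n in w, up to congruence modulo X^n - 1, so the window b, ..., b + n - 1
    -- may be moved back to 0, ..., n - 1.
    convolution : ∑ Qs X * ∑ Rs X ~ P (λ w → Σᶻ.∑< n (λ b → g (+ b) *ᶻ f (w -ᶻ + b)))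
    convolution = begin
      ∑ Qs X * ∑ Rs X
        ≈⟨ listSum-* Qs X (∑ Rs X) ⟩
      Σₚ.listSum Qs (λ i → X i * ∑ Rs X)
        ≈⟨ Σₚ.listSum-cong Qs (All.universal (λ i → begin
             X i * ∑ Rs X                                       ≈⟨ *-listSum (X i) Rs X ⟩
             Σₚ.listSum Rs (λ j → X i * X j)                    ≈⟨ Σₚ.listSum-cong Rs (All.universal
                                                                     (λ j → coeff≡⇒~ (X^-*-X^ (Fin.toℕ i) (Fin.toℕ j))) Rs) ⟩
             Σₚ.listSum Rs (λ j → X^ (Fin.toℕ i ℕ.+ Fin.toℕ j))  ≈⟨ filtered-sum R? g g-indicates (λ b → X^ (Fin.toℕ i ℕ.+ b)) ⟩
             Σₚ.∑< n (λ b → g (+ b) • X^ (Fin.toℕ i ℕ.+ b))      ∎) Qs) ⟩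
      Σₚ.listSum Qs (λ i → Σₚ.∑< n (λ b → g (+ b) • X^ (Fin.toℕ i ℕ.+ b)))
        ≈⟨ filtered-sum Q? f f-indicates (λ a → Σₚ.∑< n (λ b → g (+ b) • X^ (a ℕ.+ b))) ⟩
      Σₚ.∑< n (λ a → f (+ a) • Σₚ.∑< n (λ b → g (+ b) • X^ (a ℕ.+ b)))
        ≈⟨ Σₚ.∑<-cong n (λ a _ → •-∑< (f (+ a)) n (λ b → g (+ b) • X^ (a ℕ.+ b))) ⟩
      Σₚ.∑< n (λ a → Σₚ.∑< n (λ b → f (+ a) • g (+ b) • X^ (a ℕ.+ b)))
        ≈⟨ Σₚ.∑<-comm n n (λ a b → f (+ a) • g (+ b) • X^ (a ℕ.+ b)) ⟩
      Σₚ.∑< n (λ b → Σₚ.∑< n (λ a → f (+ a) • g (+ b) • X^ (a ℕ.+ b)))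
        ≈⟨ Σₚ.∑<-cong n (λ b _ → translate b) ⟩
      Σₚ.∑< n (λ b → Σₚ.∑< n (λ w → (g (+ b) *ᶻ f (+ w -ᶻ + b)) • X^ w))
        ≈⟨ Σₚ.∑<-comm n n (λ b w → (g (+ b) *ᶻ f (+ w -ᶻ + b)) • X^ w) ⟩
      Σₚ.∑< n (λ w → Σₚ.∑< n (λ b → (g (+ b) *ᶻ f (+ w -ᶻ + b)) • X^ w))
        ≈⟨ Σₚ.∑<-cong n (λ w _ → ∑<-• n (λ b → g (+ b) *ᶻ f (+ w -ᶻ + b)) (X^ w)) ⟩
      P (λ w → Σᶻ.∑< n (λ b → g (+ b) *ᶻ f (w -ᶻ + b)))  ∎
      where
      F : ℕ → ℕ → Poly
      F b w = (g (+ b) *ᶻ f (+ w -ᶻ + b)) • X^ w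
      F-periodic : ∀ b w → F b (n ℕ.+ w) ~ F b w
      F-periodic b w = ~-trans
        (~-reflexive (cong (λ c → (g (+ b) *ᶻ c) • X^ (n ℕ.+ w))
          (f-periodic (-‿cong (Congruence.≅-trans (+-cong modulus≅0 (≅-refl {+ w})) (≡⇒≅ (ℤₚ.+-identityˡ (+ w)))) (≅-refl {+ b})))))
        (•-cong (g (+ b) *ᶻ f (+ w -ᶻ + b)) (X^-periodic w))
      lemma : ∀ a b → a ≡ b +ᶻ a -ᶻ b
      lemma = solve-∀
      translate : ∀ b → Σₚ.∑< n (λ a → f (+ a) • g (+ b) • X^ (a ℕ.+ b)) ~ Σₚ.∑< n (F b)
      translate b = ~-trans
        (Σₚ.∑<-cong n (λ a _ → ~-trans (•-• (f (+ a)) (g (+ b)) (X^ (a ℕ.+ b)))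
          (~-reflexive (cong₂ (λ c m → c • X^ m)
            (trans (ℤₚ.*-comm (f (+ a)) (g (+ b))) (cong (λ z → g (+ b) *ᶻ f z) (lemma (+ a) (+ b))))
            (ℕₚ.+-comm a b)))))
        (Σₚ.∑<-shift n (F b) (F-periodic b) b)

-- Divisibility by prime powers, and signs of powers.

module PrimePower where
  open import Data.Integer.Base using (_*_; _+_; _-_; -_; _^_)
  open Congruence
  open Order

  pos-^ : ∀ m k → + (m ℕ.^ k) ≡ (+ m) ^ k
  pos-^ m zero    = refl
  pos-^ m (suc k) = trans (ℤₚ.pos-* m (m ℕ.^ k)) (cong (+ m *_) (pos-^ m k))

  ^-∣-^ : ∀ m {j k} → j ℕ.≤ k → m ℕ.^ j ℕ∣.∣ m ℕ.^ k
  ^-∣-^ m {j} {k} j≤k = ℕ∣.divides (m ℕ.^ (k ℕ.∸ j)) (begin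
    m ℕ.^ k                        ≡⟨ cong (m ℕ.^_) (ℕₚ.m∸n+n≡m j≤k) ⟨
    m ℕ.^ (k ℕ.∸ j ℕ.+ j)           ≡⟨ ℕₚ.^-distribˡ-+-* m (k ℕ.∸ j) j ⟩
    m ℕ.^ (k ℕ.∸ j) ℕ.* m ℕ.^ j     ∎)
    where open ≡-Reasoning

  base∣^ : ∀ m {k} → 1 ℕ.≤ k → m ℕ∣.∣ m ℕ.^ k
  base∣^ m {k} 1≤k = subst (ℕ∣._∣ m ℕ.^ k) (ℕₚ.*-identityʳ m) (^-∣-^ m 1≤k)

  coprime-^ : ∀ {a m} → ℕᶜ.Coprime a m → ∀ k → ℕᶜ.Coprime a (m ℕ.^ k)
  coprime-^     a⊥m zero    (_ , d∣1) = ℕ∣.∣1⇒≡1 d∣1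
  coprime-^ {a} a⊥m (suc k) {d} (d∣a , d∣m*) = coprime-^ a⊥m k
    (d∣a , ℕᶜ.coprime-divisor (λ (x∣d , x∣m) → a⊥m (ℕ∣.∣-trans x∣d d∣a , x∣m)) d∣m*)

  module _ {p} (p-prime : Prime p) where
    private instance _ = Prime.prime⇒nonZero p-prime

    ∤⇒coprime : ∀ {a} → ¬ (+ p ℤ∣.∣ a) → ℤᶜ.Coprime a (+ p)
    ∤⇒coprime {a} p∤a {d} (d∣a , d∣p) with Prime.prime⇒irreducible p-prime d∣p
    ... | inj₁ d≡1  = d≡1
    ... | inj₂ refl = contradiction (ℤ∣.∣ᵤ⇒∣ d∣a) p∤a

    ∤⇒coprime-^ : ∀ {a} k → ¬ (+ p ℤ∣.∣ a) → ℤᶜ.Coprime a (+ (p ℕ.^ k))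
    ∤⇒coprime-^ {a} k p∤a = coprime-^ (∤⇒coprime {a} p∤a) k

    coprime⇒∤ : ∀ {a k} → 1 ℕ.≤ k → ℤᶜ.Coprime a (+ (p ℕ.^ k)) → ¬ (+ p ℤ∣.∣ a)
    coprime⇒∤ 1≤k a⊥p^k p∣a = contradiction
      (subst Prime (a⊥p^k (ℤ∣.∣⇒∣ᵤ p∣a , base∣^ p 1≤k)) p-prime) Prime.¬prime[1]

    euclid : ∀ a b → + p ℤ∣.∣ a * b → (+ p ℤ∣.∣ a) ⊎ (+ p ℤ∣.∣ b)
    euclid a b p∣ab with Prime.euclidsLemma ∣ a ∣ ∣ b ∣ p-prime
                           (subst (p ℕ∣.∣_) (ℤₚ.abs-* a b) (ℤ∣.∣⇒∣ᵤ p∣ab))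
    ... | inj₁ p∣a = inj₁ (ℤ∣.∣ᵤ⇒∣ p∣a)
    ... | inj₂ p∣b = inj₂ (ℤ∣.∣ᵤ⇒∣ p∣b)

    ∤-^ : ∀ {a} → ¬ (+ p ℤ∣.∣ a) → ∀ k → ¬ (+ p ℤ∣.∣ a ^ k)
    ∤-^     p∤a zero    p∣1 = coprime⇒∤ {1ℤ} {1} ℕₚ.≤-refl (ℕᶜ.1-coprimeTo _) p∣1
    ∤-^ {a} p∤a (suc k) p∣ with euclid a (a ^ k) p∣
    ... | inj₁ p∣a  = p∤a p∣a
    ... | inj₂ p∣ak = ∤-^ {a} p∤a k p∣ak

    distinct-primes-∤ : ∀ {r} → Prime r → p ≢ r → ¬ (+ p ℤ∣.∣ + r)
    distinct-primes-∤ r-prime p≢r p∣r with Prime.prime⇒irreducible r-prime (ℤ∣.∣⇒∣ᵤ p∣r)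
    ... | inj₁ refl = Prime.¬prime[1] p-prime
    ... | inj₂ p≡r  = p≢r p≡r

    ^∣-multiple : ∀ {m k z x} → m ℕ.≤ k → z ≅ + (p ℕ.^ m) * x [ p ℕ.^ k ] → + (p ℕ.^ m) ℤ∣.∣ z
    ^∣-multiple {x = x} m≤k e =
      ∣-resp-≅ (≅-sym (≅-weaken (^-∣-^ p m≤k) e)) (ℤ∣.∣m⇒∣m*n x ℤ∣.∣-refl)

    -- The strict bound m < k makes p^(m+1) divide the modulus, so divisibility passes from z to p^m
    -- x, where p^m cancels.
    ^suc∤-multiple : ∀ {m k z x} → m ℕ.< k → ¬ (+ p ℤ∣.∣ x) → z ≅ + (p ℕ.^ m) * x [ p ℕ.^ k ] →
                     ¬ (+ (p ℕ.^ suc m) ℤ∣.∣ z)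
    ^suc∤-multiple {m} {k} {z} {x} m<k p∤x e p^[1+m]∣z = p∤x (ℤ∣.*-cancelˡ-∣ (+ (p ℕ.^ m))
      (subst (ℤ∣._∣ + (p ℕ.^ m) * x) (trans (cong +_ (ℕₚ.*-comm p (p ℕ.^ m))) (ℤₚ.pos-* (p ℕ.^ m) p))
        (∣-resp-≅ (≅-weaken (^-∣-^ p m<k) e) p^[1+m]∣z)))
      where instance _ = ℕₚ.m^n≢0 p m

    *^-∤suc : ∀ {m z} u → z ≡ u * + (p ℕ.^ m) → ¬ (+ (p ℕ.^ suc m) ℤ∣.∣ z) → ¬ (+ p ℤ∣.∣ u)
    *^-∤suc {m} u z≡ p^[1+m]∤z p∣u = p^[1+m]∤z
      (subst₂ ℤ∣._∣_ (sym (ℤₚ.pos-* p (p ℕ.^ m))) (sym z≡) (ℤ∣.*-monoˡ-∣ (+ (p ℕ.^ m)) p∣u))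

  -- Oddness is recorded as `2 ∣ suc e`: the induction step then merely swaps the alternatives, and
  -- the quotient (e + 1)/2 is available as an exponent.
  neg-^ : ∀ x e → (2 ℕ∣.∣ e × (- x) ^ e ≡ x ^ e) ⊎ (2 ℕ∣.∣ suc e × (- x) ^ e ≡ - (x ^ e))
  neg-^ x zero    = inj₁ (2 ℕ∣.∣0 , refl)
  neg-^ x (suc e) with neg-^ x e
  ... | inj₁ (2∣e , eq)   = inj₂ (ℕ∣.∣m∣n⇒∣m+n ℕ∣.∣-refl 2∣e , trans (cong (- x *_) eq) (sym (ℤₚ.neg-distribˡ-* x (x ^ e))))
  ... | inj₂ (2∣e+1 , eq) = inj₁ (2∣e+1 , trans (cong (- x *_) eq) (lemma x (x ^ e)))
    where
    lemma : ∀ x y → - x * - y ≡ x * y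
    lemma = solve-∀

  neg-^-odd : ∀ x {e} → ¬ (2 ℕ∣.∣ e) → (- x) ^ e ≡ - (x ^ e)
  neg-^-odd x {e} e-odd with neg-^ x e
  ... | inj₁ (2∣e , _) = contradiction 2∣e e-odd
  ... | inj₂ (_ , eq)  = eq

  neg-^-even : ∀ x {e} → 2 ℕ∣.∣ e → (- x) ^ e ≡ x ^ e
  neg-^-even x {e} 2∣e with neg-^ x e
  ... | inj₁ (_ , eq)    = eq
  ... | inj₂ (2∣e+1 , _) = contradiction (ℕ∣.∣m+n∣m⇒∣n (subst (2 ℕ∣.∣_) (ℕₚ.+-comm 1 e) 2∣e+1) 2∣e) λ 2∣1 → contradiction (ℕ∣.∣1⇒≡1 2∣1) λ ()

-- Cyclotomic cosets as sets of integers.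

module Coset where
  open import Data.Integer.Base using (_*_; _+_; _-_; -_; _^_)
  open Congruence
  open Order

  -- A predicate on ℤ with arbitrary modulus, so that one notion serves both modulo n and modulo
  -- p^s, whereas `C` is tied to `Fin n`.
  record Coset (m l : ℕ) (γ z : ℤ) : Set where
    constructor _at_
    field
      exponent : ℕ
      power    : z ≅ γ * (+ l) ^ exponent [ m ]

  coset? : ∀ m l .{{_ : ℕ.NonZero m}} γ z → Dec (Coset m l γ z)
  coset? m l γ z = map′
    (λ (r , e) → Fin.toℕ r at congruent e)
    (λ (r at e) → let r′ , e′ = bounded-exponent m l γ r in
      r′ , difference (≅-trans e (congruent e′)))
    (Finₚ.any? λ r → + m ℤ∣.∣? z - γ * (+ l) ^ Fin.toℕ r)

  coset-resp-≅ : ∀ {m l γ y z} → y ≅ z [ m ] → Coset m l γ y → Coset m l γ z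
  coset-resp-≅ y≅z (r at e) = r at ≅-trans (≅-sym y≅z) e

  coset-⊆ : ∀ {m l γ γ′ z} r → γ ≅ γ′ * (+ l) ^ r [ m ] → Coset m l γ z → Coset m l γ′ z
  coset-⊆ {m} {l} {γ} {γ′} {z} r e (a at f) = (r ℕ.+ a) at (begin
    z                              ≈⟨ f ⟩
    γ * (+ l) ^ a                  ≈⟨ *-cong e ≅-refl ⟩
    γ′ * (+ l) ^ r * (+ l) ^ a     ≡⟨ ℤₚ.*-assoc γ′ ((+ l) ^ r) ((+ l) ^ a) ⟩
    γ′ * ((+ l) ^ r * (+ l) ^ a)   ≡⟨ cong (γ′ *_) (ℤₚ.^-distribˡ-+-* (+ l) r a) ⟨
    γ′ * (+ l) ^ (r ℕ.+ a)         ∎)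
    where open ≅-Reasoning m

  -- The factor l^r is undone by its inverse, which is again a power of l because l has an order.
  coset-⊇ : ∀ {m l γ γ′ z d} → HasOrder m (+ l) d → ∀ r → γ ≅ γ′ * (+ l) ^ r [ m ] →
            Coset m l γ′ z → Coset m l γ z
  coset-⊇ {m} {l} {γ} {γ′} {z} {d} ord r e = coset-⊆ (r ℕ.* ℕ.pred d) (≅-sym (begin
    γ * (+ l) ^ (r ℕ.* ℕ.pred d)                      ≈⟨ *-cong e ≅-refl ⟩
    γ′ * (+ l) ^ r * (+ l) ^ (r ℕ.* ℕ.pred d)          ≡⟨ ℤₚ.*-assoc γ′ _ _ ⟩
    γ′ * ((+ l) ^ r * (+ l) ^ (r ℕ.* ℕ.pred d))        ≈⟨ *-congˡ γ′ (^-inverse m (+ l) d ord r) ⟩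
    γ′ * 1ℤ                                           ≡⟨ ℤₚ.*-identityʳ γ′ ⟩
    γ′                                                ∎))
    where open ≅-Reasoning m

-- Powers of l modulo p^s when l has odd order.

module OddOrder (p s l d : ℕ) (p-prime : Prime p) (1≤s : 1 ℕ.≤ s) (p-odd : ¬ (2 ℕ∣.∣ p))
                (d-odd : ¬ (2 ℕ∣.∣ d)) (ord : HasOrder (p ℕ.^ s) (+ l) d) where
  open import Data.Integer.Base using (_*_; _+_; _-_; -_; _^_)
  open Congruence
  open Order
  open PrimePower
  open Coset

  private
    instance
      p-nonZero = Prime.prime⇒nonZero p-prime
      p^s-nonZero = ℕₚ.m^n≢0 p s
    λ^_ : ℕ → ℤ
    λ^ r = (+ l) ^ r

  ≅-mod-p : ∀ {a b} → a ≅ b [ p ℕ.^ s ] → a ≅ b [ p ]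
  ≅-mod-p = ≅-weaken (base∣^ p 1≤s)

  ^d≅1 : ∀ a → (λ^ a) ^ d ≅ 1ℤ [ p ℕ.^ s ]
  ^d≅1 a = ≅-trans (≡⇒≅ (trans (ℤₚ.^-*-assoc (+ l) a d) (cong λ^_ (ℕₚ.*-comm a d)))) (^[order*]≅1 (p ℕ.^ s) (+ l) d ord a)

  -- Raising l^a ≡ -l^b to the odd power d gives 1 ≡ -1, impossible modulo an odd prime. Excluding
  -- the congruence already modulo p, not only modulo p^s, is what `power-lift` requires.
  power≇-power : ∀ a b → ¬ (λ^ a ≅ - λ^ b [ p ])
  power≇-power a b e = contradiction (ℤ∣.∣⇒∣ᵤ (difference 1≅-1)) p∤2
    where
    1≅-1 : 1ℤ ≅ - 1ℤ [ p ]
    1≅-1 = begin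
      1ℤ               ≈⟨ ≅-mod-p (^d≅1 a) ⟨
      (λ^ a) ^ d       ≈⟨ ^-cong d e ⟩
      (- λ^ b) ^ d     ≡⟨ neg-^-odd (λ^ b) d-odd ⟩
      - ((λ^ b) ^ d)   ≈⟨ neg-cong (≅-mod-p (^d≅1 b)) ⟩
      - 1ℤ             ∎
      where open ≅-Reasoning p
    p∤2 : ¬ (p ℕ∣.∣ 2)
    p∤2 p∣2 with Prime.prime⇒irreducible Prime.prime[2] p∣2
    ... | inj₁ refl = Prime.¬prime[1] p-prime
    ... | inj₂ refl = p-odd ℕ∣.∣-refl

  -- An even exponent e removes the sign, so d divides e, and 2d divides e because d is odd. An odd
  -- exponent would make -1 a power of l.
  -l-order : HasOrder (p ℕ.^ s) (- + l) (2 ℕ.* d)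
  -l-order =
    ( ℕₚ.*-mono-< {0} {2} ℕ.z<s (order>0 (p ℕ.^ s) (+ l) d ord)
    , difference (begin
        (- + l) ^ (2 ℕ.* d)  ≡⟨ neg-^-even (+ l) (ℕ∣.m∣m*n d) ⟩
        λ^ (2 ℕ.* d)         ≡⟨ cong λ^_ (ℕₚ.*-comm 2 d) ⟩
        λ^ (d ℕ.* 2)         ≈⟨ ^[order*]≅1 (p ℕ.^ s) (+ l) d ord 2 ⟩
        1ℤ                   ∎)
    , λ e e>0 c → minimal e e>0 (congruent c) )
    where
    open ≅-Reasoning (p ℕ.^ s)
    minimal : ∀ e → 0 ℕ.< e → (- + l) ^ e ≅ 1ℤ [ p ℕ.^ s ] → 2 ℕ.* d ℕ.≤ e
    minimal e e>0 c with neg-^ (+ l) e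
    ... | inj₂ (_ , eq) = contradiction
            (≅-trans (≡⇒≅ (sym (ℤₚ.neg-involutive (λ^ e))))
                     (neg-cong (≅-trans (≡⇒≅ (sym eq)) (≅-mod-p c))))
            (power≇-power e 0)
    ... | inj₁ (2∣e , eq) with order∣ (p ℕ.^ s) (+ l) d ord e (≅-trans (≡⇒≅ (sym eq)) c)
    ...   | ℕ∣.divides v refl = ℕ∣.∣⇒≤ {{ℕ.>-nonZero e>0}}
            (ℕ∣.*-monoˡ-∣ d (ℕᶜ.coprime-divisor {2} {d} {v} (ℕᶜ.sym (∤⇒coprime Prime.prime[2] {+ d} (d-odd ∘ ℤ∣.∣⇒∣ᵤ)))
              (subst (2 ℕ∣.∣_) (ℕₚ.*-comm v d) 2∣e)))

  p∤power : ∀ r → ¬ (+ p ℤ∣.∣ λ^ r)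
  p∤power r = coprime⇒∤ p-prime {λ^ r} 1≤s (^-coprime (p ℕ.^ s) (+ l) d ord r)

  UnitCases : Set
  UnitCases = ∀ u → ¬ (+ p ℤ∣.∣ u) →
              (∃ λ r → u ≅ λ^ r [ p ℕ.^ s ]) ⊎ (∃ λ r → u ≅ - λ^ r [ p ℕ.^ s ])

  -- Since -l has order 2d = φ(p^s), it is a primitive root, and its powers are those of l up to
  -- sign.
  unit-cases : φ (p ℕ.^ s) ≡ 2 ℕ.* d → UnitCases
  unit-cases φ≡2d u p∤u = signs (primitive-root-generates (p ℕ.^ s) (- + l) -l-primitive u (∤⇒coprime-^ p-prime {u} s p∤u))
    where
    -l-primitive : PrimitiveRoot (- + l) (p ℕ.^ s)
    -l-primitive = subst (HasOrder (p ℕ.^ s) (- + l)) (sym φ≡2d) -l-order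
    signs : (∃ λ r → u ≅ (- + l) ^ r [ p ℕ.^ s ]) →
            (∃ λ r → u ≅ λ^ r [ p ℕ.^ s ]) ⊎ (∃ λ r → u ≅ - λ^ r [ p ℕ.^ s ])
    signs (r , e) = Sum.map (λ (_ , eq) → r , ≅-trans e (≡⇒≅ eq)) (λ (_ , eq) → r , ≅-trans e (≡⇒≅ eq)) (neg-^ (+ l) r)

  module _ (cases : UnitCases) where

    -- As a unit, u is plus or minus a power of l modulo p^s; the minus sign would survive reduction
    -- modulo p.
    power-lift : ∀ {u} a → u ≅ λ^ a [ p ] → ∃ λ b → u ≅ λ^ b [ p ℕ.^ s ]
    power-lift {u} a e = [ (λ r → r)
                         , (λ (b , e′) → contradiction (≅-trans (≅-sym e) (≅-mod-p e′)) (power≇-power a b)) ]′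
                         (cases u (p∤power a ∘ ∣-resp-≅ e))

    -- A square root x of a modulo p is ± l^r modulo p^s, and squaring removes the sign. This
    -- identifies a modulo p only, whence the appeal to `power-lift`.
    residue⇒power : ∀ {a} → ¬ (+ p ℤ∣.∣ a) → QuadraticResidue a p → ∃ λ r → a ≅ λ^ r [ p ℕ.^ s ]
    residue⇒power {a} p∤a (_ , x , x²≡a) = power-lift k (≅-trans (≅-sym x²≅a) (≅-mod-p (proj₂ square)))
      where
      x²≅a : x * x ≅ a [ p ]
      x²≅a = congruent x²≡a
      p∤x : ¬ (+ p ℤ∣.∣ x)
      p∤x p∣x = p∤a (∣-resp-≅ x²≅a (ℤ∣.∣m⇒∣m*n x p∣x))
      lemma : ∀ y → - y * - y ≡ y * y
      lemma = solve-∀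
      square : ∃ λ k → x * x ≅ λ^ k [ p ℕ.^ s ]
      square = [ (λ (r , e) → r ℕ.+ r , ≅-trans (*-cong e e) (≡⇒≅ (sym (ℤₚ.^-distribˡ-+-* (+ l) r r))))
               , (λ (r , e) → r ℕ.+ r , ≅-trans (*-cong e e) (≡⇒≅ (trans (lemma (λ^ r)) (sym (ℤₚ.^-distribˡ-+-* (+ l) r r))))) ]′
               (cases x p∤x)
      k = proj₁ square

    -- As the order d of l is odd, l = (l ^ ((d + 1) / 2)) ^ 2 is a square.
    nonresidue⇒-power : ∀ {a} → ¬ (+ p ℤ∣.∣ a) → QuadraticNonresidue a p → ∃ λ r → a ≅ - λ^ r [ p ℕ.^ s ]
    nonresidue⇒-power {a} p∤a (_ , nonsquare) with cases a p∤a
    ... | inj₂ r       = r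
    ... | inj₁ (r , e) with neg-^ 1ℤ d
    ...   | inj₁ (2∣d , _) = contradiction 2∣d d-odd
    ...   | inj₂ (ℕ∣.divides f d+1≡f*2 , _) = contradiction (x , difference (≅-mod-p (begin
      x * x                      ≡⟨ ℤₚ.^-distribˡ-+-* (+ l) (r ℕ.* f) (r ℕ.* f) ⟨
      λ^ (r ℕ.* f ℕ.+ r ℕ.* f)   ≡⟨ cong λ^_ exponent ⟩
      λ^ (r ℕ.+ d ℕ.* r)         ≈⟨ ^-period (p ℕ.^ s) (+ l) d ord r r ⟩
      λ^ r                       ≈⟨ e ⟨
      a                          ∎))) nonsquare
      where
      open ≅-Reasoning (p ℕ.^ s)
      x = λ^ (r ℕ.* f)
      exponent : r ℕ.* f ℕ.+ r ℕ.* f ≡ r ℕ.+ d ℕ.* r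
      exponent = trans (sym (ℕₚ.*-distribˡ-+ r f f)) (trans (cong (r ℕ.*_)
        (trans (trans (cong (f ℕ.+_) (sym (ℕₚ.+-identityʳ f))) (ℕₚ.*-comm 2 f)) (sym d+1≡f*2))) (ℕₚ.*-comm r (suc d)))

    -- The d-th power of any power of l is 1. This puts g, whose order is 2d, on the negative side.
    order≢d⇒-power : ∀ {a} → ¬ (+ p ℤ∣.∣ a) → ¬ (a ^ d ≅ 1ℤ [ p ℕ.^ s ]) → ∃ λ r → a ≅ - λ^ r [ p ℕ.^ s ]
    order≢d⇒-power {a} p∤a a^d≇1 with cases a p∤a
    ... | inj₂ r       = r
    ... | inj₁ (r , e) = contradiction (≅-trans (^-cong d e) (^d≅1 r)) a^d≇1

    -- p^i c l^a + p^i′ c x = p^i c u with u ≡ l^a modulo p, so that u is again a power of l.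
    coset-translate : ∀ {i i′ c w y} x → i ℕ.< i′ → y ≅ + (p ℕ.^ i′) * c * x [ p ℕ.^ s ] →
      Coset (p ℕ.^ s) l (+ (p ℕ.^ i) * c) w → Coset (p ℕ.^ s) l (+ (p ℕ.^ i) * c) (w + y)
    coset-translate {i} {i′} {c} {w} {y} x i<i′ y≅ (a at w≅) = b at (begin
      w + y                                                  ≈⟨ +-cong w≅ y≅ ⟩
      + (p ℕ.^ i) * c * λ^ a + + (p ℕ.^ i′) * c * x          ≡⟨ cong (λ z → + (p ℕ.^ i) * c * λ^ a + z * c * x) p^i′≡ ⟩
      + (p ℕ.^ i) * c * λ^ a + + (p ℕ.^ i) * (+ p * e) * c * x  ≡⟨ lemma (+ (p ℕ.^ i)) c (λ^ a) (+ p) e x ⟩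
      + (p ℕ.^ i) * c * u                                    ≈⟨ *-congˡ (+ (p ℕ.^ i) * c) u≅ ⟩
      + (p ℕ.^ i) * c * λ^ b                                 ∎)
      where
      open ≅-Reasoning (p ℕ.^ s)
      e = + (p ℕ.^ (i′ ℕ.∸ suc i))
      p^i′≡ : + (p ℕ.^ i′) ≡ + (p ℕ.^ i) * (+ p * e)
      p^i′≡ = trans (cong (λ k → + (p ℕ.^ k)) (sym (trans (ℕₚ.+-suc i (i′ ℕ.∸ suc i)) (ℕₚ.m+[n∸m]≡n i<i′))))
        (trans (cong +_ (ℕₚ.^-distribˡ-+-* p i (suc (i′ ℕ.∸ suc i))))
        (trans (ℤₚ.pos-* (p ℕ.^ i) _) (cong (+ (p ℕ.^ i) *_) (ℤₚ.pos-* p _))))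
      u = λ^ a + + p * e * x
      lemma : ∀ P c L p e x → P * c * L + P * (p * e) * c * x ≡ P * c * (L + p * e * x)
      lemma = solve-∀
      u≅λ^a : u ≅ λ^ a [ p ]
      u≅λ^a = ≅-trans (+-cong (≅-refl {λ^ a}) (∣⇒≅0 (ℤ∣.∣m⇒∣m*n x (ℤ∣.∣m⇒∣m*n e ℤ∣.∣-refl)))) (≡⇒≅ (ℤₚ.+-identityʳ (λ^ a)))
      b = proj₁ (power-lift a u≅λ^a)
      u≅ = proj₂ (power-lift a u≅λ^a)

-- Cosets modulo n described by a residue modulo p^s and a q-adic valuation.

module CosetDecomposition (p s q t l d e : ℕ) (q-prime : Prime q) (1≤t : 1 ℕ.≤ t)
    (p^s⊥q^t : ℕᶜ.Coprime (p ℕ.^ s) (q ℕ.^ t)) (d⊥e : ℕᶜ.Coprime e d)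
    (ordₚ : HasOrder (p ℕ.^ s) (+ l) d) (ord-q : HasOrder (q ℕ.^ t) (+ l) e) where
  open import Data.Integer.Base using (_*_; _^_)
  open Congruence
  open Order
  open PrimePower
  open Coset

  n : ℕ
  n = p ℕ.^ s ℕ.* q ℕ.^ t

  private
    instance
      q-nonZero = Prime.prime⇒nonZero q-prime
      q^t-nonZero = ℕₚ.m^n≢0 q t
    λ^_ : ℕ → ℤ
    λ^ r = (+ l) ^ r

  -- The base is l^d rather than l because its powers are 1 modulo p^s: the residue modulo q^t can
  -- be corrected without disturbing the other one.
  Generates : Set
  Generates = ∀ u → ¬ (+ q ℤ∣.∣ u) → ∃ λ v → u ≅ (λ^ d) ^ v [ q ℕ.^ t ]

  -- If (l^d)^k ≡ 1 then e divides d k, hence k, by the coprimality of e and d.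
  l^d-order : HasOrder (q ℕ.^ t) (λ^ d) e
  l^d-order = order>0 _ _ _ ord-q
    , difference (≅-trans (≡⇒≅ (trans (ℤₚ.^-*-assoc (+ l) d e) (cong λ^_ (ℕₚ.*-comm d e))))
                          (^[order*]≅1 (q ℕ.^ t) (+ l) e ord-q d))
    , λ k k>0 c → ℕ∣.∣⇒≤ {{ℕ.>-nonZero k>0}} (ℕᶜ.coprime-divisor d⊥e
        (order∣ (q ℕ.^ t) (+ l) e ord-q (d ℕ.* k) (≅-trans (≡⇒≅ (sym (ℤₚ.^-*-assoc (+ l) d k))) (congruent c))))

  l^d-generates : φ (q ℕ.^ t) ≡ e → Generates
  l^d-generates φ≡e u q∤u = primitive-root-generates (q ℕ.^ t) (λ^ d)
    (subst (HasOrder (q ℕ.^ t) (λ^ d)) (sym φ≡e) l^d-order) u (∤⇒coprime-^ q-prime {u} t q∤u)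

  q∤power : ∀ r → ¬ (+ q ℤ∣.∣ λ^ r)
  q∤power r = coprime⇒∤ q-prime {λ^ r} 1≤t (^-coprime (q ℕ.^ t) (+ l) e ord-q r)

  module _ (generates : Generates) {γ c : ℤ} {m : ℕ} (γ≡ : γ ≡ + (q ℕ.^ m) * c) (m≤t : m ℕ.≤ t) (q∤c : ¬ (+ q ℤ∣.∣ c)) where

    coset⇒cosetₚ : ∀ {z} → Coset n l γ z → Coset (p ℕ.^ s) l γ z
    coset⇒cosetₚ (r at f) = r at ≅-weaken (ℕ∣.m∣m*n (q ℕ.^ t)) f

    coset⇒≅ : ∀ {z} → Coset n l γ z → ∃ λ r → z ≅ + (q ℕ.^ m) * (c * λ^ r) [ q ℕ.^ t ]
    coset⇒≅ (r at f) = r , ≅-trans (≅-weaken (ℕ∣.n∣m*n (p ℕ.^ s)) f)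
      (≡⇒≅ (trans (cong (_* λ^ r) γ≡) (ℤₚ.*-assoc (+ (q ℕ.^ m)) c (λ^ r))))

    q∤c*power : ∀ r → ¬ (+ q ℤ∣.∣ c * λ^ r)
    q∤c*power r = [ q∤c , q∤power r ]′ ∘ euclid q-prime c (λ^ r)

    coset⇒q^m∣ : ∀ {z} → Coset n l γ z → + (q ℕ.^ m) ℤ∣.∣ z
    coset⇒q^m∣ z∈ = ^∣-multiple q-prime m≤t (proj₂ (coset⇒≅ z∈))

    coset⇒q^[1+m]∤ : ∀ {z} → m ℕ.< t → Coset n l γ z → ¬ (+ (q ℕ.^ suc m) ℤ∣.∣ z)
    coset⇒q^[1+m]∤ m<t z∈ = ^suc∤-multiple q-prime m<t (q∤c*power (proj₁ (coset⇒≅ z∈))) (proj₂ (coset⇒≅ z∈))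

    -- The exponent r + d v acts as r modulo p^s, where l has order d, while v remains free to fit
    -- the residue modulo q^t.
    combine : ∀ {z} r v → z ≅ γ * λ^ r [ p ℕ.^ s ] → z ≅ γ * (λ^ r * (λ^ d) ^ v) [ q ℕ.^ t ] → Coset n l γ z
    combine {z} r v f g = (r ℕ.+ d ℕ.* v) at chinese-remainder (p ℕ.^ s) (q ℕ.^ t) p^s⊥q^t
      (≅-trans f (*-congˡ γ (≅-sym (^-period (p ℕ.^ s) (+ l) d ordₚ r v))))
      (≅-trans g (≡⇒≅ (cong (γ *_) (trans (cong (λ^ r *_) (ℤₚ.^-*-assoc (+ l) d v))
                                          (sym (ℤₚ.^-distribˡ-+-* (+ l) r (d ℕ.* v)))))))

    -- Write z = q^m u with q not dividing u. The quotient of u by c l^r is a unit modulo q^t, hence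
    -- some (l^d)^v, and this v corrects the exponent r.
    cosetₚ⇒coset : ∀ {z} → Coset (p ℕ.^ s) l γ z → + (q ℕ.^ m) ℤ∣.∣ z → ¬ (+ (q ℕ.^ suc m) ℤ∣.∣ z) →
                   Coset n l γ z
    cosetₚ⇒coset {z} (r at f) (divides u z≡) q^[1+m]∤z = combine r (proj₁ y-power) f (begin
      z                                        ≡⟨ trans z≡ (ℤₚ.*-comm u (+ (q ℕ.^ m))) ⟩
      + (q ℕ.^ m) * u                          ≡⟨ cong (+ (q ℕ.^ m) *_) (ℤₚ.*-identityʳ u) ⟨
      + (q ℕ.^ m) * (u * 1ℤ)                   ≈⟨ *-congˡ (+ (q ℕ.^ m)) (*-congˡ u (proj₂ w)) ⟨
      + (q ℕ.^ m) * (u * (c * λ^ r * proj₁ w)) ≡⟨ lemma (+ (q ℕ.^ m)) u c (λ^ r) (proj₁ w) ⟩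
      + (q ℕ.^ m) * c * (λ^ r * (u * proj₁ w)) ≡⟨ cong (_* (λ^ r * (u * proj₁ w))) γ≡ ⟨
      γ * (λ^ r * (u * proj₁ w))               ≈⟨ *-congˡ γ (*-congˡ (λ^ r) (proj₂ y-power)) ⟩
      γ * (λ^ r * (λ^ d) ^ proj₁ y-power)      ∎)
      where
      open ≅-Reasoning (q ℕ.^ t)
      lemma : ∀ Q u c L w → Q * (u * (c * L * w)) ≡ Q * c * (L * (u * w))
      lemma = solve-∀
      lemma′ : ∀ a b → b * a ≡ a * b
      lemma′ = solve-∀
      w : ∃ λ w → c * λ^ r * w ≅ 1ℤ [ q ℕ.^ t ]
      w = inverse (c * λ^ r) (∤⇒coprime-^ q-prime {c * λ^ r} t (q∤c*power r))
      q∤w : ¬ (+ q ℤ∣.∣ proj₁ w)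
      q∤w = coprime⇒∤ q-prime {proj₁ w} 1≤t
        (unit⇒coprime (proj₁ w) (c * λ^ r) (≅-trans (≡⇒≅ (lemma′ (c * λ^ r) (proj₁ w))) (proj₂ w)))
      q∤u : ¬ (+ q ℤ∣.∣ u)
      q∤u = *^-∤suc q-prime {m} u z≡ q^[1+m]∤z
      y-power : ∃ λ v → u * proj₁ w ≅ (λ^ d) ^ v [ q ℕ.^ t ]
      y-power = generates (u * proj₁ w) ([ q∤u , q∤w ]′ ∘ euclid q-prime u (proj₁ w))

    -- Here z and γ both vanish modulo q^t, so any v fits, and 0 is taken.
    cosetₚ⇒coset-top : ∀ {z} → m ≡ t → Coset (p ℕ.^ s) l γ z → + (q ℕ.^ m) ℤ∣.∣ z → Coset n l γ z
    cosetₚ⇒coset-top {z} refl (r at f) q^t∣z = combine r 0 f (≅-trans (∣⇒≅0 q^t∣z)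
      (≅-sym (∣⇒≅0 (ℤ∣.∣m⇒∣m*n (λ^ r * (λ^ d) ^ 0) (subst (+ (q ℕ.^ t) ℤ∣.∣_) (sym γ≡) (ℤ∣.∣m⇒∣m*n c ℤ∣.∣-refl))))))

-- Integer-valued indicators and counting in residue classes.

module Counting where
  open import Data.Integer.Base using (_*_; _+_; _-_; -_)
  open Congruence
  open PrimePower using (∤⇒coprime-^; coprime⇒∤)
  open RangeSum ℤₚ.+-0-commutativeMonoid
  open import Algebra.Properties.Semiring.Sum ℤₚ.+-*-semiring using (*-distribˡ-sum; *-distribʳ-sum)

  []-cong : ∀ {A B : Set} (a? : Dec A) (b? : Dec B) → (A → B) → (B → A) → [ a? ]₁ ≡ [ b? ]₁
  []-cong (yes a) (yes b) f g = refl
  []-cong (yes a) (no ¬b) f g = contradiction (f a) ¬b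
  []-cong (no ¬a) (yes b) f g = contradiction (g b) ¬a
  []-cong (no ¬a) (no ¬b) f g = refl

  []-yes : ∀ {A : Set} (a? : Dec A) → A → [ a? ]₁ ≡ 1ℤ
  []-yes (yes _) _ = refl
  []-yes (no ¬a) a = contradiction a ¬a

  []-no : ∀ {A : Set} (a? : Dec A) → ¬ A → [ a? ]₁ ≡ 0ℤ
  []-no (yes a) ¬a = contradiction a ¬a
  []-no (no _)  _  = refl

  -- A bracket used as a factor serves as a hypothesis: where it vanishes, nothing has to be shown
  -- about x and y.
  []-guard : ∀ {A : Set} (a? : Dec A) {x y} → (A → x ≡ y) → [ a? ]₁ * x ≡ [ a? ]₁ * y
  []-guard (yes a) e = cong (1ℤ *_) (e a)
  []-guard (no ¬a) e = refl

  δ : ℕ → ℤ → ℤ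
  δ m z = [ + m ℤ∣.∣? z ]₁

  δ-cong : ∀ {m a b} → a ≅ b [ m ] → δ m a ≡ δ m b
  δ-cong {m} {a} {b} e = []-cong (+ m ℤ∣.∣? a) (+ m ℤ∣.∣? b) (∣-resp-≅ e) (∣-resp-≅ (≅-sym e))

  -- Three summands are what the inclusion-exclusion in `convolution-count` produces; shorter
  -- combinations are padded with `0ℤ * 0ℤ`.
  ∑<-linear : ∀ n x y z F G H →
    ∑< n (λ k → x * F k + (y * G k + z * H k)) ≡ x * ∑< n F + (y * ∑< n G + z * ∑< n H)
  ∑<-linear zero    x y z F G H = lemma x y z
    where
    lemma : ∀ x y z → 0ℤ ≡ x * 0ℤ + (y * 0ℤ + z * 0ℤ)
    lemma = solve-∀
  ∑<-linear (suc n) x y z F G H = trans (cong (λ S → x * F 0 + (y * G 0 + z * H 0) + S) (∑<-linear n x y z (F ∘ suc) (G ∘ suc) (H ∘ suc)))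
    (lemma x y z (F 0) (G 0) (H 0) (∑< n (F ∘ suc)) (∑< n (G ∘ suc)) (∑< n (H ∘ suc)))
    where
    lemma : ∀ x y z a b c A B C → x * a + (y * b + z * c) + (x * A + (y * B + z * C)) ≡
                                  x * (a + A) + (y * (b + B) + z * (c + C))
    lemma = solve-∀

  *-distribˡ-∑< : ∀ n x F → x * ∑< n F ≡ ∑< n (λ k → x * F k)
  *-distribˡ-∑< n x F = *-distribˡ-sum {n} x (F ∘ Fin.toℕ)

  *-distribʳ-∑< : ∀ n x F → ∑< n F * x ≡ ∑< n (λ k → F k * x)
  *-distribʳ-∑< n x F = *-distribʳ-sum {n} x (F ∘ Fin.toℕ)

  ∑<-const : ∀ n x → ∑< n (λ _ → x) ≡ + n * x
  ∑<-const zero    x = refl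
  ∑<-const (suc n) x = trans (cong (λ S → x + S) (∑<-const n x)) (sym (ℤₚ.suc-* (+ n) x))

  -- The shift by one replaces -k by -(k + 1), whose representative n - (k + 1) is below n even at k
  -- = 0. What remains is a reversal of the range.
  ∑<-reflect : ∀ n (f : ℤ → ℤ) → (∀ {a b} → a ≅ b [ n ] → f a ≡ f b) →
               ∑< n (λ k → f (- + k)) ≡ ∑< n (λ k → f (+ k))
  ∑<-reflect n f periodic = begin
    ∑< n (λ k → f (- + k))             ≡⟨ ∑<-shift n (λ k → f (- + k)) (λ k → periodic (≅-trans (neg-cong (+-cong modulus≅0 (≅-refl {+ k}))) (≡⇒≅ (cong -_ (ℤₚ.+-identityˡ (+ k)))))) 1 ⟨
    ∑< n (λ k → f (- + suc k))         ≡⟨ ∑<-cong n (λ k k<n → periodic (complement k k<n)) ⟩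
    ∑< n (λ k → f (+ (n ℕ.∸ suc k)))   ≡⟨ ∑<-reverse n (λ k → f (+ k)) ⟩
    ∑< n (λ k → f (+ k))               ∎
    where
    open ≡-Reasoning
    complement : ∀ k → k ℕ.< n → - + suc k ≅ + (n ℕ.∸ suc k) [ n ]
    complement k k<n = ≅-trans (≡⇒≅ (sym (ℤₚ.+-identityˡ (- + suc k)))) (≅-trans (+-cong (≅-sym modulus≅0) (≅-refl { - + suc k}))
      (≡⇒≅ (trans (ℤₚ.m-n≡m⊖n n (suc k)) (ℤₚ.⊖-≥ k<n))))

  -- As b runs over M periods of length N, x − P b vanishes modulo N once per period.
  ∑<-δ : ∀ M N .{{_ : ℕ.NonZero N}} {P P⁻¹} → P * P⁻¹ ≅ 1ℤ [ N ] → ∀ x →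
         ∑< (M ℕ.* N) (λ b → δ N (x - P * + b)) ≡ + M
  ∑<-δ M N {P} {P⁻¹} PP⁻¹≅1 x = begin
    ∑< (M ℕ.* N) (λ b → δ N (x - P * + b))                      ≡⟨ ∑<-* M N (λ b → δ N (x - P * + b)) ⟩
    ∑< M (λ i → ∑< N (λ j → δ N (x - P * + (i ℕ.* N ℕ.+ j))))   ≡⟨ ∑<-cong M (λ i _ → trans (∑<-cong N (λ j _ → δ-cong (period i j))) once) ⟩
    ∑< M (λ _ → 1ℤ)                                             ≡⟨ ∑<-const M 1ℤ ⟩
    + M * 1ℤ                                                    ≡⟨ ℤₚ.*-identityʳ (+ M) ⟩
    + M                                                         ∎
    where
    open ≡-Reasoning
    period : ∀ i j → x - P * + (i ℕ.* N ℕ.+ j) ≅ x - P * + j [ N ]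
    period i j = -‿cong (≅-refl {x}) (*-congˡ P (≅-trans
      (+-cong (∣⇒≅0 (subst (+ N ℤ∣.∣_) (sym (ℤₚ.pos-* i N)) (ℤ∣.∣n⇒∣m*n (+ i) ℤ∣.∣-refl))) (≅-refl {+ j}))
      (≡⇒≅ (ℤₚ.+-identityˡ (+ j)))))
    root : ℕ
    root = (P⁻¹ * x) ℤᵈ.%ℕ N
    root≅ : P⁻¹ * x ≅ + root [ N ]
    root≅ = ≅-remainder (P⁻¹ * x) N
    at-root : x - P * + root ≅ 0ℤ [ N ]
    at-root = ≅-trans (-‿cong (≅-refl {x}) (≅-trans (*-congˡ P (≅-sym root≅))
      (≅-trans (≡⇒≅ (sym (ℤₚ.*-assoc P P⁻¹ x))) (≅-trans (*-cong PP⁻¹≅1 (≅-refl {x})) (≡⇒≅ (ℤₚ.*-identityˡ x))))))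
      (≡⇒≅ (ℤₚ.+-inverseʳ x))
    lemma : ∀ P P⁻¹ x b → P * P⁻¹ * b - P⁻¹ * x ≡ - P⁻¹ * (x - P * b)
    lemma = solve-∀
    lemma′ : ∀ a b → a - b + b ≡ a
    lemma′ = solve-∀
    unique : ∀ b → x - P * + b ≅ 0ℤ [ N ] → + b ≅ + root [ N ]
    unique b e = ≅-trans (≅-trans (≡⇒≅ (sym (ℤₚ.*-identityˡ (+ b)))) (*-cong (≅-sym PP⁻¹≅1) (≅-refl {+ b})))
      (≅-trans (≅-trans (≡⇒≅ (sym (lemma′ (P * P⁻¹ * + b) (P⁻¹ * x))))
                        (+-cong (≅-trans (≡⇒≅ (lemma P P⁻¹ x (+ b))) (*-congˡ (- P⁻¹) e)) root≅))
               (≡⇒≅ (trans (cong (_+ + root) (ℤₚ.*-zeroʳ (- P⁻¹))) (ℤₚ.+-identityˡ (+ root)))))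
    once : ∑< N (λ j → δ N (x - P * + j)) ≡ 1ℤ
    once = trans (∑<-single N (λ j → δ N (x - P * + j)) root (ℤᵈ.n%ℕd<d (P⁻¹ * x) N)
        (λ k k<N k≢root → []-no (+ N ℤ∣.∣? x - P * + k) (λ N∣ → k≢root
          (≅⇒≡-below k<N (ℤᵈ.n%ℕd<d (P⁻¹ * x) N) (unique k (∣⇒≅0 N∣))))))
      ([]-yes (+ N ℤ∣.∣? x - P * + root) (≅0⇒∣ at-root))

  -- The case P = -1 of `∑<-δ`, where -1 is its own inverse.
  ∑<-multiples : ∀ M N .{{_ : ℕ.NonZero N}} x → ∑< (M ℕ.* N) (λ b → δ N (x + + b)) ≡ + M
  ∑<-multiples M N x = trans (∑<-cong (M ℕ.* N) (λ b _ → cong (δ N) (lemma x (+ b))))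
    (∑<-δ M N { - 1ℤ} { - 1ℤ} ≅-refl x)
    where
    lemma : ∀ x b → x + b ≡ x - - 1ℤ * b
    lemma = solve-∀

  -- Write z = b A + a. The factor κ sees only a, and since A is invertible modulo N, the
  -- divisibility condition holds for M of the M N values of b, whatever a and w are.
  ∑<-independent : ∀ A M N .{{_ : ℕ.NonZero N}} → ℕᶜ.Coprime A N → (κ : ℤ → ℤ) →
    (∀ {a b} → a ≅ b [ A ] → κ a ≡ κ b) → ∀ w →
    ∑< (A ℕ.* (M ℕ.* N)) (λ z → κ (+ z) * δ N (w - + z)) ≡ ∑< A (λ a → κ (+ a)) * + M
  ∑<-independent A M N A⊥N κ periodic w = begin
    ∑< (A ℕ.* (M ℕ.* N)) (λ z → κ (+ z) * δ N (w - + z))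
      ≡⟨ cong (λ B → ∑< B (λ z → κ (+ z) * δ N (w - + z))) (ℕₚ.*-comm A (M ℕ.* N)) ⟩
    ∑< (M ℕ.* N ℕ.* A) (λ z → κ (+ z) * δ N (w - + z))
      ≡⟨ ∑<-* (M ℕ.* N) A (λ z → κ (+ z) * δ N (w - + z)) ⟩
    ∑< (M ℕ.* N) (λ b → ∑< A (λ a → κ (+ (b ℕ.* A ℕ.+ a)) * δ N (w - + (b ℕ.* A ℕ.+ a))))
      ≡⟨ ∑<-cong (M ℕ.* N) (λ b _ → ∑<-cong A (λ a _ → cong₂ _*_ (periodic (period b a)) (cong (δ N) (split b a)))) ⟩
    ∑< (M ℕ.* N) (λ b → ∑< A (λ a → κ (+ a) * δ N (w - + a - + A * + b)))
      ≡⟨ ∑<-comm (M ℕ.* N) A (λ b a → κ (+ a) * δ N (w - + a - + A * + b)) ⟩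
    ∑< A (λ a → ∑< (M ℕ.* N) (λ b → κ (+ a) * δ N (w - + a - + A * + b)))
      ≡⟨ ∑<-cong A (λ a _ → trans (sym (*-distribˡ-∑< (M ℕ.* N) (κ (+ a)) (λ b → δ N (w - + a - + A * + b)))) (cong (κ (+ a) *_) (∑<-δ M N {+ A} {proj₁ A⁻¹} (proj₂ A⁻¹) (w - + a)))) ⟩
    ∑< A (λ a → κ (+ a) * + M)
      ≡⟨ *-distribʳ-∑< A (+ M) (λ a → κ (+ a)) ⟨
    ∑< A (λ a → κ (+ a)) * + M  ∎
    where
    open ≡-Reasoning
    A⁻¹ : ∃ λ b → + A * b ≅ 1ℤ [ N ]
    A⁻¹ = inverse (+ A) A⊥N
    period : ∀ b a → + (b ℕ.* A ℕ.+ a) ≅ + a [ A ]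
    period b a = ≅-trans
      (+-cong (∣⇒≅0 (subst (+ A ℤ∣.∣_) (sym (ℤₚ.pos-* b A)) (ℤ∣.∣n⇒∣m*n (+ b) ℤ∣.∣-refl))) (≅-refl {+ a}))
      (≡⇒≅ (ℤₚ.+-identityˡ (+ a)))
    lemma : ∀ w A a b → w - (b * A + a) ≡ w - a - A * b
    lemma = solve-∀
    split : ∀ b a → w - + (b ℕ.* A ℕ.+ a) ≡ w - + a - + A * + b
    split b a = trans (cong (λ z → w - (z + + a)) (ℤₚ.pos-* b A)) (lemma w (+ A) (+ a) (+ b))

  length-filter : ∀ {P : Pred ℕ 0ℓ} (P? : Decidable P) n f →
    + length (filter P? (map suc (applyUpTo f n))) ≡ ∑< n (λ k → [ P? (suc (f k)) ]₁)
  length-filter P? zero    f = refl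
  length-filter P? (suc n) f with does (P? (suc (f 0)))
  ... | true  = cong (λ S → 1ℤ + S) (length-filter P? n (f ∘ suc))
  ... | false = trans (length-filter P? n (f ∘ suc)) (sym (ℤₚ.+-identityˡ _))

  -- Among 1, ..., p^(k+1) the numbers not coprime to p^(k+1) are the p^k multiples of p.
  φ-prime-power : ∀ {p} → Prime p → ∀ k → + φ (p ℕ.^ suc k) ≡ + p * + (p ℕ.^ k) - + (p ℕ.^ k)
  φ-prime-power {p} p-prime k = begin
    + φ m                                                ≡⟨ length-filter (λ a → ℕᶜ.coprime? a m) m (λ a → a) ⟩
    ∑< m (λ a → [ ℕᶜ.coprime? (suc a) m ]₁)              ≡⟨ ∑<-cong m (λ a _ → complement a) ⟩
    ∑< m (λ a → 1ℤ * 1ℤ + (- 1ℤ * δ p (1ℤ + + a) + 0ℤ * 0ℤ))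
                                                         ≡⟨ ∑<-linear m 1ℤ (- 1ℤ) 0ℤ (λ _ → 1ℤ) (λ a → δ p (1ℤ + + a)) (λ _ → 0ℤ) ⟩
    1ℤ * ∑< m (λ _ → 1ℤ) + (- 1ℤ * ∑< m (λ a → δ p (1ℤ + + a)) + 0ℤ * ∑< m (λ _ → 0ℤ))
                                                         ≡⟨ cong₂ (λ x y → 1ℤ * x + (- 1ℤ * y + 0ℤ * ∑< m (λ _ → 0ℤ)))
                                                              (trans (∑<-const m 1ℤ) (cong (_* 1ℤ) (ℤₚ.pos-* p (p ℕ.^ k))))
                                                              (trans (cong (λ B → ∑< B (λ a → δ p (1ℤ + + a))) (ℕₚ.*-comm p (p ℕ.^ k)))
                                                                     (∑<-multiples (p ℕ.^ k) p 1ℤ)) ⟩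
    1ℤ * (+ p * + (p ℕ.^ k) * 1ℤ) + (- 1ℤ * + (p ℕ.^ k) + 0ℤ * ∑< m (λ _ → 0ℤ))
                                                         ≡⟨ lemma (+ p * + (p ℕ.^ k)) (+ (p ℕ.^ k)) (∑< m (λ _ → 0ℤ)) ⟩
    + p * + (p ℕ.^ k) - + (p ℕ.^ k)                      ∎
    where
    open ≡-Reasoning
    instance _ = Prime.prime⇒nonZero p-prime
    m = p ℕ.^ suc k
    lemma : ∀ x y z → 1ℤ * (x * 1ℤ) + (- 1ℤ * y + 0ℤ * z) ≡ x - y
    lemma = solve-∀
    by-cases : ∀ {A B : Set} (a? : Dec A) (b? : Dec B) → (A → ¬ B) → (¬ B → A) →
               [ a? ]₁ ≡ 1ℤ * 1ℤ + (- 1ℤ * [ b? ]₁ + 0ℤ * 0ℤ)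
    by-cases (yes a) (yes b) f g = contradiction b (f a)
    by-cases (yes a) (no ¬b) f g = refl
    by-cases (no ¬a) (yes b) f g = refl
    by-cases (no ¬a) (no ¬b) f g = contradiction (g ¬b) ¬a
    complement : ∀ a → [ ℕᶜ.coprime? (suc a) m ]₁ ≡ 1ℤ * 1ℤ + (- 1ℤ * δ p (1ℤ + + a) + 0ℤ * 0ℤ)
    complement a = by-cases (ℕᶜ.coprime? (suc a) m) (+ p ℤ∣.∣? 1ℤ + + a)
      (λ c → coprime⇒∤ p-prime {+ suc a} {suc k} (ℕ.s≤s ℕ.z≤n) c)
      (λ p∤ → ∤⇒coprime-^ p-prime {+ suc a} (suc k) p∤)

-- The size of the coset of p^i c modulo p^s.

module HalfCount (p s l d : ℕ) (p-prime : Prime p) (1≤s : 1 ℕ.≤ s) (p-odd : ¬ (2 ℕ∣.∣ p))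
                 (d-odd : ¬ (2 ℕ∣.∣ d)) (ord : HasOrder (p ℕ.^ s) (+ l) d)
                 (cases : OddOrder.UnitCases p s l d p-prime 1≤s p-odd d-odd ord) where
  open import Data.Integer.Base using (_*_; _+_; _-_; -_; _^_)
  open Congruence
  open Order
  open PrimePower
  open Coset
  open Counting
  open OddOrder p s l d p-prime 1≤s p-odd d-odd ord
  open RangeSum ℤₚ.+-0-commutativeMonoid

  private instance
    p-nonZero = Prime.prime⇒nonZero p-prime
    p^s-nonZero = ℕₚ.m^n≢0 p s

  module _ {i : ℕ} (i<s : i ℕ.< s) (c : ℤ) (p∤c : ¬ (+ p ℤ∣.∣ c)) where
    private
      instance p^i-nonZero = ℕₚ.m^n≢0 p i
      instance p^[1+i]-nonZero = ℕₚ.m^n≢0 p (suc i)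
      γ = + (p ℕ.^ i) * c
      K = Coset (p ℕ.^ s) l γ
      K? = coset? (p ℕ.^ s) l γ

    coset-multiple : ∀ {z} → K z → ∃ λ r → z ≅ + (p ℕ.^ i) * (c * (+ l) ^ r) [ p ℕ.^ s ]
    coset-multiple (r at e) = r , ≅-trans e (≡⇒≅ (ℤₚ.*-assoc (+ (p ℕ.^ i)) c ((+ l) ^ r)))

    coset⇒∣ : ∀ {z} → K z → + (p ℕ.^ i) ℤ∣.∣ z
    coset⇒∣ z∈ = ^∣-multiple p-prime (ℕₚ.<⇒≤ i<s) (proj₂ (coset-multiple z∈))

    coset⇒∤ : ∀ {z} → K z → ¬ (+ (p ℕ.^ suc i) ℤ∣.∣ z)
    coset⇒∤ z∈ = ^suc∤-multiple p-prime i<s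
      ([ p∤c , p∤power (proj₁ (coset-multiple z∈)) ]′ ∘ euclid p-prime c _) (proj₂ (coset-multiple z∈))

    -- Because −1 is not a power of l modulo p.
    coset⇒neg∉coset : ∀ {z} → K z → ¬ K (- z)
    coset⇒neg∉coset {z} z∈ -z∈ = power≇-power a b
      (*-cancelˡ-coprime c (∤⇒coprime p-prime p∤c) (*-cancelˡ-modulus (p ℕ.^ i) (≅-weaken p^i*p∣p^s (begin
        + (p ℕ.^ i) * (c * (+ l) ^ a)      ≈⟨ proj₂ (coset-multiple z∈) ⟨
        z                                  ≡⟨ ℤₚ.neg-involutive z ⟨
        - - z                              ≈⟨ neg-cong (proj₂ (coset-multiple -z∈)) ⟩
        - (+ (p ℕ.^ i) * (c * (+ l) ^ b))  ≡⟨ lemma (+ (p ℕ.^ i)) c ((+ l) ^ b) ⟩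
        + (p ℕ.^ i) * (c * - (+ l) ^ b)    ∎))))
      where
      open ≅-Reasoning (p ℕ.^ s)
      a = proj₁ (coset-multiple z∈)
      b = proj₁ (coset-multiple -z∈)
      p^i*p∣p^s : p ℕ.^ i ℕ.* p ℕ∣.∣ p ℕ.^ s
      p^i*p∣p^s = subst (ℕ∣._∣ p ℕ.^ s) (ℕₚ.*-comm p (p ℕ.^ i)) (^-∣-^ p i<s)
      lemma : ∀ P c x → - (P * (c * x)) ≡ P * (c * - x)
      lemma = solve-∀

    -- With z = p^i u, the quotient of u by c is a unit modulo p^s, hence a power of l up to sign.
    ∈coset⊎neg∈coset : ∀ {z} → + (p ℕ.^ i) ℤ∣.∣ z → ¬ (+ (p ℕ.^ suc i) ℤ∣.∣ z) → K z ⊎ K (- z)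
    ∈coset⊎neg∈coset {z} (divides u z≡) p^[1+i]∤z = Sum.map
      (λ (r , e) → r at ≅-trans z≅ (*-congˡ γ e))
      (λ (r , e) → r at ≅-trans (neg-cong (≅-trans z≅ (*-congˡ γ e))) (≡⇒≅ (lemma′ γ ((+ l) ^ r))))
      (cases (u * proj₁ w) ([ *^-∤suc p-prime {i} u z≡ p^[1+i]∤z , p∤w ]′ ∘ euclid p-prime u (proj₁ w)))
      where
      open ≅-Reasoning (p ℕ.^ s)
      w : ∃ λ w → c * w ≅ 1ℤ [ p ℕ.^ s ]
      w = inverse c (∤⇒coprime-^ p-prime s p∤c)
      p∤w : ¬ (+ p ℤ∣.∣ proj₁ w)
      p∤w = coprime⇒∤ p-prime {proj₁ w} 1≤s
        (unit⇒coprime (proj₁ w) c (≅-trans (≡⇒≅ (ℤₚ.*-comm (proj₁ w) c)) (proj₂ w)))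
      lemma : ∀ P u c w → P * (u * (c * w)) ≡ P * c * (u * w)
      lemma = solve-∀
      lemma′ : ∀ γ x → - (γ * - x) ≡ γ * x
      lemma′ = solve-∀
      z≅ : z ≅ γ * (u * proj₁ w) [ p ℕ.^ s ]
      z≅ = begin
        z                                  ≡⟨ trans z≡ (ℤₚ.*-comm u (+ (p ℕ.^ i))) ⟩
        + (p ℕ.^ i) * u                    ≡⟨ cong (+ (p ℕ.^ i) *_) (ℤₚ.*-identityʳ u) ⟨
        + (p ℕ.^ i) * (u * 1ℤ)             ≈⟨ *-congˡ (+ (p ℕ.^ i)) (*-congˡ u (proj₂ w)) ⟨
        + (p ℕ.^ i) * (u * (c * proj₁ w))  ≡⟨ lemma (+ (p ℕ.^ i)) u c (proj₁ w) ⟩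
        γ * (u * proj₁ w)                  ∎

    partition : ∀ z → [ K? z ]₁ + [ K? (- z) ]₁ ≡ δ (p ℕ.^ i) z - δ (p ℕ.^ suc i) z
    partition z = by-cases (K? z) (K? (- z)) (+ (p ℕ.^ i) ℤ∣.∣? z) (+ (p ℕ.^ suc i) ℤ∣.∣? z)
      coset⇒∣ coset⇒∤ (neg∣ ∘ coset⇒∣) (λ k ∣z → coset⇒∤ k (ℤ∣.∣m⇒∣-m ∣z)) coset⇒neg∉coset ∈coset⊎neg∈coset
      (ℤ∣.∣-trans (ℤ∣.∣ᵤ⇒∣ (^-∣-^ p (ℕₚ.n≤1+n i))))
      where
      neg∣ : ∀ {m z} → m ℤ∣.∣ - z → m ℤ∣.∣ z
      neg∣ {m} {z} = subst (m ℤ∣.∣_) (ℤₚ.neg-involutive z) ∘ ℤ∣.∣m⇒∣-m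
      by-cases : ∀ {A B C D : Set} (a? : Dec A) (b? : Dec B) (c? : Dec C) (d? : Dec D) →
        (A → C) → (A → ¬ D) → (B → C) → (B → ¬ D) → (A → ¬ B) → (C → ¬ D → A ⊎ B) → (D → C) →
        [ a? ]₁ + [ b? ]₁ ≡ [ c? ]₁ - [ d? ]₁
      by-cases (yes a) (yes b) c? d? _ _ _ _ f _ _ = contradiction b (f a)
      by-cases (yes a) (no ¬b) (yes c) (yes d) _ f _ _ _ _ _ = contradiction d (f a)
      by-cases (yes a) (no ¬b) (yes c) (no ¬d) _ _ _ _ _ _ _ = refl
      by-cases (yes a) (no ¬b) (no ¬c) d? f _ _ _ _ _ _ = contradiction (f a) ¬c
      by-cases (no ¬a) (yes b) (yes c) (yes d) _ _ _ f _ _ _ = contradiction d (f b)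
      by-cases (no ¬a) (yes b) (yes c) (no ¬d) _ _ _ _ _ _ _ = refl
      by-cases (no ¬a) (yes b) (no ¬c) d? _ _ f _ _ _ _ = contradiction (f b) ¬c
      by-cases (no ¬a) (no ¬b) (yes c) (yes d) _ _ _ _ _ _ _ = refl
      by-cases (no ¬a) (no ¬b) (yes c) (no ¬d) _ _ _ _ _ f _ = [ (λ a → contradiction a ¬a) , (λ b → contradiction b ¬b) ]′ (f c ¬d)
      by-cases (no ¬a) (no ¬b) (no ¬c) (yes d) _ _ _ _ _ _ f = contradiction (f d) ¬c
      by-cases (no ¬a) (no ¬b) (no ¬c) (no ¬d) _ _ _ _ _ _ _ = refl

    indicator-periodic : ∀ {a b} → a ≅ b [ p ℕ.^ s ] → [ K? a ]₁ ≡ [ K? b ]₁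
    indicator-periodic {a} {b} e = []-cong (K? a) (K? b) (coset-resp-≅ e) (coset-resp-≅ (≅-sym e))

    -- The cosets of γ and −γ are exchanged by z ↦ −z, and together they consist
    -- of the residues of p-adic valuation i.
    2*∑coset : ∀ k → s ≡ i ℕ.+ suc k →
               + 2 * ∑< (p ℕ.^ s) (λ z → [ K? (+ z) ]₁) ≡ + p * + (p ℕ.^ k) - + (p ℕ.^ k)
    2*∑coset k s≡ = begin
      + 2 * S                                                        ≡⟨ lemma S ⟩
      S + S                                                          ≡⟨ cong (λ T → S + T) (∑<-reflect (p ℕ.^ s) (λ z → [ K? z ]₁) indicator-periodic) ⟨
      S + ∑< (p ℕ.^ s) (λ z → [ K? (- + z) ]₁)                       ≡⟨ ∑<-∙ (p ℕ.^ s) (λ z → [ K? (+ z) ]₁) (λ z → [ K? (- + z) ]₁) ⟨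
      ∑< (p ℕ.^ s) (λ z → [ K? (+ z) ]₁ + [ K? (- + z) ]₁)           ≡⟨ ∑<-cong (p ℕ.^ s) (λ z _ → trans (partition (+ z)) (lemma′ (δ (p ℕ.^ i) (+ z)) (δ (p ℕ.^ suc i) (+ z)))) ⟩
      ∑< (p ℕ.^ s) (λ z → 1ℤ * δ (p ℕ.^ i) (+ z) + (- 1ℤ * δ (p ℕ.^ suc i) (+ z) + 0ℤ * 0ℤ))
        ≡⟨ ∑<-linear (p ℕ.^ s) 1ℤ (- 1ℤ) 0ℤ (λ z → δ (p ℕ.^ i) (+ z)) (λ z → δ (p ℕ.^ suc i) (+ z)) (λ _ → 0ℤ) ⟩
      1ℤ * ∑< (p ℕ.^ s) (λ z → δ (p ℕ.^ i) (+ z)) + (- 1ℤ * ∑< (p ℕ.^ s) (λ z → δ (p ℕ.^ suc i) (+ z)) + 0ℤ * ∑< (p ℕ.^ s) (λ _ → 0ℤ))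
        ≡⟨ cong₂ (λ x y → 1ℤ * x + (- 1ℤ * y + 0ℤ * ∑< (p ℕ.^ s) (λ _ → 0ℤ)))
             (multiples (suc k) i (trans s≡ (ℕₚ.+-comm i (suc k))))
             (multiples k (suc i) (trans s≡ (trans (ℕₚ.+-suc i k) (ℕₚ.+-comm (suc i) k)))) ⟩
      1ℤ * + (p ℕ.^ suc k) + (- 1ℤ * + (p ℕ.^ k) + 0ℤ * ∑< (p ℕ.^ s) (λ _ → 0ℤ))
        ≡⟨ lemma″ (+ (p ℕ.^ suc k)) (+ (p ℕ.^ k)) (∑< (p ℕ.^ s) (λ _ → 0ℤ)) ⟩
      + (p ℕ.^ suc k) - + (p ℕ.^ k)                                  ≡⟨ cong (_- + (p ℕ.^ k)) (ℤₚ.pos-* p (p ℕ.^ k)) ⟩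
      + p * + (p ℕ.^ k) - + (p ℕ.^ k)                                ∎
      where
      open ≡-Reasoning
      S = ∑< (p ℕ.^ s) (λ z → [ K? (+ z) ]₁)
      lemma : ∀ x → + 2 * x ≡ x + x
      lemma = solve-∀
      lemma′ : ∀ x y → x - y ≡ 1ℤ * x + (- 1ℤ * y + 0ℤ * 0ℤ)
      lemma′ = solve-∀
      lemma″ : ∀ x y z → 1ℤ * x + (- 1ℤ * y + 0ℤ * z) ≡ x - y
      lemma″ = solve-∀
      multiples : ∀ a b .{{_ : ℕ.NonZero (p ℕ.^ b)}} → s ≡ a ℕ.+ b → ∑< (p ℕ.^ s) (λ z → δ (p ℕ.^ b) (+ z)) ≡ + (p ℕ.^ a)
      multiples a b refl = trans
        (cong (λ B → ∑< B (λ z → δ (p ℕ.^ b) (+ z))) (ℕₚ.^-distribˡ-+-* p a b))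
        (trans (∑<-cong (p ℕ.^ a ℕ.* p ℕ.^ b) (λ z _ → cong (δ (p ℕ.^ b)) (sym (ℤₚ.+-identityˡ (+ z)))))
               (∑<-multiples (p ℕ.^ a) (p ℕ.^ b) 0ℤ))

    -- Connects the doubled count with the truncated division in the theorem; for negative x the
    -- equation is absurd by computation.
    half : ∀ x m → + 2 * x ≡ + m → x ≡ + (m ℕ./ 2)
    half (+ x)    m e = cong +_ (sym (trans (cong (ℕ._/ 2) (trans (ℤₚ.+-injective (trans (sym e) (sym (ℤₚ.pos-* 2 x)))) (ℕₚ.*-comm 2 x))) (ℕᵈ.m*n/n≡m x 2)))
    half -[1+ x ] m ()

    ∑coset : ∑< (p ℕ.^ s) (λ z → [ K? (+ z) ]₁) ≡ + (φ (p ℕ.^ (s ℕ.∸ i)) ℕ./ 2)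
    ∑coset = half _ (φ (p ℕ.^ (s ℕ.∸ i))) (begin
      + 2 * ∑< (p ℕ.^ s) (λ z → [ K? (+ z) ]₁)  ≡⟨ 2*∑coset k (sym (trans (ℕₚ.+-suc i k) (ℕₚ.m+[n∸m]≡n i<s))) ⟩
      + p * + (p ℕ.^ k) - + (p ℕ.^ k)           ≡⟨ φ-prime-power p-prime k ⟨
      + φ (p ℕ.^ suc k)                         ≡⟨ cong (λ e → + φ (p ℕ.^ e)) (sym (ℕₚ.+-∸-assoc 1 i<s)) ⟩
      + φ (p ℕ.^ (s ℕ.∸ i))                     ∎)
      where
      open ≡-Reasoning
      k = s ℕ.∸ suc i

-- Inclusion-exclusion for a coefficient of the product.

module ConvolutionCount where
  open import Data.Integer.Base using (_*_; _+_; _-_; -_)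
  open Congruence
  open Counting
  open RangeSum ℤₚ.+-0-commutativeMonoid

  -- If B divides z - y, then y and z agree modulo B and hence modulo A.
  δ-absorb : ∀ A B x y z → A ℕ∣.∣ B → z - y ≡ x → δ B x * δ A y ≡ δ B x * δ A z
  δ-absorb A B x y z A∣B z-y≡x = []-guard (+ B ℤ∣.∣? x) (λ B∣x →
    sym (δ-cong {A} {z} {y} (≅-weaken A∣B (congruent (subst (+ B ℤ∣.∣_) (sym z-y≡x) B∣x)))))

  module _ (n A B : ℕ) (A∣B : A ℕ∣.∣ B) (κ κ′ : ℤ → ℤ) (x y : ℤ)
           (absorb : ∀ β w → κ′ β * κ (w - β) ≡ κ′ β * κ w)
           (countA : ∀ w → ∑< n (λ β → κ′ (+ β) * δ A (w - + β)) ≡ x)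
           (countB : ∀ w → ∑< n (λ β → κ′ (+ β) * δ B (w - + β)) ≡ y) where

    private
      δ-neg : ∀ m β → δ m β ≡ δ m (- β)
      δ-neg m β = []-cong (+ m ℤ∣.∣? β) (+ m ℤ∣.∣? - β) ℤ∣.∣m⇒∣-m (subst (+ m ℤ∣.∣_) (ℤₚ.neg-involutive β) ∘ ℤ∣.∣m⇒∣-m)

      count₀ : ∀ m {v} → (∀ w → ∑< n (λ β → κ′ (+ β) * δ m (w - + β)) ≡ v) → ∑< n (λ β → κ′ (+ β) * δ m (+ β)) ≡ v
      count₀ m count = trans (∑<-cong n (λ β _ → cong (κ′ (+ β) *_)
        (trans (δ-neg m (+ β)) (cong (δ m) (sym (ℤₚ.+-identityˡ (- + β))))))) (count 0ℤ)

      -- The letters a and b stand for `δ A` and `δ B` at the summation variable, c and d for the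
      -- same at its difference from w, and α and β for the same at w.
      expand : ∀ K′ κs κw a b c d α β → K′ * κs ≡ K′ * κw → a * c ≡ a * α → b * c ≡ b * α → d * a ≡ d * α → b * d ≡ b * β →
        K′ * (a - b) * (κs * (c - d)) ≡ κw * α * (K′ * a) + (κw * (β - α) * (K′ * b) + - (κw * α) * (K′ * d))
      expand K′ κs κw a b c d α β e₀ e₁ e₂ e₃ e₄ = begin
        K′ * (a - b) * (κs * (c - d))                        ≡⟨ lemma₁ K′ κs a b c d ⟩
        K′ * κs * (a * c - b * c - d * a + b * d)            ≡⟨ cong₂ _*_ e₀ (cong₂ _+_ (cong₂ _-_ (cong₂ _-_ e₁ e₂) e₃) e₄) ⟩
        K′ * κw * (a * α - b * α - d * α + b * β)            ≡⟨ lemma₂ K′ κw a b d α β ⟩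
        κw * α * (K′ * a) + (κw * (β - α) * (K′ * b) + - (κw * α) * (K′ * d))  ∎
        where
        open ≡-Reasoning
        lemma₁ : ∀ K′ κs a b c d → K′ * (a - b) * (κs * (c - d)) ≡ K′ * κs * (a * c - b * c - d * a + b * d)
        lemma₁ = solve-∀
        lemma₂ : ∀ K′ κw a b d α β → K′ * κw * (a * α - b * α - d * α + b * β) ≡
                 κw * α * (K′ * a) + (κw * (β - α) * (K′ * b) + - (κw * α) * (K′ * d))
        lemma₂ = solve-∀

    -- In each of the four products of indicators, one condition can be replaced by a condition on
    -- w, which leaves the sum. Only counts equal to x or y remain. The value is x - 2y if A divides
    -- w but B does not, and x - y if B divides w.
    convolution-count : ∀ w →
      ∑< n (λ β → κ′ (+ β) * (δ A (+ β) - δ B (+ β)) * (κ (w - + β) * (δ A (w - + β) - δ B (w - + β)))) ≡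
      κ w * (δ A w * (x - y - y) + δ B w * y)
    convolution-count w = begin
      ∑< n (λ β → κ′ (+ β) * (δ A (+ β) - δ B (+ β)) * (κ (w - + β) * (δ A (w - + β) - δ B (w - + β))))
        ≡⟨ ∑<-cong n (λ β _ → expand (κ′ (+ β)) (κ (w - + β)) (κ w) (δ A (+ β)) (δ B (+ β)) (δ A (w - + β)) (δ B (w - + β)) (δ A w) (δ B w)
             (absorb (+ β) w)
             (δ-absorb A A (+ β) (w - + β) w ℕ∣.∣-refl (lemma w (+ β))) (δ-absorb A B (+ β) (w - + β) w A∣B (lemma w (+ β)))
             (δ-absorb A B (w - + β) (+ β) w A∣B refl) (δ-absorb B B (+ β) (w - + β) w ℕ∣.∣-refl (lemma w (+ β)))) ⟩
      ∑< n (λ β → κ w * δ A w * (κ′ (+ β) * δ A (+ β)) + (κ w * (δ B w - δ A w) * (κ′ (+ β) * δ B (+ β)) +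
                  - (κ w * δ A w) * (κ′ (+ β) * δ B (w - + β))))
        ≡⟨ ∑<-linear n (κ w * δ A w) (κ w * (δ B w - δ A w)) (- (κ w * δ A w)) (λ β → κ′ (+ β) * δ A (+ β))
                     (λ β → κ′ (+ β) * δ B (+ β)) (λ β → κ′ (+ β) * δ B (w - + β)) ⟩
      κ w * δ A w * ∑< n (λ β → κ′ (+ β) * δ A (+ β)) + (κ w * (δ B w - δ A w) * ∑< n (λ β → κ′ (+ β) * δ B (+ β)) +
        - (κ w * δ A w) * ∑< n (λ β → κ′ (+ β) * δ B (w - + β)))
        ≡⟨ cong₂ _+_ (cong (κ w * δ A w *_) (count₀ A countA))
                     (cong₂ _+_ (cong (κ w * (δ B w - δ A w) *_) (count₀ B countB)) (cong (- (κ w * δ A w) *_) (countB w))) ⟩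
      κ w * δ A w * x + (κ w * (δ B w - δ A w) * y + - (κ w * δ A w) * y)
        ≡⟨ lemma′ (κ w) (δ A w) (δ B w) x y ⟩
      κ w * (δ A w * (x - y - y) + δ B w * y)  ∎
      where
      open ≡-Reasoning
      lemma : ∀ w β → w - (w - β) ≡ β
      lemma = solve-∀
      lemma′ : ∀ k a b x y → k * a * x + (k * (b - a) * y + - (k * a) * y) ≡ k * (a * (x - y - y) + b * y)
      lemma′ = solve-∀

-- The product of two coset sums.

module CosetProduct
    (p q s t l d e : ℕ) (p-prime : Prime p) (q-prime : Prime q) (p≢q : p ≢ q)
    (1≤s : 1 ℕ.≤ s) (1≤t : 1 ℕ.≤ t) (p-odd : ¬ (2 ℕ∣.∣ p)) (d-odd : ¬ (2 ℕ∣.∣ d)) (e⊥d : ℕᶜ.Coprime e d)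
    (ordₚ : HasOrder (p ℕ.^ s) (+ l) d) (ord-q : HasOrder (q ℕ.^ t) (+ l) e)
    (p^s⊥q^t : ℕᶜ.Coprime (p ℕ.^ s) (q ℕ.^ t))
    (cases : OddOrder.UnitCases p s l d p-prime 1≤s p-odd d-odd ordₚ)
    (generates : CosetDecomposition.Generates p s q t l d e q-prime 1≤t p^s⊥q^t e⊥d ordₚ ord-q)
    (i i′ j : ℕ) (i<i′ : i ℕ.< i′) (i′<s : i′ ℕ.< s) (j<t : j ℕ.< t) where
  open import Data.Integer.Base using () renaming (_+_ to _+ᶻ_; _*_ to _*ᶻ_; -_ to -ᶻ_; _-_ to _-ᶻ_; _^_ to _^ᶻ_)
  open Congruence
  open PrimePower
  open Coset
  open Counting
  open OddOrder p s l d p-prime 1≤s p-odd d-odd ordₚ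
  open HalfCount p s l d p-prime 1≤s p-odd d-odd ordₚ cases
  open CosetDecomposition p s q t l d e q-prime 1≤t p^s⊥q^t e⊥d ordₚ ord-q

  open CyclicPolynomial l n
  open Polynomial (𝔽 l)
  open RangeSum ℤₚ.+-0-commutativeMonoid using (∑<)

  private instance
    p-nonZero = Prime.prime⇒nonZero p-prime
    q-nonZero = Prime.prime⇒nonZero q-prime
    p^s-nonZero = ℕₚ.m^n≢0 p s
    q^t-nonZero = ℕₚ.m^n≢0 q t
    n-nonZero = ℕₚ.m*n≢0 (p ℕ.^ s) (q ℕ.^ t)

  Q : ℕ → ℤ
  Q m = + (q ℕ.^ m)

  -- The residue modulo p^s is always compared with p^k q^j, whatever valuation m is under
  -- consideration; this lets the cosets for all m > j share one factor κ.
  K? : ∀ k z → Dec (Coset (p ℕ.^ s) l (+ (p ℕ.^ k) *ᶻ Q j) z)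
  K? k = coset? (p ℕ.^ s) l (+ (p ℕ.^ k) *ᶻ Q j)

  κ : ℕ → ℤ → ℤ
  κ k z = [ K? k z ]₁

  χ[_] : ℤ → Poly
  χ[ γ ] = ∑ (filter (C? n l γ) (allFin n)) (λ α → X^ Fin.toℕ α)

  -- The indicator of q-adic valuation m; modulo q ^ t the valuation is capped at t.
  ν : ℕ → ℤ → ℤ
  ν m z = δ (q ℕ.^ m) z -ᶻ [ m ℕₚ.<? t ]₁ *ᶻ δ (q ℕ.^ suc m) z

  ν-below : ∀ {m} → m ℕ.< t → ∀ z → ν m z ≡ δ (q ℕ.^ m) z -ᶻ δ (q ℕ.^ suc m) z
  ν-below {m} m<t z = cong (λ x → δ (q ℕ.^ m) z -ᶻ x)
    (trans (cong (_*ᶻ δ (q ℕ.^ suc m) z) ([]-yes (m ℕₚ.<? t) m<t)) (ℤₚ.*-identityˡ _))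

  ν-top : ∀ z → ν t z ≡ δ (q ℕ.^ t) z
  ν-top z = trans (cong (λ x → δ (q ℕ.^ t) z -ᶻ x)
      (cong (_*ᶻ δ (q ℕ.^ suc t) z) ([]-no (t ℕₚ.<? t) (ℕₚ.<-irrefl refl))))
    (ℤₚ.+-identityʳ (δ (q ℕ.^ t) z))

  -- A common name for the m-th summand, whether it turns out to be the sum over the coset of p^i
  -- q^m or of p^i q^m g.
  D : ℕ → Poly
  D m = P (λ z → κ i z *ᶻ ν m z)

  module _ (k r : ℕ) {γ c : ℤ} {m : ℕ} (m≤t : m ℕ.≤ t) (γ≡ : γ ≡ Q m *ᶻ c) (q∤c : ¬ (+ q ℤ∣.∣ c))
           (γ≅ : γ ≅ + (p ℕ.^ k) *ᶻ Q j *ᶻ (+ l) ^ᶻ r [ p ℕ.^ s ]) where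
    private
      K-to : ∀ {z} → Coset n l γ z → Coset (p ℕ.^ s) l (+ (p ℕ.^ k) *ᶻ Q j) z
      K-to z∈ = coset-⊆ r γ≅ (coset⇒cosetₚ generates γ≡ m≤t q∤c z∈)

      K-from : ∀ {z} → Coset (p ℕ.^ s) l (+ (p ℕ.^ k) *ᶻ Q j) z → Coset (p ℕ.^ s) l γ z
      K-from = coset-⊇ ordₚ r γ≅

      below-cases : ∀ {A B D E : Set} (a? : Dec A) (b? : Dec B) (d? : Dec D) (e? : Dec E) →
        (A → B) → (A → D) → (A → ¬ E) → (B → D → ¬ E → A) → (E → D) →
        [ b? ]₁ *ᶻ ([ d? ]₁ -ᶻ [ e? ]₁) ≡ [ a? ]₁
      below-cases (yes a) (no ¬b) d? e? f _ _ _ _ = contradiction (f a) ¬b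
      below-cases (yes a) (yes b) (no ¬d) e? _ f _ _ _ = contradiction (f a) ¬d
      below-cases (yes a) (yes b) (yes d) (yes e) _ _ f _ _ = contradiction e (f a)
      below-cases (yes a) (yes b) (yes d) (no ¬e) _ _ _ _ _ = refl
      below-cases (no ¬a) (no ¬b) d? e? _ _ _ _ _ = refl
      below-cases (no ¬a) (yes b) (yes d) (yes e) _ _ _ _ _ = refl
      below-cases (no ¬a) (yes b) (yes d) (no ¬e) _ _ _ f _ = contradiction (f b d ¬e) ¬a
      below-cases (no ¬a) (yes b) (no ¬d) (yes e) _ _ _ _ f = contradiction (f e) ¬d
      below-cases (no ¬a) (yes b) (no ¬d) (no ¬e) _ _ _ _ _ = refl

      top-cases : ∀ {A B D : Set} (a? : Dec A) (b? : Dec B) (d? : Dec D) →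
        (A → B) → (A → D) → (B → D → A) → [ b? ]₁ *ᶻ [ d? ]₁ ≡ [ a? ]₁
      top-cases (yes a) (no ¬b) d? f _ _ = contradiction (f a) ¬b
      top-cases (yes a) (yes b) (no ¬d) _ f _ = contradiction (f a) ¬d
      top-cases (yes a) (yes b) (yes d) _ _ _ = refl
      top-cases (no ¬a) (no ¬b) d? _ _ _ = refl
      top-cases (no ¬a) (yes b) (no ¬d) _ _ _ = refl
      top-cases (no ¬a) (yes b) (yes d) _ _ f = contradiction (f b d) ¬a

    indicator : ∀ z → κ k z *ᶻ ν m z ≡ [ coset? n l γ z ]₁
    indicator z = [ below , top ]′ (ℕₚ.m≤n⇒m<n∨m≡n m≤t)
      where
      below : m ℕ.< t → κ k z *ᶻ ν m z ≡ [ coset? n l γ z ]₁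
      below m<t = trans (cong (κ k z *ᶻ_) (ν-below m<t z))
        (below-cases (coset? n l γ z) (K? k z) (Q m ℤ∣.∣? z) (Q (suc m) ℤ∣.∣? z)
          K-to (coset⇒q^m∣ generates γ≡ m≤t q∤c) (coset⇒q^[1+m]∤ generates γ≡ m≤t q∤c m<t)
          (λ z∈ → cosetₚ⇒coset generates γ≡ m≤t q∤c (K-from z∈))
          (ℤ∣.∣-trans (ℤ∣.∣ᵤ⇒∣ (^-∣-^ q (ℕₚ.n≤1+n m)))))
      top : m ≡ t → κ k z *ᶻ ν m z ≡ [ coset? n l γ z ]₁
      top refl = trans (cong (κ k z *ᶻ_) (ν-top z))
        (top-cases (coset? n l γ z) (K? k z) (Q m ℤ∣.∣? z)
          K-to (coset⇒q^m∣ generates γ≡ m≤t q∤c)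
          (λ z∈ → cosetₚ⇒coset-top generates γ≡ m≤t q∤c refl (K-from z∈)))

    C-indicator : ∀ α → κ k (+ Fin.toℕ α) *ᶻ ν m (+ Fin.toℕ α) ≡ [ C? n l γ α ]₁
    C-indicator α = trans (indicator (+ Fin.toℕ α)) ([]-cong (coset? n l γ (+ Fin.toℕ α)) (C? n l γ α)
      (λ (r at e) → r , difference e) (λ (r , e) → r at congruent e))

    χ~P : χ[ γ ] ~ P (λ z → κ k z *ᶻ ν m z)
    χ~P = filtered-sum (C? n l γ) (λ z → κ k z *ᶻ ν m z) C-indicator X^_

  -- Below t each ν is a difference of consecutive divisibility indicators, and ν at t is the last
  -- indicator itself because the valuation is capped there.
  telescope : ∀ N a → a ℕ.+ N ≡ t → Σₚ.∑< (suc N) (λ k → D (a ℕ.+ k)) ~ P (λ z → κ i z *ᶻ δ (q ℕ.^ a) z)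
  telescope zero    a a+0≡t = ~-trans (coeff≡⇒~ (λ k → trans (coeff-+ (D (a ℕ.+ 0)) [] k) (ℤₚ.+-identityʳ _)))
    (~-trans (~-reflexive (cong D a+0≡t)) (P-cong (λ z →
      trans (cong (κ i z *ᶻ_) (ν-top z)) (cong (λ b → κ i z *ᶻ δ (q ℕ.^ b) z) (sym (trans (sym (ℕₚ.+-identityʳ a)) a+0≡t))))))
  telescope (suc N) a a+N≡t = begin
    D (a ℕ.+ 0) + Σₚ.∑< (suc N) (λ k → D (a ℕ.+ suc k))
      ≈⟨ +-cong-~ (~-reflexive (cong D (ℕₚ.+-identityʳ a)))
                 (Σₚ.∑<-cong (suc N) (λ k _ → ~-reflexive (cong D (ℕₚ.+-suc a k)))) ⟩
    D a + Σₚ.∑< (suc N) (λ k → D (suc a ℕ.+ k))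
      ≈⟨ +-cong-~ ~-refl (telescope N (suc a) (trans (sym (ℕₚ.+-suc a N)) a+N≡t)) ⟩
    D a + P (λ z → κ i z *ᶻ δ (q ℕ.^ suc a) z)
      ≈⟨ P-+ (λ z → κ i z *ᶻ ν a z) (λ z → κ i z *ᶻ δ (q ℕ.^ suc a) z) ⟩
    P (λ z → κ i z *ᶻ ν a z +ᶻ κ i z *ᶻ δ (q ℕ.^ suc a) z)
      ≈⟨ P-cong (λ z → trans (cong (λ x → κ i z *ᶻ x +ᶻ κ i z *ᶻ δ (q ℕ.^ suc a) z) (ν-below a<t z))
                             (lemma (κ i z) (δ (q ℕ.^ a) z) (δ (q ℕ.^ suc a) z))) ⟩
    P (λ z → κ i z *ᶻ δ (q ℕ.^ a) z)  ∎
    where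
    open SetoidReasoning ~-setoid
    a<t : a ℕ.< t
    a<t = subst (a ℕ.<_) a+N≡t (ℕₚ.m<m+n a ℕ.z<s)
    lemma : ∀ k x y → k *ᶻ (x -ᶻ y) +ᶻ k *ᶻ y ≡ k *ᶻ x
    lemma = solve-∀

  sum-above : Σₚ.listSum ⦅ j , t ⟧ D ~ P (λ z → κ i z *ᶻ δ (q ℕ.^ suc j) z)
  sum-above = begin
    Σₚ.listSum ⦅ j , t ⟧ D                              ≈⟨ Σₚ.listSum-filter-applyUpTo (j ℕₚ.<?_) (suc t) (λ k → k) D ⟩
    Σₚ.∑< (suc t) F                                     ≡⟨ cong (λ b → Σₚ.∑< b F) t≡ ⟨
    Σₚ.∑< (suc j ℕ.+ suc N) F                           ≈⟨ Σₚ.∑<-+ (suc j) (suc N) F ⟩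
    Σₚ.∑< (suc j) F + Σₚ.∑< (suc N) (F ∘ (suc j ℕ.+_))
      ≈⟨ +-cong-~ (Σₚ.∑<-ε (suc j) F (λ k k≤j → ~-reflexive (cong (λ b → if b then D k else [])
                      (dec-false (j ℕₚ.<? k) (ℕₚ.<⇒≱ k≤j)))))
                   (Σₚ.∑<-cong (suc N) (λ k _ → ~-reflexive (cong (λ b → if b then D (suc j ℕ.+ k) else [])
                      (dec-true (j ℕₚ.<? suc j ℕ.+ k) (ℕₚ.m≤m+n (suc j) k))))) ⟩
    Σₚ.∑< (suc N) (λ k → D (suc j ℕ.+ k))               ≈⟨ telescope N (suc j) (ℕₚ.m+[n∸m]≡n j<t) ⟩
    P (λ z → κ i z *ᶻ δ (q ℕ.^ suc j) z)                ∎
    where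
    open SetoidReasoning ~-setoid
    N = t ℕ.∸ suc j
    F : ℕ → Poly
    F k = if does (j ℕₚ.<? k) then D k else []
    t≡ : suc j ℕ.+ suc N ≡ suc t
    t≡ = trans (ℕₚ.+-suc (suc j) N) (cong suc (ℕₚ.m+[n∸m]≡n j<t))

  half-φ : ℤ
  half-φ = + (φ (p ℕ.^ (s ℕ.∸ i′)) ℕ./ 2)

  p∤q^ : ∀ m → ¬ (+ p ℤ∣.∣ Q m)
  p∤q^ m = subst (λ z → ¬ (+ p ℤ∣.∣ z)) (sym (pos-^ q m)) (∤-^ p-prime {+ q} (distinct-primes-∤ p-prime q-prime p≢q) m)

  q∤p^ : ∀ m → ¬ (+ q ℤ∣.∣ + (p ℕ.^ m))
  q∤p^ m = subst (λ z → ¬ (+ q ℤ∣.∣ z)) (sym (pos-^ p m)) (∤-^ q-prime {+ p} (distinct-primes-∤ q-prime p-prime (p≢q ∘ sym)) m)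

  -- Translation by β preserves the coset of p^i q^j modulo p^s, and so does translation by -β. As
  -- -β equals p^i′ q^j times a negated power of l, `coset-translate` allows an arbitrary cofactor
  -- x.
  absorb : ∀ β w → κ i′ β *ᶻ κ i (w -ᶻ β) ≡ κ i′ β *ᶻ κ i w
  absorb β w = []-guard (K? i′ β) (λ (r at β≅) → []-cong (K? i (w -ᶻ β)) (K? i w)
    (coset-resp-≅ (≡⇒≅ (lemma w β)) ∘ coset-translate cases {c = Q j} ((+ l) ^ᶻ r) i<i′ β≅)
    (coset-translate cases {c = Q j} (-ᶻ (+ l) ^ᶻ r) i<i′
      (≅-trans (neg-cong β≅) (≡⇒≅ (lemma′ (+ (p ℕ.^ i′)) (Q j) ((+ l) ^ᶻ r))))))
    where
    lemma : ∀ w β → w -ᶻ β +ᶻ β ≡ w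
    lemma = solve-∀
    lemma′ : ∀ P c x → -ᶻ (P *ᶻ c *ᶻ x) ≡ P *ᶻ c *ᶻ -ᶻ x
    lemma′ = solve-∀

  -- The conditions modulo p^s and modulo q^m are independent: `half-φ` residues satisfy the first,
  -- and a class modulo q^m has q^k lifts modulo q^t.
  count : ∀ k m → k ℕ.+ m ≡ t → ∀ w →
          ∑< n (λ β → κ i′ (+ β) *ᶻ δ (q ℕ.^ m) (w -ᶻ + β)) ≡ half-φ *ᶻ + (q ℕ.^ k)
  count k m k+m≡t w = begin
    ∑< n (λ β → κ i′ (+ β) *ᶻ δ (q ℕ.^ m) (w -ᶻ + β))
      ≡⟨ cong (λ B → ∑< (p ℕ.^ s ℕ.* B) (λ β → κ i′ (+ β) *ᶻ δ (q ℕ.^ m) (w -ᶻ + β)))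
           (trans (cong (q ℕ.^_) (sym k+m≡t)) (ℕₚ.^-distribˡ-+-* q k m)) ⟩
    ∑< (p ℕ.^ s ℕ.* (q ℕ.^ k ℕ.* q ℕ.^ m)) (λ β → κ i′ (+ β) *ᶻ δ (q ℕ.^ m) (w -ᶻ + β))
      ≡⟨ ∑<-independent (p ℕ.^ s) (q ℕ.^ k) (q ℕ.^ m) p^s⊥q^m (κ i′) (indicator-periodic i′<s (Q j) (p∤q^ j)) w ⟩
    ∑< (p ℕ.^ s) (λ a → κ i′ (+ a)) *ᶻ + (q ℕ.^ k)
      ≡⟨ cong (_*ᶻ + (q ℕ.^ k)) (∑coset i′<s (Q j) (p∤q^ j)) ⟩
    half-φ *ᶻ + (q ℕ.^ k)  ∎
    where
    open ≡-Reasoning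
    instance _ = ℕₚ.m^n≢0 q m
    p^s⊥q^m : ℕᶜ.Coprime (p ℕ.^ s) (q ℕ.^ m)
    p^s⊥q^m (a , b) = p^s⊥q^t (a , ℕ∣.∣-trans b (^-∣-^ q (subst (m ℕ.≤_) k+m≡t (ℕₚ.m≤n+m m k))))

  coefficient-a coefficient-b : ℤ
  coefficient-a = half-φ *ᶻ (+ q -ᶻ + 2) *ᶻ + (q ℕ.^ (t ℕ.∸ j ℕ.∸ 1))
  coefficient-b = half-φ *ᶻ + φ (q ℕ.^ (t ℕ.∸ j))

  f : ℕ → ℤ → ℤ
  f k z = κ k z *ᶻ ν j z

  f-periodic : ∀ {a b} → a ≅ b [ n ] → f i a ≡ f i b
  f-periodic {a} {b} e = cong₂ _*ᶻ_
    (indicator-periodic (ℕₚ.<-trans i<i′ i′<s) (Q j) (p∤q^ j) (≅-weaken (ℕ∣.m∣m*n (q ℕ.^ t)) e))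
    (cong₂ _-ᶻ_ (δ-periodic (ℕₚ.<⇒≤ j<t)) (cong ([ j ℕₚ.<? t ]₁ *ᶻ_) (δ-periodic j<t)))
    where
    δ-periodic : ∀ {m} → m ℕ.≤ t → δ (q ℕ.^ m) a ≡ δ (q ℕ.^ m) b
    δ-periodic m≤t = δ-cong (≅-weaken (ℕ∣.∣-trans (^-∣-^ q m≤t) (ℕ∣.n∣m*n (p ℕ.^ s))) e)

  γ : ℕ → ℕ → ℤ
  γ k m = + (p ℕ.^ k ℕ.* q ℕ.^ m)

  γ≡ : ∀ k m → γ k m ≡ Q m *ᶻ + (p ℕ.^ k)
  γ≡ k m = trans (cong +_ (ℕₚ.*-comm (p ℕ.^ k) (q ℕ.^ m))) (ℤₚ.pos-* (q ℕ.^ m) (p ℕ.^ k))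

  γ≅ : ∀ k → γ k j ≅ + (p ℕ.^ k) *ᶻ Q j *ᶻ (+ l) ^ᶻ 0 [ p ℕ.^ s ]
  γ≅ k = ≡⇒≅ (trans (ℤₚ.pos-* (p ℕ.^ k) (q ℕ.^ j)) (sym (ℤₚ.*-identityʳ _)))

  -- With h = `half-φ` and k = t - j - 1, the two counts are x = h q^(k+1) and y = h q^k. Hence x -
  -- 2y = h (q - 2) q^k and x - y = h φ(q^(k+1)).
  χχ~ : χ[ γ i j ] * χ[ γ i′ j ] ~ coefficient-a • χ[ γ i j ] + coefficient-b • Σₚ.listSum ⦅ j , t ⟧ D
  χχ~ = begin
    χ[ γ i j ] * χ[ γ i′ j ]
      ≈⟨ convolution (C? n l (γ i j)) (C? n l (γ i′ j)) (f i) (f i′)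
           (C-indicator i 0 (ℕₚ.<⇒≤ j<t) (γ≡ i j) (q∤p^ i) (γ≅ i)) (C-indicator i′ 0 (ℕₚ.<⇒≤ j<t) (γ≡ i′ j) (q∤p^ i′) (γ≅ i′)) f-periodic ⟩
    P (λ w → ∑< n (λ β → f i′ (+ β) *ᶻ f i (w -ᶻ + β)))
      ≈⟨ P-cong pointwise ⟩
    P (λ w → coefficient-a *ᶻ f i w +ᶻ coefficient-b *ᶻ (κ i w *ᶻ δ (q ℕ.^ suc j) w))
      ≈⟨ P-+ (λ w → coefficient-a *ᶻ f i w) (λ w → coefficient-b *ᶻ (κ i w *ᶻ δ (q ℕ.^ suc j) w)) ⟨
    P (λ w → coefficient-a *ᶻ f i w) + P (λ w → coefficient-b *ᶻ (κ i w *ᶻ δ (q ℕ.^ suc j) w))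
      ≈⟨ +-cong-~ (P-• coefficient-a (f i)) (P-• coefficient-b (λ w → κ i w *ᶻ δ (q ℕ.^ suc j) w)) ⟨
    coefficient-a • P (f i) + coefficient-b • P (λ w → κ i w *ᶻ δ (q ℕ.^ suc j) w)
      ≈⟨ +-cong-~ (•-cong coefficient-a (χ~P i 0 (ℕₚ.<⇒≤ j<t) (γ≡ i j) (q∤p^ i) (γ≅ i))) (•-cong coefficient-b sum-above) ⟨
    coefficient-a • χ[ γ i j ] + coefficient-b • Σₚ.listSum ⦅ j , t ⟧ D  ∎
    where
    open SetoidReasoning ~-setoid
    k = t ℕ.∸ suc j
    t∸j≡ : t ℕ.∸ j ≡ suc k
    t∸j≡ = ℕₚ.+-∸-assoc 1 j<t
    A B : ℕ
    A = q ℕ.^ j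
    B = q ℕ.^ suc j
    y = half-φ *ᶻ + (q ℕ.^ k)
    x = half-φ *ᶻ + (q ℕ.^ suc k)
    a≡ : coefficient-a ≡ half-φ *ᶻ (+ q -ᶻ + 2) *ᶻ + (q ℕ.^ k)
    a≡ = cong (λ e → half-φ *ᶻ (+ q -ᶻ + 2) *ᶻ + (q ℕ.^ (e ℕ.∸ 1))) t∸j≡
    b≡ : coefficient-b ≡ half-φ *ᶻ (+ q *ᶻ + (q ℕ.^ k) -ᶻ + (q ℕ.^ k))
    b≡ = cong (half-φ *ᶻ_) (trans (cong (λ e → + φ (q ℕ.^ e)) t∸j≡) (φ-prime-power q-prime k))
    lemma : ∀ h q Q κ a b → κ *ᶻ (a *ᶻ (h *ᶻ (q *ᶻ Q) -ᶻ h *ᶻ Q -ᶻ h *ᶻ Q) +ᶻ b *ᶻ (h *ᶻ Q)) ≡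
      h *ᶻ (q -ᶻ + 2) *ᶻ Q *ᶻ (κ *ᶻ (a -ᶻ b)) +ᶻ h *ᶻ (q *ᶻ Q -ᶻ Q) *ᶻ (κ *ᶻ b)
    lemma = solve-∀
    f≡ : ∀ m z → f m z ≡ κ m z *ᶻ (δ A z -ᶻ δ B z)
    f≡ m z = cong (κ m z *ᶻ_) (ν-below j<t z)
    pointwise : ∀ w → ∑< n (λ β → f i′ (+ β) *ᶻ f i (w -ᶻ + β)) ≡
                      coefficient-a *ᶻ f i w +ᶻ coefficient-b *ᶻ (κ i w *ᶻ δ B w)
    pointwise w = trans
      (RangeSum.∑<-cong ℤₚ.+-0-commutativeMonoid n (λ β _ → cong₂ _*ᶻ_ (f≡ i′ (+ β)) (f≡ i (w -ᶻ + β))))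
      (trans (ConvolutionCount.convolution-count n A B (^-∣-^ q (ℕₚ.n≤1+n j)) (κ i) (κ i′) x y absorb
        (count (suc k) j (trans (sym (ℕₚ.+-suc k j)) (ℕₚ.m∸n+n≡m j<t))) (count k (suc j) (ℕₚ.m∸n+n≡m j<t)) w)
      (trans (cong (λ x → κ i w *ᶻ (δ A w *ᶻ (half-φ *ᶻ x -ᶻ y -ᶻ y) +ᶻ δ B w *ᶻ y)) (ℤₚ.pos-* q (q ℕ.^ k)))
      (trans (lemma half-φ (+ q) (+ (q ℕ.^ k)) (κ i w) (δ A w) (δ B w))
        (sym (cong₂ _+ᶻ_ (cong₂ _*ᶻ_ a≡ (f≡ i w)) (cong (_*ᶻ (κ i w *ᶻ δ B w)) b≡))))))

  γ-power : ∀ {m} → j ℕ.< m → γ i m ≡ + (p ℕ.^ i) *ᶻ Q j *ᶻ (+ q) ^ᶻ (m ℕ.∸ j)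
  γ-power {m} j<m = begin
    + (p ℕ.^ i ℕ.* q ℕ.^ m)                            ≡⟨ ℤₚ.pos-* (p ℕ.^ i) (q ℕ.^ m) ⟩
    + (p ℕ.^ i) *ᶻ Q m                                 ≡⟨ cong (λ k → + (p ℕ.^ i) *ᶻ Q k) (ℕₚ.m+[n∸m]≡n (ℕₚ.<⇒≤ j<m)) ⟨
    + (p ℕ.^ i) *ᶻ Q (j ℕ.+ (m ℕ.∸ j))                 ≡⟨ cong (λ k → + (p ℕ.^ i) *ᶻ + k) (ℕₚ.^-distribˡ-+-* q j (m ℕ.∸ j)) ⟩
    + (p ℕ.^ i) *ᶻ + (q ℕ.^ j ℕ.* q ℕ.^ (m ℕ.∸ j))     ≡⟨ cong (+ (p ℕ.^ i) *ᶻ_) (ℤₚ.pos-* (q ℕ.^ j) (q ℕ.^ (m ℕ.∸ j))) ⟩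
    + (p ℕ.^ i) *ᶻ (Q j *ᶻ Q (m ℕ.∸ j))                ≡⟨ cong (λ z → + (p ℕ.^ i) *ᶻ (Q j *ᶻ z)) (pos-^ q (m ℕ.∸ j)) ⟩
    + (p ℕ.^ i) *ᶻ (Q j *ᶻ (+ q) ^ᶻ (m ℕ.∸ j))         ≡⟨ ℤₚ.*-assoc (+ (p ℕ.^ i)) (Q j) _ ⟨
    + (p ℕ.^ i) *ᶻ Q j *ᶻ (+ q) ^ᶻ (m ℕ.∸ j)           ∎
    where open ≡-Reasoning

  χ~D : ∀ {m} r → j ℕ.< m → m ℕ.≤ t → (+ q) ^ᶻ (m ℕ.∸ j) ≅ (+ l) ^ᶻ r [ p ℕ.^ s ] → χ[ γ i m ] ~ D m
  χ~D {m} r j<m m≤t e = χ~P i r m≤t (γ≡ i m) (q∤p^ i)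
    (≅-trans (≡⇒≅ (γ-power j<m)) (*-congˡ (+ (p ℕ.^ i) *ᶻ Q j) e))

  χ*~D : ∀ {m} g r → ¬ (+ q ℤ∣.∣ g) → j ℕ.< m → m ℕ.≤ t →
         (+ q) ^ᶻ (m ℕ.∸ j) *ᶻ g ≅ (+ l) ^ᶻ r [ p ℕ.^ s ] → χ[ γ i m *ᶻ g ] ~ D m
  χ*~D {m} g r q∤g j<m m≤t e = χ~P i r m≤t
    (trans (cong (_*ᶻ g) (γ≡ i m)) (ℤₚ.*-assoc (Q m) (+ (p ℕ.^ i)) g))
    ([ q∤p^ i , q∤g ]′ ∘ euclid q-prime (+ (p ℕ.^ i)) g)
    (≅-trans (≡⇒≅ (trans (cong (_*ᶻ g) (γ-power j<m)) (ℤₚ.*-assoc (+ (p ℕ.^ i) *ᶻ Q j) _ g)))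
             (*-congˡ (+ (p ℕ.^ i) *ᶻ Q j) e))

  in-range : All (λ m → j ℕ.< m × m ℕ.≤ t) ⦅ j , t ⟧
  in-range = All.zip (Allₚ.all-filter (j ℕₚ.<?_) (upTo (suc t)) ,
    Allₚ.filter⁺ (j ℕₚ.<?_) (Allₚ.applyUpTo⁺₁ (λ k → k) (suc t) ℕₚ.≤-pred))

  even? : ∀ m → Dec (2 ℕ∣.∣ m ℕ.∸ j)
  even? m = 2 ℕ∣.∣? (m ℕ.∸ j)

  residue-case : QuadraticResidue (+ q) p →
    χ[ γ i j ] * χ[ γ i′ j ] ~ coefficient-a • χ[ γ i j ] + coefficient-b • ∑ ⦅ j , t ⟧ (λ m → χ[ γ i m ])
  residue-case q-residue = ~-trans χχ~ (+-cong-~ ~-refl (•-cong coefficient-b (~-sym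
    (Σₚ.listSum-cong ⦅ j , t ⟧ (All.map (λ {m} (j<m , m≤t) → χ~D (r ℕ.* (m ℕ.∸ j)) j<m m≤t
      (≅-trans (^-cong (m ℕ.∸ j) q≅) (≡⇒≅ (ℤₚ.^-*-assoc (+ l) r (m ℕ.∸ j))))) in-range)))))
    where
    q-power : ∃ λ r → + q ≅ (+ l) ^ᶻ r [ p ℕ.^ s ]
    q-power = residue⇒power cases (distinct-primes-∤ p-prime q-prime p≢q) q-residue
    r = proj₁ q-power
    q≅ = proj₂ q-power

  -- Since q ≡ -l^r, the power q^(m-j) has sign (-1)^(m-j). For even m - j it is a power of l; for
  -- odd m - j the factor g ≡ -l^r′ supplies the compensating sign.
  nonresidue-case : ∀ g → ¬ (+ q ℤ∣.∣ g) → (∃ λ r → g ≅ -ᶻ (+ l) ^ᶻ r [ p ℕ.^ s ]) → QuadraticNonresidue (+ q) p →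
    χ[ γ i j ] * χ[ γ i′ j ] ~ coefficient-a • χ[ γ i j ] + coefficient-b •
      (∑ ⦅ j , t ⟧-odd (λ m → χ[ γ i m *ᶻ g ]) + ∑ ⦅ j , t ⟧-even (λ m → χ[ γ i m ]))
  nonresidue-case g q∤g (r′ , g≅) q-nonresidue = ~-trans χχ~ (+-cong-~ ~-refl (•-cong coefficient-b (~-sym (~-trans
    (+-cong-~
      (Σₚ.listSum-cong ⦅ j , t ⟧-odd (All.map odd
        (All.zip (Allₚ.all-filter (¬? ∘ even?) ⦅ j , t ⟧ , Allₚ.filter⁺ (¬? ∘ even?) in-range))))
      (Σₚ.listSum-cong ⦅ j , t ⟧-even (All.map even
        (All.zip (Allₚ.all-filter even? ⦅ j , t ⟧ , Allₚ.filter⁺ even? in-range)))))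
    (Σₚ.listSum-partition even? ⦅ j , t ⟧ D)))))
    where
    q-power : ∃ λ r → + q ≅ -ᶻ (+ l) ^ᶻ r [ p ℕ.^ s ]
    q-power = nonresidue⇒-power cases (distinct-primes-∤ p-prime q-prime p≢q) q-nonresidue
    r = proj₁ q-power
    q≅ = proj₂ q-power
    lemma : ∀ x y → -ᶻ x *ᶻ -ᶻ y ≡ x *ᶻ y
    lemma = solve-∀
    even : ∀ {m} → 2 ℕ∣.∣ m ℕ.∸ j × j ℕ.< m × m ℕ.≤ t → χ[ γ i m ] ~ D m
    even {m} (2∣k , j<m , m≤t) = χ~D (r ℕ.* (m ℕ.∸ j)) j<m m≤t
      (≅-trans (^-cong (m ℕ.∸ j) q≅)
        (≡⇒≅ (trans (neg-^-even ((+ l) ^ᶻ r) 2∣k) (ℤₚ.^-*-assoc (+ l) r (m ℕ.∸ j)))))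
    odd : ∀ {m} → ¬ (2 ℕ∣.∣ m ℕ.∸ j) × j ℕ.< m × m ℕ.≤ t → χ[ γ i m *ᶻ g ] ~ D m
    odd {m} (2∤k , j<m , m≤t) = χ*~D g (r ℕ.* (m ℕ.∸ j) ℕ.+ r′) q∤g j<m m≤t (begin
      (+ q) ^ᶻ (m ℕ.∸ j) *ᶻ g                             ≈⟨ *-cong (^-cong (m ℕ.∸ j) q≅) g≅ ⟩
      (-ᶻ (+ l) ^ᶻ r) ^ᶻ (m ℕ.∸ j) *ᶻ -ᶻ (+ l) ^ᶻ r′      ≡⟨ cong (_*ᶻ -ᶻ (+ l) ^ᶻ r′) (neg-^-odd ((+ l) ^ᶻ r) 2∤k) ⟩
      -ᶻ (((+ l) ^ᶻ r) ^ᶻ (m ℕ.∸ j)) *ᶻ -ᶻ (+ l) ^ᶻ r′    ≡⟨ lemma (((+ l) ^ᶻ r) ^ᶻ (m ℕ.∸ j)) ((+ l) ^ᶻ r′) ⟩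
      ((+ l) ^ᶻ r) ^ᶻ (m ℕ.∸ j) *ᶻ (+ l) ^ᶻ r′            ≡⟨ cong (_*ᶻ (+ l) ^ᶻ r′) (ℤₚ.^-*-assoc (+ l) r (m ℕ.∸ j)) ⟩
      (+ l) ^ᶻ (r ℕ.* (m ℕ.∸ j)) *ᶻ (+ l) ^ᶻ r′           ≡⟨ ℤₚ.^-distribˡ-+-* (+ l) (r ℕ.* (m ℕ.∸ j)) r′ ⟨
      (+ l) ^ᶻ (r ℕ.* (m ℕ.∸ j) ℕ.+ r′)                   ∎)
      where open ≅-Reasoning (p ℕ.^ s)

-- Parity of φ(p^s)/2 and its coprimality to φ(q^t).

module TotientHalf where
  open import Data.Integer.Base using (_*_; _+_; _-_)
  open Counting using (φ-prime-power)
  open PrimePower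

  -- For p = 4a + 3 the totient of p^(s+1) is (4a + 2) p^s = 2 (2a + 1) p^s, and both 2a + 1 and p^s
  -- are odd.
  φ-half-odd : ∀ {p s} → Prime p → 1 ℕ.≤ s → p ℕ.% 4 ≡ 3 → ∃ λ d → φ (p ℕ.^ s) ≡ 2 ℕ.* d × ¬ (2 ℕ∣.∣ d)
  φ-half-odd {p} {suc s} p-prime _ p%4≡3 = d , ℤₚ.+-injective φ≡2d , 2∤d
    where
    a = p ℕ./ 4
    P = p ℕ.^ s
    d = (1 ℕ.+ a ℕ.* 2) ℕ.* P
    p≡ : + p ≡ + 3 + + a * + 4
    p≡ = trans (cong +_ (trans (ℕᵈ.m≡m%n+[m/n]*n p 4) (cong (ℕ._+ a ℕ.* 4) p%4≡3)))
               (cong (λ z → + 3 + z) (ℤₚ.pos-* a 4))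
    lemma : ∀ a P → (+ 3 + a * + 4) * P - P ≡ + 2 * ((1ℤ + a * + 2) * P)
    lemma = solve-∀
    φ≡2d : + φ (p ℕ.^ suc s) ≡ + (2 ℕ.* d)
    φ≡2d = begin
      + φ (p ℕ.^ suc s)                   ≡⟨ φ-prime-power p-prime s ⟩
      + p * + P - + P                     ≡⟨ cong (λ z → z * + P - + P) p≡ ⟩
      (+ 3 + + a * + 4) * + P - + P       ≡⟨ lemma (+ a) (+ P) ⟩
      + 2 * ((1ℤ + + a * + 2) * + P)      ≡⟨ cong (λ z → + 2 * ((1ℤ + z) * + P)) (ℤₚ.pos-* a 2) ⟨
      + 2 * (+ (1 ℕ.+ a ℕ.* 2) * + P)     ≡⟨ cong (+ 2 *_) (ℤₚ.pos-* (1 ℕ.+ a ℕ.* 2) P) ⟨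
      + 2 * + d                           ≡⟨ ℤₚ.pos-* 2 d ⟨
      + (2 ℕ.* d)                         ∎
      where open ≡-Reasoning
    2∤1+2b : ∀ b → ¬ (2 ℕ∣.∣ 1 ℕ.+ b ℕ.* 2)
    2∤1+2b b 2∣ = contradiction
      (ℕ∣.∣1⇒≡1 (ℕ∣.∣m+n∣m⇒∣n (subst (2 ℕ∣.∣_) (ℕₚ.+-comm 1 (b ℕ.* 2)) 2∣) (ℕ∣.n∣m*n b))) λ ()
    2∤p : ¬ (+ 2 ℤ∣.∣ + p)
    -- Here p = 3 + 4a is read as 1 + 2 (1 + 2a).
    2∤p 2∣p = 2∤1+2b (1 ℕ.+ a ℕ.* 2) (subst (2 ℕ∣.∣_) (trans (ℕᵈ.m≡m%n+[m/n]*n p 4)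
      (trans (cong (ℕ._+ a ℕ.* 4) p%4≡3) (cong (3 ℕ.+_) (sym (ℕₚ.*-assoc a 2 2))))) (ℤ∣.∣⇒∣ᵤ 2∣p))
    2∤d : ¬ (2 ℕ∣.∣ d)
    2∤d 2∣d = [ 2∤1+2b a , ∤-^ Prime.prime[2] {+ p} 2∤p s ∘ subst (+ 2 ℤ∣.∣_) (pos-^ p s) ∘ ℤ∣.∣ᵤ⇒∣ ]′
      (Prime.euclidsLemma (1 ℕ.+ a ℕ.* 2) P Prime.prime[2] 2∣d)

  -- A common divisor of e and d divides the gcd, so it is 1 or 2, and 2 does not divide d.
  gcd≡2⇒coprime : ∀ {d e} → ¬ (2 ℕ∣.∣ d) → gcd (2 ℕ.* d) e ≡ 2 → ℕᶜ.Coprime e d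
  gcd≡2⇒coprime {d} {e} 2∤d gcd≡2 {x} (x∣e , x∣d)
    with Prime.prime⇒irreducible Prime.prime[2] (subst (x ℕ∣.∣_) gcd≡2 (gcd-greatest (ℕ∣.∣n⇒∣m*n 2 x∣d) x∣e))
  ... | inj₁ x≡1  = x≡1
  ... | inj₂ refl = contradiction x∣d 2∤d

open import Data.Nat using (_∸_; _≤_; _<_; _^_; _/_; _%_)
open import Data.Nat.Divisibility using (_∣_)

theorem4p13 :
    (s t p q l : ℕ) → 1 ≤ s → 1 ≤ t →
    Prime p → Prime q → Prime l → p ≢ q → p ≢ l → q ≢ l →
    ¬ (2 ∣ p) → ¬ (2 ∣ q) → p % 4 ≡ 3 →
    HasOrder (p ^ s) (+ l) (φ (p ^ s) / 2) →
    HasOrder (q ^ t) (+ l) (φ (q ^ t)) →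
    gcd (φ (p ^ s)) (φ (q ^ t)) ≡ 2 →
    (g : ℤ) → PrimitiveRoot g (p ^ s) → PrimitiveRoot g (q ^ t) →
    (i i' j : ℕ) → i < i' → i' ≤ s ∸ 1 → j ≤ t ∸ 1 →
    let open Cosets p q s t l g
        c = + (φ (p ^ (s ∸ i')) / 2)
        a = c ℤ.* (+ q ℤ.- + 2) ℤ.* + (q ^ (t ∸ j ∸ 1))
        b = c ℤ.* + φ (q ^ (t ∸ j))
    in
    (QuadraticResidue (+ q) p →
      χ i j * χ i' j
        ≈ a • χ i j + b • ∑ ⦅ j , t ⟧ (λ m → χ i m)
        ⟨mod X^n-1 ⟩)
    ×
    (QuadraticNonresidue (+ q) p →
      χ i j * χ i' j
        ≈ a • χ i j + b • (∑ ⦅ j , t ⟧-odd (λ m → χ* i m) + ∑ ⦅ j , t ⟧-even (λ m → χ i m))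
        ⟨mod X^n-1 ⟩)
theorem4p13 s t p q l 1≤s 1≤t p-prime q-prime _ p≢q _ _ p-odd _ p%4≡3 ordₚ ord-q gcd≡2
            g g-primitiveₚ g-primitive-q i i' j i<i' i'≤s-1 j≤t-1 =
  ~⇒≈⟨mod⟩ ∘ residue-case , ~⇒≈⟨mod⟩ ∘ nonresidue-case g q∤g g-power
  where
  open Congruence
  open Order
  open PrimePower

  half : ∃ λ d → φ (p ^ s) ≡ 2 ℕ.* d × ¬ (2 ∣ d)
  half = TotientHalf.φ-half-odd p-prime 1≤s p%4≡3

  d : ℕ
  d = proj₁ half

  φ≡2d : φ (p ^ s) ≡ 2 ℕ.* d
  φ≡2d = proj₁ (proj₂ half)

  d-odd : ¬ (2 ∣ d)
  d-odd = proj₂ (proj₂ half)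

  ordₚ′ : HasOrder (p ^ s) (+ l) d
  ordₚ′ = subst (HasOrder (p ^ s) (+ l))
    (trans (cong (_/ 2) (trans φ≡2d (ℕₚ.*-comm 2 d))) (ℕᵈ.m*n/n≡m d 2)) ordₚ

  e⊥d : ℕᶜ.Coprime (φ (q ^ t)) d
  e⊥d = TotientHalf.gcd≡2⇒coprime d-odd (subst (λ N → gcd N (φ (q ^ t)) ≡ 2) φ≡2d gcd≡2)

  p^s⊥q^t : ℕᶜ.Coprime (p ^ s) (q ^ t)
  p^s⊥q^t = ∤⇒coprime-^ q-prime {+ (p ^ s)} t (subst (λ z → ¬ (+ q ℤ∣.∣ z)) (sym (pos-^ p s))
    (∤-^ q-prime {+ p} (distinct-primes-∤ q-prime p-prime (p≢q ∘ sym)) s))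

  primitive-root-∤ : ∀ {r k} → Prime r → 1 ≤ k → PrimitiveRoot g (r ^ k) → ¬ (+ r ℤ∣.∣ g)
  primitive-root-∤ {r} {k} r-prime 1≤k g-primitive = subst (λ z → ¬ (+ r ℤ∣.∣ z)) (ℤₚ.^-identityʳ g)
    (coprime⇒∤ r-prime {g ℤ.^ 1} 1≤k (^-coprime (r ^ k) g (φ (r ^ k)) g-primitive 1))

  q∤g : ¬ (+ q ℤ∣.∣ g)
  q∤g = primitive-root-∤ q-prime 1≤t g-primitive-q

  open OddOrder p s l d p-prime 1≤s p-odd d-odd ordₚ′

  -- The order of g is 2d, which exceeds d because d is positive.
  g^d≇1 : ¬ (g ℤ.^ d ≅ 1ℤ [ p ^ s ])
  g^d≇1 g^d≅1 = ℕₚ.<⇒≱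
    (ℕₚ.m<m+n d (ℕₚ.≤-trans (order>0 (p ^ s) (+ l) d ordₚ′) (ℕₚ.≤-reflexive (sym (ℕₚ.+-identityʳ d)))))
    (subst (_≤ d) φ≡2d
      (order-minimal (p ^ s) g (φ (p ^ s)) g-primitiveₚ d (order>0 (p ^ s) (+ l) d ordₚ′) g^d≅1))

  g-power : ∃ λ r → g ≅ ℤ.- (+ l) ℤ.^ r [ p ^ s ]
  g-power = order≢d⇒-power (unit-cases φ≡2d) {g} (primitive-root-∤ p-prime 1≤s g-primitiveₚ) g^d≇1

  -- Truncated subtraction makes 0 ≤ 0 ∸ 1 true, so positivity of b is what yields the strict bound.
  below-pred : ∀ {a b} → 1 ≤ b → a ≤ b ∸ 1 → a < b
  below-pred {b = suc b} _ a≤b = ℕ.s≤s a≤b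

  open CosetProduct p q s t l d (φ (q ^ t)) p-prime q-prime p≢q 1≤s 1≤t p-odd d-odd e⊥d ordₚ′ ord-q p^s⊥q^t
    (unit-cases φ≡2d)
    (CosetDecomposition.l^d-generates p s q t l d (φ (q ^ t)) q-prime 1≤t p^s⊥q^t e⊥d ordₚ′ ord-q refl)
    i i' j i<i' (below-pred 1≤s i'≤s-1) (below-pred 1≤t j≤t-1)
    using (residue-case; nonresidue-case)
  open CyclicPolynomial l (p ^ s ℕ.* q ^ t) using (~⇒≈⟨mod⟩)
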